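{- Fix $0<c<1$. Let $m=cn$ and let $\pi$ be chosen uniformly at random from $\mathrm{PF}(m,n)$. Then, as $n\to\infty$, $$\operatorname{Var}(\pi_1)=\frac1{12}n^2-\frac{c}{6(1-c)}n+o(n),\qquad \operatorname{Cov}(\pi_1,\pi_2)\to-\frac1{4(1-c)^2}.$$
   Context: Write $[n]=\{1,\dots,n\}$. For integers $0\le m\le n$, $\mathrm{PF}(m,n)$ denotes the set of parking functions with $m$ cars and $n$ spots: sequences $(\pi_1,\dots,\pi_m)\in[n]^m$ such that, when cars $1,\dots,m$ enter in order a one-way street with spots $1,\dots,n$ and car $i$ parks in spot $\pi_i$ if it is free and otherwise in the first free spot after $\pi_i$, all cars park. Equivalently, the non-decreasing rearrangement $(\lambda_1,\dots,\lambda_m)$ satisfies $\lambda_i\le n-m+i$ for all $i$. The limit $n\to\infty$ is along integers $n$ with $cn$ an integer; $c$ is fixed. -}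

module Defs where

open import Data.Fin.Base using (Fin; zero; suc; toℕ)
open import Data.Fin.Subset using (Subset; inside; outside; ⊥)
open import Data.Integer.Base using (+_)
open import Data.List.Base as List using (List; []; _∷_; length)
open import Data.Maybe.Base as Maybe using (Maybe; just; nothing; _>>=_)
open import Data.Maybe using (Is-just)
import Data.Maybe.Relation.Unary.Any as Any
open import Data.Nat.Base using (ℕ; zero; suc)
open import Data.Rational.Base
open import Data.Rational.Properties
  using (pos⇒nonZero; pos*pos⇒pos; +-monoˡ-<; +-inverseʳ)
open import Data.Unit.Base using (tt)
open import Data.Vec.Base using (Vec; []; _∷_; lookup)
open import Relation.Nullary.Decidable using (Dec; yes)
open import Relation.Binary.PropositionalEquality using (subst)

ℕ→ℚ : ℕ → ℚ
ℕ→ℚ n = + n / 1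

-- A street with n spots is given by the subset of its occupied spots;
-- spot number s ∈ {1,…,n} is the element of Fin n with toℕ equal to s - 1.

parkFirstFree : ∀ {n} → Subset n → Maybe (Subset n)
parkFirstFree []            = nothing
parkFirstFree (outside ∷ S) = just (inside ∷ S)
parkFirstFree (inside  ∷ S) = Maybe.map (inside ∷_) (parkFirstFree S)

-- The car goes to its preferred spot and takes the first free spot from there
-- on; the result is nothing if there is none.

parkCar : ∀ {n} → Fin n → Subset n → Maybe (Subset n)
parkCar zero    S       = parkFirstFree S
parkCar (suc i) (s ∷ S) = Maybe.map (s ∷_) (parkCar i S)

parkAll : ∀ {m n} → Vec (Fin n) m → Subset n → Maybe (Subset n)
parkAll []       S = just S
parkAll (p ∷ ps) S = parkCar p S >>= parkAll ps

IsParkingFunction : ∀ {m n} → Vec (Fin n) m → Set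
IsParkingFunction ps = Is-just (parkAll ps ⊥)

isParkingFunction? : ∀ {m n} (ps : Vec (Fin n) m) → Dec (IsParkingFunction ps)
isParkingFunction? ps = Any.dec (λ _ → yes tt) (parkAll ps ⊥)

-- Every element of [n]^m, listed exactly once.

sequences : ∀ m n → List (Vec (Fin n) m)
sequences zero    n = [] ∷ []
sequences (suc m) n =
  List.cartesianProductWith _∷_ (List.allFin n) (sequences m n)

PF : ∀ m n → List (Vec (Fin n) m)
PF m n = List.filter isParkingFunction? (sequences m n)

π : ∀ {m n} → Fin m → Vec (Fin n) m → ℚ
π i ps = ℕ→ℚ (suc (toℕ (lookup ps i)))

-- Moments under the uniform distribution on a finite sample space, given as a
-- list of its elements without repetition.  The value for the empty list is a
-- convention; PF m n is non-empty whenever m ≤ n.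

module _ {A : Set} where

  sumℚ : List A → (A → ℚ) → ℚ
  sumℚ Ω X = List.foldr (λ ω s → X ω + s) 0ℚ Ω

  𝔼 : List A → (A → ℚ) → ℚ
  𝔼 []          X = 0ℚ
  𝔼 Ω@(_ ∷ _) X = (+ 1 / length Ω) * sumℚ Ω X

  Cov : List A → (A → ℚ) → (A → ℚ) → ℚ
  Cov Ω X Y = 𝔼 Ω (λ ω → (X ω - 𝔼 Ω X) * (Y ω - 𝔼 Ω Y))

  Var : List A → (A → ℚ) → ℚ
  Var Ω X = Cov Ω X X

p<1⇒1-p-positive : ∀ {p} → p < 1ℚ → Positive (1ℚ - p)
p<1⇒1-p-positive {p} p<1 =
  positive (subst (_< 1ℚ - p) (+-inverseʳ p) (+-monoˡ-< (- p) p<1))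

-- A real c with cn an integer for some n ≥ 1 is rational, so ℚ loses no case.

module Constants (c : ℚ) (c<1 : c < 1ℚ) where

  instance
    1-c-positive : Positive (1ℚ - c)
    1-c-positive = p<1⇒1-p-positive c<1

    6[1-c]-nonZero : NonZero (ℕ→ℚ 6 * (1ℚ - c))
    6[1-c]-nonZero =
      pos⇒nonZero (ℕ→ℚ 6 * (1ℚ - c)) {{pos*pos⇒pos (ℕ→ℚ 6) (1ℚ - c)}}

    4[1-c]²-nonZero : NonZero (ℕ→ℚ 4 * ((1ℚ - c) * (1ℚ - c)))
    4[1-c]²-nonZero =
      pos⇒nonZero (ℕ→ℚ 4 * ((1ℚ - c) * (1ℚ - c)))
        {{pos*pos⇒pos (ℕ→ℚ 4) ((1ℚ - c) * (1ℚ - c))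
            {{pos*pos⇒pos (1ℚ - c) (1ℚ - c)}}}}

  c/6[1-c] : ℚ
  c/6[1-c] = c ÷ (ℕ→ℚ 6 * (1ℚ - c))

  1/4[1-c]² : ℚ
  1/4[1-c]² = 1ℚ ÷ (ℕ→ℚ 4 * ((1ℚ - c) * (1ℚ - c)))

{-# OPTIONS --safe #-}
module Submission where

-- Cars may be parked in any order, so the first cars of a parking function may
-- be parked last: if the other k cars leave n - k free spots and L is the length
-- of the run of occupied spots at the end of the street, then a further car can
-- park iff its preference is at most n - L.  For a second further car the length
-- L′ of the preceding run matters too.  The runs are exchangeable, with weights
-- given by a binomial convolution power of b l = #PF(l,l); this yields the exact
-- mean E L = k / (n - k + 1) and makes the squares cancel in the covariance.
-- With T the tree function, l^r b l is bounded by a multiple of the coefficients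
-- of b / (1 - T)^(2r), whose convolutions with the weights are controlled by the
-- recursion D = 1 + T D for D = 1 / (1 - T); so all moments of L are bounded in n,
-- and both limits follow with errors O(1) and O(1/n) respectively.

open import Defs
open import Algebra.Bundles using (CommutativeSemiring)
import Algebra.Solver.Ring.NaturalCoefficients.Default
open import Data.Empty using (⊥-elim)
open import Data.Fin.Base using (Fin; zero; suc; toℕ)
open import Data.Fin.Subset using (Subset; inside; outside; ⊥)
import Data.Integer.Base as ℤ
import Data.Integer.Properties as ℤ
open import Data.List.Base as List using (List; []; _∷_; length)
open import Data.Maybe.Base as Maybe using (Maybe; just; nothing; maybe′)
open import Data.Nat.Base as ℕ using (ℕ; zero; suc)
import Data.Nat.Properties as ℕ
open import Data.Nat.Solver using (module +-*-Solver)
open import Data.Product.Base using (_×_; _,_; proj₁; proj₂; ∃-syntax)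
open import Data.Rational.Base
  using (ℚ; mkℚ; 0ℚ; 1ℚ; ½; _+_; _-_; _*_; -_; _/_; _<_; _≤_; ∣_∣; 1/_; ↥_; toℚᵘ; positive; nonNegative)
open import Data.Rational.Properties
open import Data.Rational.Unnormalised.Base as ℚᵘ using (mkℚᵘ; *≡*; *≤*)
import Data.Rational.Unnormalised.Properties as ℚᵘ
open import Data.Sum.Base using (inj₁; inj₂)
open import Data.Vec.Base using (Vec; []; _∷_; lookup)
open import Function.Base using (_∘_)
open import Level using (0ℓ)
open import Relation.Binary.PropositionalEquality
  using (_≡_; _≢_; _≗_; refl; sym; trans; cong; cong₂; subst; subst₂; module ≡-Reasoning)
open import Relation.Nullary using (yes; no)
open import Relation.Nullary.Decidable using (dec⇒maybe)
open import Tactic.RingSolver using (solve-∀)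
open import Tactic.RingSolver.Core.AlmostCommutativeRing using (AlmostCommutativeRing; fromCommutativeRing)

-- The preferences are centred at the midpoint of the street, since raw moments would leave terms of
-- order n^2 to cancel in the covariance. After centring, the preferences 1,...,n-L have total
-- weight -L(n-L)/2. Higher moments of L then enter only below the orders that matter (for two cars,
-- after the squares have cancelled), so bounds are enough for them and only a = E L must be known
-- exactly. Write X, Y for the centred first two preferences and γ = c/(1-c) for the limit of a.
-- Dividing by the mean number n-a of admissible preferences gives E X^2 = n^2/12 + (1/12 - 1/4) a n
-- + O(1), which is the origin of -c/(6(1-c)). For two cars E XY tends to -(1+2γ)/4 and E X to -γ/2,
-- so the covariance tends to -(1+γ)^2/4, where 1+γ = 1/(1-c). No probability space is carried
-- along: a car is a linear operator on functions of the occupied set, every moment is an exact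
-- identity over ℚ for each n, and analysis enters only through bounds uniform in n.

ℚ-ring : AlmostCommutativeRing 0ℓ 0ℓ
ℚ-ring = fromCommutativeRing +-*-commutativeRing (λ x → dec⇒maybe (0ℚ ≟ x))

*-zeroˡ-+ : ∀ x y → 0ℚ * x + y ≡ y
*-zeroˡ-+ = solve-∀ ℚ-ring

interchange : ∀ a b c d → (a + b) + (c + d) ≡ (a + c) + (b + d)
interchange = solve-∀ ℚ-ring

linear-interchange : ∀ a b x y x′ y′ → (a * x + b * y) + (a * x′ + b * y′) ≡ a * (x + x′) + b * (y + y′)
linear-interchange = solve-∀ ℚ-ring

linear-0 : ∀ a b → 0ℚ ≡ a * 0ℚ + b * 0ℚ
linear-0 = solve-∀ ℚ-ring

-- Sums over the positions of a street

sumFin : ∀ {n} → (Fin n → ℚ) → ℚ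
sumFin {zero}  f = 0ℚ
sumFin {suc n} f = f zero + sumFin (f ∘ suc)

sumFin-cong : ∀ {n} {f g : Fin n → ℚ} → (∀ j → f j ≡ g j) → sumFin f ≡ sumFin g
sumFin-cong {zero}  f≗g = refl
sumFin-cong {suc n} f≗g = cong₂ _+_ (f≗g zero) (sumFin-cong (f≗g ∘ suc))

sumFin-linear : ∀ {n} a b (f g : Fin n → ℚ) →
  sumFin (λ j → a * f j + b * g j) ≡ a * sumFin f + b * sumFin g
sumFin-linear {zero}  a b f g = linear-0 a b
sumFin-linear {suc n} a b f g =
  trans (cong (a * f zero + b * g zero +_) (sumFin-linear a b (f ∘ suc) (g ∘ suc)))
        (linear-interchange a b (f zero) (g zero) (sumFin (f ∘ suc)) (sumFin (g ∘ suc)))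

sumFin-* : ∀ {n} a (f : Fin n → ℚ) → sumFin (λ j → a * f j) ≡ a * sumFin f
sumFin-* {zero}  a f = sym (*-zeroʳ a)
sumFin-* {suc n} a f =
  trans (cong (a * f zero +_) (sumFin-* a (f ∘ suc))) (sym (*-distribˡ-+ a _ _))

sumFin-+ : ∀ {n} (f g : Fin n → ℚ) → sumFin (λ j → f j + g j) ≡ sumFin f + sumFin g
sumFin-+ {zero}  f g = refl
sumFin-+ {suc n} f g =
  trans (cong (f zero + g zero +_) (sumFin-+ (f ∘ suc) (g ∘ suc)))
        (interchange (f zero) (g zero) (sumFin (f ∘ suc)) (sumFin (g ∘ suc)))

sumFin-0 : ∀ {n} {f : Fin n → ℚ} → (∀ j → f j ≡ 0ℚ) → sumFin f ≡ 0ℚ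
sumFin-0 {zero}  f≗0 = refl
sumFin-0 {suc n} f≗0 = cong₂ _+_ (f≗0 zero) (sumFin-0 (f≗0 ∘ suc))

-- Operators on functions of the occupied set

Functional : ℕ → Set
Functional n = Subset n → ℚ

-- firstFree F S is the value of F after parking in the first free spot of S, and
-- 0 if there is none; park g F S is the sum of g p times the value of F after
-- parking a car with preference p.

firstFree : ∀ {n} → Functional n → Functional n
firstFree F []            = 0ℚ
firstFree F (outside ∷ S) = F (inside ∷ S)
firstFree F (inside  ∷ S) = firstFree (F ∘ (inside ∷_)) S

park : ∀ {n} → (ℕ → ℚ) → Functional n → Functional n
park g F []      = 0ℚ
park g F (s ∷ S) = g 0 * firstFree F (s ∷ S) + park (g ∘ suc) (F ∘ (s ∷_)) S

firstFree-cong : ∀ {n} {F G : Functional n} → (∀ S → F S ≡ G S) →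
  ∀ S → firstFree F S ≡ firstFree G S
firstFree-cong F≗G []            = refl
firstFree-cong F≗G (outside ∷ S) = F≗G (inside ∷ S)
firstFree-cong F≗G (inside  ∷ S) = firstFree-cong (λ T → F≗G (inside ∷ T)) S

park-cong : ∀ {n} g {F G : Functional n} → (∀ S → F S ≡ G S) →
  ∀ S → park g F S ≡ park g G S
park-cong g F≗G []      = refl
park-cong g F≗G (s ∷ S) =
  cong₂ _+_ (cong (g 0 *_) (firstFree-cong F≗G (s ∷ S)))
            (park-cong (g ∘ suc) (λ T → F≗G (s ∷ T)) S)

firstFree-linear : ∀ {n} a b (F G : Functional n) S →
  firstFree (λ T → a * F T + b * G T) S ≡ a * firstFree F S + b * firstFree G S
firstFree-linear a b F G []            = linear-0 a b
firstFree-linear a b F G (outside ∷ S) = refl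
firstFree-linear a b F G (inside  ∷ S) = firstFree-linear a b _ _ S

park-linear : ∀ {n} g a b (F G : Functional n) S →
  park g (λ T → a * F T + b * G T) S ≡ a * park g F S + b * park g G S
park-linear g a b F G []      = linear-0 a b
park-linear g a b F G (s ∷ S) =
  trans (cong₂ (λ x y → g 0 * x + y) (firstFree-linear a b F G (s ∷ S))
                                     (park-linear (g ∘ suc) a b _ _ S))
        (lemma a b (g 0) _ _ _ _)
  where
  lemma : ∀ a b c x y x′ y′ → c * (a * x + b * y) + (a * x′ + b * y′) ≡
                              a * (c * x + x′) + b * (c * y + y′)
  lemma = solve-∀ ℚ-ring

linear-* : ∀ a x y → a * x ≡ a * x + 0ℚ * y
linear-* = solve-∀ ℚ-ring

linear-+ : ∀ x y → x + y ≡ 1ℚ * x + 1ℚ * y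
linear-+ = solve-∀ ℚ-ring

park-* : ∀ {n} g a (F : Functional n) S → park g (λ T → a * F T) S ≡ a * park g F S
park-* g a F S = begin
  park g (λ T → a * F T) S             ≡⟨ park-cong g (λ T → linear-* a (F T) (F T)) S ⟩
  park g (λ T → a * F T + 0ℚ * F T) S  ≡⟨ park-linear g a 0ℚ F F S ⟩
  a * park g F S + 0ℚ * park g F S     ≡⟨ linear-* a (park g F S) (park g F S) ⟨
  a * park g F S                       ∎
  where open ≡-Reasoning

park-+ : ∀ {n} g (F G : Functional n) S → park g (λ T → F T + G T) S ≡ park g F S + park g G S
park-+ g F G S = begin
  park g (λ T → F T + G T) S            ≡⟨ park-cong g (λ T → linear-+ (F T) (G T)) S ⟩
  park g (λ T → 1ℚ * F T + 1ℚ * G T) S  ≡⟨ park-linear g 1ℚ 1ℚ F G S ⟩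
  1ℚ * park g F S + 1ℚ * park g G S     ≡⟨ linear-+ (park g F S) (park g G S) ⟨
  park g F S + park g G S               ∎
  where open ≡-Reasoning

firstFree-0 : ∀ {n} {F : Functional n} → (∀ S → F S ≡ 0ℚ) → ∀ S → firstFree F S ≡ 0ℚ
firstFree-0 F≗0 []            = refl
firstFree-0 F≗0 (outside ∷ S) = F≗0 _
firstFree-0 F≗0 (inside  ∷ S) = firstFree-0 (λ T → F≗0 _) S

park-0 : ∀ {n} g {F : Functional n} → (∀ S → F S ≡ 0ℚ) → ∀ S → park g F S ≡ 0ℚ
park-0 g F≗0 []      = refl
park-0 g F≗0 (s ∷ S) =
  cong₂ _+_ (trans (cong (g 0 *_) (firstFree-0 F≗0 (s ∷ S))) (*-zeroʳ (g 0)))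
            (park-0 _ (λ T → F≗0 _) S)

park-sumFin : ∀ {n m} g (F : Fin m → Functional n) S →
  park g (λ T → sumFin (λ j → F j T)) S ≡ sumFin (λ j → park g (F j) S)
park-sumFin {m = zero}  g F S = park-0 g (λ _ → refl) S
park-sumFin {m = suc m} g F S =
  trans (park-+ g (F zero) _ S) (cong (park g (F zero) S +_) (park-sumFin g (F ∘ suc) S))

-- The special case of `park-comm` in which one car heads for the first spot. If that spot is free,
-- both sides unfold to the same sum; if it is occupied, the first free spot lies in the tail and
-- linearity reduces to induction.
firstFree-park-comm : ∀ {n} g (F : Functional n) S →
  firstFree (park g F) S ≡ park g (firstFree F) S
firstFree-park-comm g F []            = refl
firstFree-park-comm g F (outside ∷ S) = refl
firstFree-park-comm g F (inside  ∷ S) = begin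
  firstFree (λ T → g 0 * firstFree F (inside ∷ T) + park (g ∘ suc) (F ∘ (inside ∷_)) T) S
    ≡⟨ firstFree-cong (λ T → cong (g 0 * firstFree (F ∘ (inside ∷_)) T +_)
                               (sym (*-identityˡ (park (g ∘ suc) (F ∘ (inside ∷_)) T)))) S ⟩
  firstFree (λ T → g 0 * firstFree (F ∘ (inside ∷_)) T + 1ℚ * park (g ∘ suc) (F ∘ (inside ∷_)) T) S
    ≡⟨ firstFree-linear (g 0) 1ℚ _ _ S ⟩
  g 0 * firstFree (firstFree (F ∘ (inside ∷_))) S + 1ℚ * firstFree (park (g ∘ suc) (F ∘ (inside ∷_))) S
    ≡⟨ cong (g 0 * firstFree (firstFree (F ∘ (inside ∷_))) S +_)
            (trans (*-identityˡ (firstFree (park (g ∘ suc) (F ∘ (inside ∷_))) S))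
                   (firstFree-park-comm (g ∘ suc) (F ∘ (inside ∷_)) S)) ⟩
  park g (firstFree F) (inside ∷ S) ∎
  where open ≡-Reasoning

-- Parking is abelian: the set of spots finally occupied does not depend on which of two cars
-- arrives first. Splitting off the first spot leaves mixed terms in which one of the cars prefers
-- that spot, and `firstFree-park-comm` matches them.
park-comm : ∀ {n} g h (F : Functional n) S → park g (park h F) S ≡ park h (park g F) S
park-comm g h F []      = refl
park-comm g h F (s ∷ S) = begin
  g 0 * firstFree (park h F) (s ∷ S) + park g′ (λ T → h 0 * A T + park h′ (F ∘ (s ∷_)) T) S
    ≡⟨ cong₂ (λ x y → g 0 * x + y) (firstFree-park-comm h F (s ∷ S)) (expand g′ h) ⟩
  g 0 * (h 0 * firstFree (firstFree F) (s ∷ S) + park h′ A S) + (h 0 * park g′ A S + park g′ (park h′ (F ∘ (s ∷_))) S)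
    ≡⟨ cong (λ x → g 0 * (h 0 * firstFree (firstFree F) (s ∷ S) + park h′ A S) + (h 0 * park g′ A S + x))
            (park-comm g′ h′ (F ∘ (s ∷_)) S) ⟩
  g 0 * (h 0 * firstFree (firstFree F) (s ∷ S) + park h′ A S) + (h 0 * park g′ A S + park h′ (park g′ (F ∘ (s ∷_))) S)
    ≡⟨ swap (g 0) (h 0) _ _ _ _ ⟩
  h 0 * (g 0 * firstFree (firstFree F) (s ∷ S) + park g′ A S) + (g 0 * park h′ A S + park h′ (park g′ (F ∘ (s ∷_))) S)
    ≡⟨ cong₂ (λ x y → h 0 * x + y) (firstFree-park-comm g F (s ∷ S)) (expand h′ g) ⟨
  h 0 * firstFree (park g F) (s ∷ S) + park h′ (λ T → g 0 * A T + park g′ (F ∘ (s ∷_)) T) S ∎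
  where
  open ≡-Reasoning
  g′ h′ : ℕ → ℚ
  g′ = g ∘ suc
  h′ = h ∘ suc
  A : Functional _
  A = firstFree F ∘ (s ∷_)
  expand : ∀ (f k : ℕ → ℚ) → park f (λ T → k 0 * A T + park (k ∘ suc) (F ∘ (s ∷_)) T) S ≡
                   k 0 * park f A S + park f (park (k ∘ suc) (F ∘ (s ∷_))) S
  expand f k = trans (park-+ f (λ T → k 0 * A T) (park (k ∘ suc) (F ∘ (s ∷_))) S)
                     (cong (_+ park f (park (k ∘ suc) (F ∘ (s ∷_))) S) (park-* f (k 0) A S))
  swap : ∀ a b x y z w → a * (b * x + y) + (b * z + w) ≡ b * (a * x + z) + (a * y + w)
  swap = solve-∀ ℚ-ring

one : ℕ → ℚ
one _ = 1ℚ

-- The innermost operator belongs to the car that parks last. Peeling it off first makes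
-- `park one F` the new function, so that identities for a single car apply to it directly.
parkN : ∀ {n} → ℕ → Functional n → Functional n
parkN zero    F = F
parkN (suc k) F = parkN k (park one F)

parkN-cong : ∀ {n} k {F G : Functional n} → (∀ S → F S ≡ G S) →
  ∀ S → parkN k F S ≡ parkN k G S
parkN-cong zero    F≗G = F≗G
parkN-cong (suc k) F≗G = parkN-cong k (park-cong one F≗G)

park-parkN : ∀ {n} k g (F : Functional n) S → park g (parkN k F) S ≡ parkN k (park g F) S
park-parkN zero    g F S = refl
park-parkN (suc k) g F S =
  trans (park-parkN k g (park one F) S) (parkN-cong k (park-comm g one F) S)

parkN-+ : ∀ {n} k (F G : Functional n) S → parkN k (λ T → F T + G T) S ≡ parkN k F S + parkN k G S
parkN-+ zero    F G S = refl
parkN-+ (suc k) F G S = trans (parkN-cong k (park-+ one F G) S) (parkN-+ k _ _ S)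

parkN-* : ∀ {n} k a (F : Functional n) S → parkN k (λ T → a * F T) S ≡ a * parkN k F S
parkN-* zero    a F S = refl
parkN-* (suc k) a F S = trans (parkN-cong k (park-* one a F) S) (parkN-* k a _ S)

parkN-sumFin : ∀ {n m} k (F : Fin m → Functional n) S →
  parkN k (λ T → sumFin (λ j → F j T)) S ≡ sumFin (λ j → parkN k (F j) S)
parkN-sumFin zero    F S = refl
parkN-sumFin (suc k) F S = trans (parkN-cong k (park-sumFin one F) S) (parkN-sumFin k (λ j → park one (F j)) S)

-- Sums over sequences

module _ {A : Set} where

  sumℚ-cong : ∀ (Ω : List A) {X Y : A → ℚ} → (∀ ω → X ω ≡ Y ω) → sumℚ Ω X ≡ sumℚ Ω Y
  sumℚ-cong []      X≗Y = refl
  sumℚ-cong (ω ∷ Ω) X≗Y = cong₂ _+_ (X≗Y ω) (sumℚ-cong Ω X≗Y)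

  sumℚ-0 : ∀ (Ω : List A) → sumℚ Ω (λ _ → 0ℚ) ≡ 0ℚ
  sumℚ-0 []      = refl
  sumℚ-0 (ω ∷ Ω) = trans (+-identityˡ _) (sumℚ-0 Ω)

  sumℚ-* : ∀ (Ω : List A) a X → sumℚ Ω (λ ω → a * X ω) ≡ a * sumℚ Ω X
  sumℚ-* []      a X = sym (*-zeroʳ a)
  sumℚ-* (ω ∷ Ω) a X = trans (cong (a * X ω +_) (sumℚ-* Ω a X)) (sym (*-distribˡ-+ a _ _))

  sumℚ-++ : ∀ (Ω Ω′ : List A) X → sumℚ (Ω List.++ Ω′) X ≡ sumℚ Ω X + sumℚ Ω′ X
  sumℚ-++ []      Ω′ X = sym (+-identityˡ _)
  sumℚ-++ (ω ∷ Ω) Ω′ X = trans (cong (X ω +_) (sumℚ-++ Ω Ω′ X)) (sym (+-assoc (X ω) _ _))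

  sumℚ-tabulate : ∀ {n} (f : Fin n → A) X → sumℚ (List.tabulate f) X ≡ sumFin (X ∘ f)
  sumℚ-tabulate {zero}  f X = refl
  sumℚ-tabulate {suc n} f X = cong (X (f zero) +_) (sumℚ-tabulate (f ∘ suc) X)

sumℚ-map : ∀ {A B : Set} (f : A → B) Ω X → sumℚ (List.map f Ω) X ≡ sumℚ Ω (X ∘ f)
sumℚ-map f []      X = refl
sumℚ-map f (ω ∷ Ω) X = cong (X (f ω) +_) (sumℚ-map f Ω X)

sumℚ-cartesianProductWith : ∀ {A B C : Set} (f : A → B → C) Ω Ω′ X →
  sumℚ (List.cartesianProductWith f Ω Ω′) X ≡ sumℚ Ω (λ a → sumℚ Ω′ (λ b → X (f a b)))
sumℚ-cartesianProductWith f []      Ω′ X = refl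
sumℚ-cartesianProductWith f (a ∷ Ω) Ω′ X =
  trans (sumℚ-++ (List.map (f a) Ω′) _ X)
        (cong₂ _+_ (sumℚ-map (f a) Ω′ X) (sumℚ-cartesianProductWith f Ω Ω′ X))

sumℚ-sequences : ∀ k n (X : Vec (Fin n) (suc k) → ℚ) →
  sumℚ (sequences (suc k) n) X ≡ sumFin (λ p → sumℚ (sequences k n) (λ ps → X (p ∷ ps)))
sumℚ-sequences k n X =
  trans (sumℚ-cartesianProductWith _∷_ (List.allFin n) (sequences k n) X)
        (sumℚ-tabulate (λ p → p) (λ p → sumℚ (sequences k n) (λ ps → X (p ∷ ps))))

sumℚ-PF : ∀ k n (X : Vec (Fin n) k → ℚ) →
  sumℚ (PF k n) X ≡ sumℚ (sequences k n) (λ ps → maybe′ (λ _ → X ps) 0ℚ (parkAll ps ⊥))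
sumℚ-PF k n X = go (sequences k n)
  where
  go : ∀ Ω → sumℚ (List.filter isParkingFunction? Ω) X ≡
             sumℚ Ω (λ ps → maybe′ (λ _ → X ps) 0ℚ (parkAll ps ⊥))
  go []       = refl
  go (ps ∷ Ω) with parkAll ps ⊥
  ... | just _  = cong (X ps +_) (go Ω)
  ... | nothing = trans (go Ω) (sym (+-identityˡ _))

maybe-map : ∀ {n m} (f : Subset n → Subset m) (F : Functional m) x →
  maybe′ F 0ℚ (Maybe.map f x) ≡ maybe′ (F ∘ f) 0ℚ x
maybe-map f F (just _) = refl
maybe-map f F nothing  = refl

firstFree-sound : ∀ {n} (F : Functional n) S → maybe′ F 0ℚ (parkFirstFree S) ≡ firstFree F S
firstFree-sound F []            = refl
firstFree-sound F (outside ∷ S) = refl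
firstFree-sound F (inside  ∷ S) =
  trans (maybe-map (inside ∷_) F (parkFirstFree S)) (firstFree-sound (F ∘ (inside ∷_)) S)

park-sound : ∀ {n} g (F : Functional n) S →
  sumFin (λ p → g (toℕ p) * maybe′ F 0ℚ (parkCar p S)) ≡ park g F S
park-sound g F []      = refl
park-sound g F (s ∷ S) = cong₂ _+_
  (cong (g 0 *_) (firstFree-sound F (s ∷ S)))
  (trans (sumFin-cong (λ p → cong (g (suc (toℕ p)) *_) (maybe-map (s ∷_) F (parkCar p S))))
         (park-sound (g ∘ suc) (F ∘ (s ∷_)) S))

-- The induction step shared by the three `sumℚ-weigh` lemmas: the first car carries the weight `g`,
-- and `Y ps T` is the weight of the remaining cars `ps` when they start from the street `T`. A
-- first car that fails to park contributes 0.
sumℚ-parkCar : ∀ k n (g : ℕ → ℚ) (Y : Vec (Fin n) k → Functional n) F S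
  (X : Vec (Fin n) (suc k) → ℚ) →
  (∀ p ps → X (p ∷ ps) ≡ g (toℕ p) * maybe′ (Y ps) 0ℚ (parkCar p S)) →
  (∀ T → sumℚ (sequences k n) (λ ps → Y ps T) ≡ F T) →
  sumℚ (sequences (suc k) n) X ≡ park g F S
sumℚ-parkCar k n g Y F S X X≗ Y≗F = begin
  sumℚ (sequences (suc k) n) X
    ≡⟨ sumℚ-sequences k n X ⟩
  sumFin (λ p → sumℚ (sequences k n) (λ ps → X (p ∷ ps)))
    ≡⟨ sumFin-cong first ⟩
  sumFin (λ p → g (toℕ p) * maybe′ F 0ℚ (parkCar p S))
    ≡⟨ park-sound g F S ⟩
  park g F S ∎
  where
  open ≡-Reasoning
  rest : ∀ x → sumℚ (sequences k n) (λ ps → maybe′ (Y ps) 0ℚ x) ≡ maybe′ F 0ℚ x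
  rest (just T) = Y≗F T
  rest nothing  = sumℚ-0 (sequences k n)
  first : ∀ p → sumℚ (sequences k n) (λ ps → X (p ∷ ps)) ≡ g (toℕ p) * maybe′ F 0ℚ (parkCar p S)
  first p = begin
    sumℚ (sequences k n) (λ ps → X (p ∷ ps))
      ≡⟨ sumℚ-cong (sequences k n) (X≗ p) ⟩
    sumℚ (sequences k n) (λ ps → g (toℕ p) * maybe′ (Y ps) 0ℚ (parkCar p S))
      ≡⟨ sumℚ-* (sequences k n) (g (toℕ p)) (λ ps → maybe′ (Y ps) 0ℚ (parkCar p S)) ⟩
    g (toℕ p) * sumℚ (sequences k n) (λ ps → maybe′ (Y ps) 0ℚ (parkCar p S))
      ≡⟨ cong (g (toℕ p) *_) (rest (parkCar p S)) ⟩
    g (toℕ p) * maybe′ F 0ℚ (parkCar p S) ∎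

all : ∀ {n} → Functional n
all _ = 1ℚ

weigh : ∀ {k n} → ℚ → Vec (Fin n) k → Functional n
weigh w ps S = maybe′ (λ _ → w) 0ℚ (parkAll ps S)

weigh-∷ : ∀ {k n} c w p (ps : Vec (Fin n) k) S →
  weigh (c * w) (p ∷ ps) S ≡ c * maybe′ (weigh w ps) 0ℚ (parkCar p S)
weigh-∷ c w p ps S with parkCar p S
... | nothing = sym (*-zeroʳ c)
... | just T with parkAll ps T
...   | just _  = refl
...   | nothing = sym (*-zeroʳ c)

sumℚ-weigh : ∀ k n (S : Subset n) →
  sumℚ (sequences k n) (λ ps → weigh 1ℚ ps S) ≡ parkN k all S
sumℚ-weigh zero    n S = refl
sumℚ-weigh (suc k) n S =
  trans (sumℚ-parkCar k n one (weigh 1ℚ) (parkN k all) S (λ ps → weigh 1ℚ ps S)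
          (λ p ps → weigh-∷ 1ℚ 1ℚ p ps S) (sumℚ-weigh k n))
        (park-parkN k one all S)

-- The weighted car stands first in the sequence, but `park-parkN` moves its operator to the
-- innermost place: it is parked after the `k` unweighted cars.
sumℚ-weigh₁ : ∀ k n g (S : Subset n) →
  sumℚ (sequences (suc k) n) (λ ps → weigh (g (toℕ (lookup ps zero))) ps S) ≡
  parkN k (park g all) S
sumℚ-weigh₁ k n g S =
  trans (sumℚ-parkCar k n g (weigh 1ℚ) (parkN k all) S (λ ps → weigh (g (toℕ (lookup ps zero))) ps S)
          (λ p ps → trans (cong (λ w → weigh w (p ∷ ps) S) (sym (*-identityʳ (g (toℕ p)))))
                          (weigh-∷ (g (toℕ p)) 1ℚ p ps S))
          (sumℚ-weigh k n))
        (park-parkN k g all S)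

sumℚ-weigh₂ : ∀ k n g h (S : Subset n) →
  sumℚ (sequences (2 ℕ.+ k) n)
       (λ ps → weigh (g (toℕ (lookup ps zero)) * h (toℕ (lookup ps (suc zero)))) ps S) ≡
  parkN k (park g (park h all)) S
sumℚ-weigh₂ k n g h S =
  trans (sumℚ-parkCar (suc k) n g (λ ps → weigh (h (toℕ (lookup ps zero))) ps)
          (parkN k (park h all)) S
          (λ ps → weigh (g (toℕ (lookup ps zero)) * h (toℕ (lookup ps (suc zero)))) ps S)
          (λ p ps → weigh-∷ (g (toℕ p)) (h (toℕ (lookup ps zero))) p ps S)
          (sumℚ-weigh₁ k n h))
        (park-parkN k g (park h all) S)

sumℚ-PF₀ : ∀ k n → sumℚ (PF k n) (λ _ → 1ℚ) ≡ parkN k all ⊥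
sumℚ-PF₀ k n = trans (sumℚ-PF k n _) (sumℚ-weigh k n ⊥)

sumℚ-PF₁ : ∀ k n g →
  sumℚ (PF (suc k) n) (λ ps → g (toℕ (lookup ps zero))) ≡ parkN k (park g all) ⊥
sumℚ-PF₁ k n g = trans (sumℚ-PF (suc k) n _) (sumℚ-weigh₁ k n g ⊥)

sumℚ-PF₂ : ∀ k n g h →
  sumℚ (PF (2 ℕ.+ k) n) (λ ps → g (toℕ (lookup ps zero)) * h (toℕ (lookup ps (suc zero)))) ≡
  parkN k (park g (park h all)) ⊥
sumℚ-PF₂ k n g h = trans (sumℚ-PF (2 ℕ.+ k) n _) (sumℚ-weigh₂ k n g h ⊥)

-- Cutting the street at a free spot

right : ∀ {n} → Fin n → ℕ
right {suc n} zero    = n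
right         (suc j) = right j

-- Zero unless the spot j is free, and then the product of G on its left and H on its right.

splitAtFree : ∀ {n} (j : Fin n) → Functional (toℕ j) → Functional (right j) → Functional n
splitAtFree zero    G H (outside ∷ S) = G [] * H S
splitAtFree zero    G H (inside  ∷ S) = 0ℚ
splitAtFree (suc j) G H (s       ∷ S) = splitAtFree j (G ∘ (s ∷_)) H S

splitAtFree-cong : ∀ {n} (j : Fin n) {G G′ : Functional (toℕ j)} {H H′ : Functional (right j)} →
  (∀ T → G T ≡ G′ T) → (∀ T → H T ≡ H′ T) → ∀ S → splitAtFree j G H S ≡ splitAtFree j G′ H′ S
splitAtFree-cong zero    G≗ H≗ (outside ∷ S) = cong₂ _*_ (G≗ []) (H≗ S)
splitAtFree-cong zero    G≗ H≗ (inside  ∷ S) = refl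
splitAtFree-cong (suc j) G≗ H≗ (s       ∷ S) = splitAtFree-cong j (λ T → G≗ (s ∷ T)) H≗ S

splitAtFree-linear : ∀ {n} (j : Fin n) a b G G′ H S →
  splitAtFree j (λ T → a * G T + b * G′ T) H S ≡ a * splitAtFree j G H S + b * splitAtFree j G′ H S
splitAtFree-linear zero    a b G G′ H (outside ∷ S) = lemma a b (G []) (G′ []) (H S)
  where
  lemma : ∀ a b x y z → (a * x + b * y) * z ≡ a * (x * z) + b * (y * z)
  lemma = solve-∀ ℚ-ring
splitAtFree-linear zero    a b G G′ H (inside  ∷ S) = linear-0 a b
splitAtFree-linear (suc j) a b G G′ H (s       ∷ S) = splitAtFree-linear j a b _ _ H S

splitAtFree-*ˡ : ∀ {n} (j : Fin n) a G H S →
  splitAtFree j (λ T → a * G T) H S ≡ a * splitAtFree j G H S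
splitAtFree-*ˡ zero    a G H (outside ∷ S) = *-assoc a (G []) (H S)
splitAtFree-*ˡ zero    a G H (inside  ∷ S) = sym (*-zeroʳ a)
splitAtFree-*ˡ (suc j) a G H (s       ∷ S) = splitAtFree-*ˡ j a _ H S

-- A car coming from the left end leaves the free spot `j` free only by stopping before it, so only
-- the left factor changes. If nothing is free before `j`, the left side is 0 because `j` itself
-- gets filled, and so is the right side.
firstFree-splitAtFree : ∀ {n} (j : Fin n) G H S →
  firstFree (splitAtFree j G H) S ≡ splitAtFree j (firstFree G) H S
firstFree-splitAtFree zero    G H (outside ∷ S) = sym (*-zeroˡ (H S))
firstFree-splitAtFree zero    G H (inside  ∷ S) = firstFree-0 (λ _ → refl) S
firstFree-splitAtFree (suc j) G H (outside ∷ S) = refl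
firstFree-splitAtFree (suc j) G H (inside  ∷ S) = firstFree-splitAtFree j (G ∘ (inside ∷_)) H S

-- A Leibniz rule: spot j stays free iff the car parks to its left or prefers a spot to its right.

park-splitAtFree : ∀ {n} (j : Fin n) g G H S →
  park g (splitAtFree j G H) S ≡
  splitAtFree j (park g G) H S + splitAtFree j G (park (λ i → g (suc (toℕ j ℕ.+ i))) H) S
park-splitAtFree zero g G H (outside ∷ S) = begin
  g 0 * 0ℚ + park (g ∘ suc) (λ T → G [] * H T) S
    ≡⟨ cong₂ _+_ (*-zeroʳ (g 0)) (park-* (g ∘ suc) (G []) H S) ⟩
  0ℚ + G [] * park (g ∘ suc) H S
    ≡⟨ cong (_+ G [] * park (g ∘ suc) H S) (*-zeroˡ (H S)) ⟨
  0ℚ * H S + G [] * park (g ∘ suc) H S ∎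
  where open ≡-Reasoning
park-splitAtFree zero g G H (inside ∷ S) =
  cong₂ _+_ (trans (cong (g 0 *_) (firstFree-0 (λ _ → refl) S)) (*-zeroʳ (g 0)))
            (park-0 (g ∘ suc) (λ _ → refl) S)
park-splitAtFree (suc j) g G H (s ∷ S) = begin
  g 0 * firstFree (splitAtFree (suc j) G H) (s ∷ S) + park (g ∘ suc) (splitAtFree j (G ∘ (s ∷_)) H) S
    ≡⟨ cong₂ (λ x y → g 0 * x + y) (firstFree-splitAtFree (suc j) G H (s ∷ S))
                                   (park-splitAtFree j (g ∘ suc) (G ∘ (s ∷_)) H S) ⟩
  g 0 * splitAtFree j (firstFree G ∘ (s ∷_)) H S
    + (splitAtFree j (park (g ∘ suc) (G ∘ (s ∷_))) H S + R)
    ≡⟨ lemma (g 0) (splitAtFree j (firstFree G ∘ (s ∷_)) H S) (splitAtFree j (park (g ∘ suc) (G ∘ (s ∷_))) H S) R ⟩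
  (g 0 * splitAtFree j (firstFree G ∘ (s ∷_)) H S
    + 1ℚ * splitAtFree j (park (g ∘ suc) (G ∘ (s ∷_))) H S) + R
    ≡⟨ cong (_+ R) (splitAtFree-linear j (g 0) 1ℚ (firstFree G ∘ (s ∷_)) (park (g ∘ suc) (G ∘ (s ∷_))) H S) ⟨
  splitAtFree j (λ T → g 0 * firstFree G (s ∷ T) + 1ℚ * park (g ∘ suc) (G ∘ (s ∷_)) T) H S + R
    ≡⟨ cong (_+ R) (splitAtFree-cong j {H = H} (λ T → cong (g 0 * firstFree G (s ∷ T) +_)
                                                   (*-identityˡ (park (g ∘ suc) (G ∘ (s ∷_)) T))) (λ _ → refl) S) ⟩
  splitAtFree (suc j) (park g G) H (s ∷ S) + R ∎
  where
  open ≡-Reasoning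
  R : ℚ
  R = splitAtFree j (G ∘ (s ∷_)) (park (λ i → g (suc (suc (toℕ j ℕ.+ i)))) H) S
  lemma : ∀ c x y z → c * x + (y + z) ≡ (c * x + 1ℚ * y) + z
  lemma = solve-∀ ℚ-ring

-- free x is x to the number of free spots: free 1ℚ is constant and free 0ℚ is
-- the indicator of the full street.

free : ∀ {n} → ℚ → Functional n
free x []            = 1ℚ
free x (outside ∷ S) = x * free x S
free x (inside  ∷ S) = free x S

free-1 : ∀ {n} (S : Subset n) → free 1ℚ S ≡ 1ℚ
free-1 []            = refl
free-1 (outside ∷ S) = trans (*-identityˡ (free 1ℚ S)) (free-1 S)
free-1 (inside  ∷ S) = free-1 S

sumBefore : (ℕ → ℚ) → ℕ → ℚ
sumBefore g zero    = 0ℚ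
sumBefore g (suc j) = g 0 + sumBefore (g ∘ suc) j

-- In splitAtFree j F (free 0ℚ) the spot j is the last free one.

firstFree-free : ∀ {n} x (S : Subset n) →
  firstFree (free x) S ≡ sumFin (λ j → splitAtFree j (free x) (free 0ℚ) S)
-- If some spot is free, filling the first one removes one factor `x` from `free x`, which is why
-- the sum from `firstFree-free` returns here multiplied by `x`; the full street gives the separate
-- summand. The base stays general because both 1 and 0 are needed later.
free-split : ∀ {n} x (S : Subset n) →
  free x S ≡ free 0ℚ S + x * sumFin (λ j → splitAtFree j (free x) (free 0ℚ) S)

splitAtFree-outside : ∀ {n} x (S : Subset n) →
  sumFin (λ j → splitAtFree j (free x ∘ (outside ∷_)) (free 0ℚ) S) ≡
  x * sumFin (λ j → splitAtFree j (free x) (free 0ℚ) S)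
splitAtFree-outside x S =
  trans (sumFin-cong (λ j → splitAtFree-*ˡ j x (free x) (free 0ℚ) S))
        (sumFin-* x (λ j → splitAtFree j (free x) (free 0ℚ) S))

firstFree-free x []            = refl
firstFree-free x (outside ∷ S) =
  trans (free-split x S)
        (cong₂ _+_ (sym (*-identityˡ (free 0ℚ S))) (sym (splitAtFree-outside x S)))
firstFree-free x (inside  ∷ S) = trans (firstFree-free x S) (sym (+-identityˡ _))

free-split x [] = cong (1ℚ +_) (sym (*-zeroʳ x))
free-split x (outside ∷ S) = begin
  x * firstFree (free x) (outside ∷ S)
    ≡⟨ cong (x *_) (firstFree-free x (outside ∷ S)) ⟩
  x * Σ
    ≡⟨ *-zeroˡ-+ (free 0ℚ S) (x * Σ) ⟨
  0ℚ * free 0ℚ S + x * Σ ∎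
  where
  open ≡-Reasoning
  Σ : ℚ
  Σ = sumFin (λ j → splitAtFree j (free x) (free 0ℚ) (outside ∷ S))
free-split x (inside  ∷ S) =
  trans (free-split x S) (cong (λ y → free 0ℚ S + x * y) (sym (+-identityˡ _)))

-- A car can park iff its preference does not exceed the last free spot `j`, and `free x` sees only
-- that one free spot has gone, not which. So the admissible preferences contribute their total
-- weight, a partial sum of `g` that includes spot `j`, and the remaining factor counts the other
-- free spots.
park-free : ∀ {n} g x (S : Subset n) →
  park g (free x) S ≡
  sumFin (λ j → sumBefore g (suc (toℕ j)) * splitAtFree j (free x) (free 0ℚ) S)
park-free g x []      = refl
park-free {suc n} g x (s ∷ S) = begin
  g 0 * firstFree (free x) (s ∷ S) + park g′ (free x ∘ (s ∷_)) S
    ≡⟨ cong₂ (λ u v → g 0 * u + v) (firstFree-free x (s ∷ S)) (rest s) ⟩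
  g 0 * (A zero + sumFin (A ∘ suc)) + sumFin (λ j → sumBefore g′ (suc (toℕ j)) * A (suc j))
    ≡⟨ lemma (g 0) (A zero) (sumFin (A ∘ suc)) (sumFin (λ j → sumBefore g′ (suc (toℕ j)) * A (suc j))) ⟩
  (g 0 + 0ℚ) * A zero + (g 0 * sumFin (A ∘ suc) + 1ℚ * sumFin (λ j → sumBefore g′ (suc (toℕ j)) * A (suc j)))
    ≡⟨ cong ((g 0 + 0ℚ) * A zero +_) (sumFin-linear (g 0) 1ℚ (A ∘ suc) (λ j → sumBefore g′ (suc (toℕ j)) * A (suc j))) ⟨
  (g 0 + 0ℚ) * A zero + sumFin (λ j → g 0 * A (suc j) + 1ℚ * (sumBefore g′ (suc (toℕ j)) * A (suc j)))
    ≡⟨ cong ((g 0 + 0ℚ) * A zero +_) (sumFin-cong (λ j → distrib (g 0) (A (suc j)) (sumBefore g′ (suc (toℕ j))))) ⟩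
  sumFin (λ j → sumBefore g (suc (toℕ j)) * A j) ∎
  where
  open ≡-Reasoning
  g′ : ℕ → ℚ
  g′ = g ∘ suc
  A : Fin (suc n) → ℚ
  A j = splitAtFree j (free x) (free 0ℚ) (s ∷ S)
  lemma : ∀ c a b r → c * (a + b) + r ≡ (c + 0ℚ) * a + (c * b + 1ℚ * r)
  lemma = solve-∀ ℚ-ring
  distrib : ∀ c a b → c * a + 1ℚ * (b * a) ≡ (c + b) * a
  distrib = solve-∀ ℚ-ring
  swap : ∀ a b c → a * (b * c) ≡ b * (a * c)
  swap = solve-∀ ℚ-ring
  rest : ∀ s → park g′ (free x ∘ (s ∷_)) S ≡
    sumFin (λ j → sumBefore g′ (suc (toℕ j)) * splitAtFree (suc j) (free x) (free 0ℚ) (s ∷ S))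
  rest inside  = park-free g′ x S
  rest outside = begin
    park g′ (λ T → x * free x T) S
      ≡⟨ park-* g′ x (free x) S ⟩
    x * park g′ (free x) S
      ≡⟨ cong (x *_) (park-free g′ x S) ⟩
    x * sumFin (λ j → sumBefore g′ (suc (toℕ j)) * splitAtFree j (free x) (free 0ℚ) S)
      ≡⟨ sumFin-* x (λ j → sumBefore g′ (suc (toℕ j)) * splitAtFree j (free x) (free 0ℚ) S) ⟨
    sumFin (λ j → x * (sumBefore g′ (suc (toℕ j)) * splitAtFree j (free x) (free 0ℚ) S))
      ≡⟨ sumFin-cong (λ j → trans (swap x (sumBefore g′ (suc (toℕ j))) (splitAtFree j (free x) (free 0ℚ) S))
           (cong (sumBefore g′ (suc (toℕ j)) *_) (sym (splitAtFree-*ˡ j x (free x) (free 0ℚ) S)))) ⟩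
    sumFin (λ j → sumBefore g′ (suc (toℕ j)) * splitAtFree j (λ T → x * free x T) (free 0ℚ) S) ∎

-- Binomial sums

-- shuffle Ψ k is the sum of C(k,i) Ψ i l over i + l = k.

shuffle : (ℕ → ℕ → ℚ) → ℕ → ℚ
shuffle Ψ zero    = Ψ 0 0
shuffle Ψ (suc k) = shuffle (λ i l → Ψ (suc i) l) k + shuffle (λ i l → Ψ i (suc l)) k

shuffle-cong : ∀ k {Ψ Φ : ℕ → ℕ → ℚ} → (∀ i l → i ℕ.+ l ≡ k → Ψ i l ≡ Φ i l) → shuffle Ψ k ≡ shuffle Φ k
shuffle-cong zero    Ψ≗Φ = Ψ≗Φ 0 0 refl
shuffle-cong (suc k) Ψ≗Φ = cong₂ _+_
  (shuffle-cong k (λ i l p → Ψ≗Φ (suc i) l (cong suc p)))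
  (shuffle-cong k (λ i l p → Ψ≗Φ i (suc l) (trans (ℕ.+-suc i l) (cong suc p))))

shuffle-linear : ∀ k a b (Ψ Φ : ℕ → ℕ → ℚ) →
  shuffle (λ i l → a * Ψ i l + b * Φ i l) k ≡ a * shuffle Ψ k + b * shuffle Φ k
shuffle-linear zero    a b Ψ Φ = refl
shuffle-linear (suc k) a b Ψ Φ =
  trans (cong₂ _+_ (shuffle-linear k a b (λ i l → Ψ (suc i) l) (λ i l → Φ (suc i) l))
                   (shuffle-linear k a b (λ i l → Ψ i (suc l)) (λ i l → Φ i (suc l))))
        (linear-interchange a b _ _ _ _)

shuffle-+ : ∀ k (Ψ Φ : ℕ → ℕ → ℚ) → shuffle (λ i l → Ψ i l + Φ i l) k ≡ shuffle Ψ k + shuffle Φ k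
shuffle-+ zero    Ψ Φ = refl
shuffle-+ (suc k) Ψ Φ =
  trans (cong₂ _+_ (shuffle-+ k (λ i l → Ψ (suc i) l) (λ i l → Φ (suc i) l))
                   (shuffle-+ k (λ i l → Ψ i (suc l)) (λ i l → Φ i (suc l))))
        (interchange (shuffle (λ i l → Ψ (suc i) l) k) (shuffle (λ i l → Φ (suc i) l) k)
                     (shuffle (λ i l → Ψ i (suc l)) k) (shuffle (λ i l → Φ i (suc l)) k))

shuffle-* : ∀ k a (Ψ : ℕ → ℕ → ℚ) → shuffle (λ i l → a * Ψ i l) k ≡ a * shuffle Ψ k
shuffle-* zero    a Ψ = refl
shuffle-* (suc k) a Ψ =
  trans (cong₂ _+_ (shuffle-* k a (λ i l → Ψ (suc i) l)) (shuffle-* k a (λ i l → Ψ i (suc l))))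
        (sym (*-distribˡ-+ a _ _))

shuffle-0 : ∀ k {Ψ : ℕ → ℕ → ℚ} → (∀ i l → Ψ i l ≡ 0ℚ) → shuffle Ψ k ≡ 0ℚ
shuffle-0 zero    Ψ≗0 = Ψ≗0 0 0
shuffle-0 (suc k) Ψ≗0 = cong₂ _+_ (shuffle-0 k (λ i l → Ψ≗0 _ _)) (shuffle-0 k (λ i l → Ψ≗0 _ _))

shuffle-comm : ∀ k (Ψ : ℕ → ℕ → ℚ) → shuffle Ψ k ≡ shuffle (λ i l → Ψ l i) k
shuffle-comm zero    Ψ = refl
shuffle-comm (suc k) Ψ =
  trans (+-comm (shuffle (λ i l → Ψ (suc i) l) k) (shuffle (λ i l → Ψ i (suc l)) k))
        (cong₂ _+_ (shuffle-comm k (λ i l → Ψ i (suc l))) (shuffle-comm k (λ i l → Ψ (suc i) l)))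

-- Both sides are the trinomial sum: `k` labelled cars are distributed over three classes, and the
-- order in which the classes are separated is irrelevant.
shuffle-assoc : ∀ k (Ψ : ℕ → ℕ → ℕ → ℚ) →
  shuffle (λ i s → shuffle (Ψ i) s) k ≡ shuffle (λ t l → shuffle (λ i j → Ψ i j l) t) k
shuffle-assoc zero    Ψ = refl
shuffle-assoc (suc k) Ψ = begin
  shuffle (λ i s → shuffle (Ψ (suc i)) s) k +
  shuffle (λ i s → shuffle (λ j l → Ψ i (suc j) l) s + shuffle (λ j l → Ψ i j (suc l)) s) k
    ≡⟨ cong₂ _+_ (shuffle-assoc k (Ψ ∘ suc))
        (trans (shuffle-+ k (λ i s → shuffle (λ j l → Ψ i (suc j) l) s) (λ i s → shuffle (λ j l → Ψ i j (suc l)) s))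
               (cong₂ _+_ (shuffle-assoc k (λ i j l → Ψ i (suc j) l)) (shuffle-assoc k (λ i j l → Ψ i j (suc l))))) ⟩
  x + (y + z)
    ≡⟨ +-assoc x y z ⟨
  (x + y) + z
    ≡⟨ cong (_+ z) (shuffle-+ k (λ t l → shuffle (λ i j → Ψ (suc i) j l) t) (λ t l → shuffle (λ i j → Ψ i (suc j) l) t)) ⟨
  shuffle (λ t l → shuffle (λ i j → Ψ (suc i) j l) t + shuffle (λ i j → Ψ i (suc j) l) t) k + z ∎
  where
  open ≡-Reasoning
  x y z : ℚ
  x = shuffle (λ t l → shuffle (λ i j → Ψ (suc i) j l) t) k
  y = shuffle (λ t l → shuffle (λ i j → Ψ i (suc j) l) t) k
  z = shuffle (λ t l → shuffle (λ i j → Ψ i j (suc l)) t) k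

shuffle-sumFin : ∀ {n} k (Ψ : Fin n → ℕ → ℕ → ℚ) →
  sumFin (λ j → shuffle (Ψ j) k) ≡ shuffle (λ i l → sumFin (λ j → Ψ j i l)) k
shuffle-sumFin zero    Ψ = refl
shuffle-sumFin (suc k) Ψ =
  trans (sumFin-+ (λ j → shuffle (λ i l → Ψ j (suc i) l) k) (λ j → shuffle (λ i l → Ψ j i (suc l)) k))
        (cong₂ _+_ (shuffle-sumFin k (λ j i l → Ψ j (suc i) l)) (shuffle-sumFin k (λ j i l → Ψ j i (suc l))))

sumFin-single : ∀ n a b (f : ℕ → ℕ → ℚ) → n ≡ suc (a ℕ.+ b) → (∀ i l → l ≢ b → f i l ≡ 0ℚ) →
  sumFin {n} (λ j → f (toℕ j) (right j)) ≡ f a b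
sumFin-single (suc n) zero b f refl f≗0 =
  trans (cong (f 0 b +_) (sumFin-0 (λ j → f≗0 (suc (toℕ j)) (right j) (λ r≡b → ℕ.<-irrefl r≡b (right< j)))))
        (+-identityʳ (f 0 b))
  where
  right< : ∀ {n} (j : Fin n) → right j ℕ.< n
  right< zero    = ℕ.≤-refl
  right< (suc j) = ℕ.m≤n⇒m≤1+n (right< j)
sumFin-single (suc n) (suc a) b f eq f≗0 =
  trans (cong₂ _+_ (f≗0 0 n (λ n≡b → ℕ.<-irrefl (trans (sym n≡b) (ℕ.suc-injective eq)) (ℕ.s≤s (ℕ.m≤n+m b a))))
                   (sumFin-single n a b (f ∘ suc) (ℕ.suc-injective eq) (λ i → f≗0 (suc i))))
        (+-identityˡ (f (suc a) b))

-- If Ψ a b i s vanishes unless b = d + s, a single position contributes to each (i , s).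

shuffle-diagonal : ∀ n k d e (Ψ : ℕ → ℕ → ℕ → ℕ → ℚ) → n ≡ suc (k ℕ.+ e ℕ.+ d) →
  (∀ a b i s → b ≢ d ℕ.+ s → Ψ a b i s ≡ 0ℚ) →
  sumFin {n} (λ j → shuffle (Ψ (toℕ j) (right j)) k) ≡
  shuffle (λ i s → Ψ (i ℕ.+ e) (d ℕ.+ s) i s) k
shuffle-diagonal n k d e Ψ n≡ Ψ≗0 =
  trans (shuffle-sumFin {n} k (λ j → Ψ (toℕ j) (right j)))
        (shuffle-cong k (λ i s i+s≡k → sumFin-single n (i ℕ.+ e) (d ℕ.+ s) (λ a b → Ψ a b i s)
           (trans n≡ (cong suc (size i s i+s≡k))) (λ a b → Ψ≗0 a b i s)))
  where
  size : ∀ i s → i ℕ.+ s ≡ k → k ℕ.+ e ℕ.+ d ≡ i ℕ.+ e ℕ.+ (d ℕ.+ s)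
  size i s refl = +-*-Solver.solve 4
    (λ i s e d → i :+ s :+ e :+ d := i :+ e :+ (d :+ s)) refl i s e d
    where open +-*-Solver

-- Sums over the sequences of preferences of k cars

total : ∀ {n} → ℕ → Functional n → ℚ
total k F = parkN k F ⊥

splitAtFree-⊥ : ∀ {n} (j : Fin n) G H → splitAtFree j G H ⊥ ≡ G ⊥ * H ⊥
splitAtFree-⊥ zero    G H = refl
splitAtFree-⊥ (suc j) G H = splitAtFree-⊥ j (G ∘ (outside ∷_)) H

-- By the Leibniz rule `park-splitAtFree` each of the `k` cars acts on exactly one of the two
-- factors; the constant weight `one` is unchanged by the shift to the right part. Iterating a
-- product rule yields the binomial sum.
total-splitAtFree : ∀ {n} k (j : Fin n) G H →
  total k (splitAtFree j G H) ≡ shuffle (λ i l → total i G * total l H) k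
total-splitAtFree zero    j G H = splitAtFree-⊥ j G H
total-splitAtFree (suc k) j G H = begin
  total k (park one (splitAtFree j G H))
    ≡⟨ parkN-cong k (park-splitAtFree j one G H) ⊥ ⟩
  total k (λ S → splitAtFree j (park one G) H S + splitAtFree j G (park one H) S)
    ≡⟨ parkN-+ k (splitAtFree j (park one G) H) (splitAtFree j G (park one H)) ⊥ ⟩
  total k (splitAtFree j (park one G) H) + total k (splitAtFree j G (park one H))
    ≡⟨ cong₂ _+_ (total-splitAtFree k j (park one G) H) (total-splitAtFree k j G (park one H)) ⟩
  shuffle (λ i l → total i G * total l H) (suc k) ∎
  where open ≡-Reasoning

occupied : ∀ {n} → Subset n → ℕ
occupied []            = 0
occupied (outside ∷ S) = occupied S
occupied (inside  ∷ S) = suc (occupied S)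

firstFree-vanish : ∀ {n} c (F : Functional n) → (∀ S → occupied S ≡ c → F S ≡ 0ℚ) →
  ∀ S → suc (occupied S) ≡ c → firstFree F S ≡ 0ℚ
firstFree-vanish c F F≗0 []            eq = refl
firstFree-vanish c F F≗0 (outside ∷ S) eq = F≗0 (inside ∷ S) eq
firstFree-vanish (suc c) F F≗0 (inside ∷ S) eq =
  firstFree-vanish c (F ∘ (inside ∷_)) (λ T p → F≗0 (inside ∷ T) (cong suc p)) S (ℕ.suc-injective eq)

park-vanish : ∀ {n} g c (F : Functional n) → (∀ S → occupied S ≡ c → F S ≡ 0ℚ) →
  ∀ S → suc (occupied S) ≡ c → park g F S ≡ 0ℚ
park-vanish g c F F≗0 []      eq = refl
park-vanish g c F F≗0 (s ∷ S) eq = cong₂ _+_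
  (trans (cong (g 0 *_) (firstFree-vanish c F F≗0 (s ∷ S) eq)) (*-zeroʳ (g 0)))
  (rest c s F≗0 eq)
  where
  rest : ∀ c s → (∀ S → occupied S ≡ c → F S ≡ 0ℚ) → suc (occupied (s ∷ S)) ≡ c →
         park (g ∘ suc) (F ∘ (s ∷_)) S ≡ 0ℚ
  rest c       outside F≗0 eq = park-vanish (g ∘ suc) c (F ∘ (outside ∷_)) (λ T → F≗0 (outside ∷ T)) S eq
  rest (suc c) inside  F≗0 eq = park-vanish (g ∘ suc) c (F ∘ (inside ∷_))
    (λ T p → F≗0 (inside ∷ T) (cong suc p)) S (ℕ.suc-injective eq)

occupied-⊥ : ∀ n → occupied {n} ⊥ ≡ 0
occupied-⊥ zero    = refl
occupied-⊥ (suc n) = occupied-⊥ n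

-- Every parked car raises the number of occupied spots by exactly one, so `F` is evaluated only on
-- streets with `c` occupied spots.
parkN-vanish : ∀ {n} k c (F : Functional n) → (∀ S → occupied S ≡ c → F S ≡ 0ℚ) →
  ∀ S → occupied S ℕ.+ k ≡ c → parkN k F S ≡ 0ℚ
parkN-vanish zero    c F F≗0 S eq = F≗0 S (trans (sym (ℕ.+-identityʳ _)) eq)
parkN-vanish (suc k) zero    F F≗0 S eq with () ← trans (sym (ℕ.+-suc (occupied S) k)) eq
parkN-vanish (suc k) (suc c) F F≗0 S eq =
  parkN-vanish k c (park one F) (λ T p → park-vanish one (suc c) F F≗0 T (cong suc p)) S
    (ℕ.suc-injective (trans (sym (ℕ.+-suc (occupied S) k)) eq))

total-vanish : ∀ {n} k (F : Functional n) → (∀ S → occupied S ≡ k → F S ≡ 0ℚ) → total k F ≡ 0ℚ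
total-vanish {n} k F F≗0 = parkN-vanish k k F F≗0 ⊥ (cong (ℕ._+ k) (occupied-⊥ n))

free-0-vanish : ∀ {n} (S : Subset n) → occupied S ≢ n → free 0ℚ S ≡ 0ℚ
free-0-vanish []            p = ⊥-elim (p refl)
free-0-vanish (outside ∷ S) p = *-zeroˡ (free 0ℚ S)
free-0-vanish (inside  ∷ S) p = free-0-vanish S (p ∘ cong suc)

occupied≤ : ∀ {n} (S : Subset n) → occupied S ℕ.≤ n
occupied≤ []            = ℕ.z≤n
occupied≤ (outside ∷ S) = ℕ.m≤n⇒m≤1+n (occupied≤ S)
occupied≤ (inside  ∷ S) = ℕ.s≤s (occupied≤ S)

free-0-full : ∀ {n} (S : Subset n) → occupied S ≡ n → free 0ℚ S ≡ 1ℚ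
free-0-full []            p = refl
free-0-full (outside ∷ S) p = ⊥-elim (ℕ.<-irrefl p (ℕ.s≤s (occupied≤ S)))
free-0-full (inside  ∷ S) p = free-0-full S (ℕ.suc-injective p)

total-cong : ∀ {n} k {F G : Functional n} → (∀ S → F S ≡ G S) → total k F ≡ total k G
total-cong k F≗G = parkN-cong k F≗G ⊥

-- Linearity reduces this to `total-vanish` for the difference of `F` and `G`.
total-agree : ∀ {n} k (F G : Functional n) → (∀ S → occupied S ≡ k → F S ≡ G S) → total k F ≡ total k G
total-agree k F G F≗G = begin
  total k F                                 ≡⟨ cancel (total k F) (total k G) ⟩
  (total k F + (- 1ℚ) * total k G) + total k G
    ≡⟨ cong (λ x → (total k F + x) + total k G) (parkN-* k (- 1ℚ) G ⊥) ⟨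
  (total k F + total k (λ S → (- 1ℚ) * G S)) + total k G
    ≡⟨ cong (_+ total k G) (parkN-+ k F (λ S → (- 1ℚ) * G S) ⊥) ⟨
  total k (λ S → F S + (- 1ℚ) * G S) + total k G
    ≡⟨ cong (_+ total k G) (total-vanish k _ (λ S p →
         trans (cong (_+ (- 1ℚ) * G S) (F≗G S p)) (inverse (G S)))) ⟩
  0ℚ + total k G                            ≡⟨ +-identityˡ (total k G) ⟩
  total k G                                 ∎
  where
  open ≡-Reasoning
  cancel : ∀ x y → x ≡ (x + (- 1ℚ) * y) + y
  cancel = solve-∀ ℚ-ring
  inverse : ∀ y → y + (- 1ℚ) * y ≡ 0ℚ
  inverse = solve-∀ ℚ-ring

total-free-0 : ∀ n k → n ≢ k → total {n} k (free 0ℚ) ≡ 0ℚ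
total-free-0 n k n≢k =
  total-vanish k (free 0ℚ) (λ S p → free-0-vanish S (λ q → n≢k (trans (sym q) p)))

-- v e k counts the parking functions of k cars on k + e spots, and b = v 0.

b : ℕ → ℚ
b l = total {l} l (free 0ℚ)

v : ℕ → ℕ → ℚ
v e k = total {k ℕ.+ e} k (free 1ℚ)

-- With as many cars as spots every successful outcome is the full street, on which `free 0ℚ` and
-- `free 1ℚ` agree.
b≡v₀ : ∀ k → b k ≡ v 0 k
b≡v₀ k = trans
  (total-agree k (free 0ℚ) (free 1ℚ) (λ S p → trans (free-0-full S p) (sym (free-1 S))))
  (cong (λ n → total {n} k (free 1ℚ)) (sym (ℕ.+-identityʳ k)))

total-sum-splits : ∀ {n} k (c : ℕ → ℚ) x →
  total {n} k (λ S → sumFin (λ j → c (toℕ j) * splitAtFree j (free x) (free 0ℚ) S)) ≡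
  sumFin {n} (λ j → shuffle (λ i l → c (toℕ j) *
    (total {toℕ j} i (free x) * total {right j} l (free 0ℚ))) k)
total-sum-splits {n} k c x =
  trans (parkN-sumFin k (λ j S → c (toℕ j) * splitAtFree j (free x) (free 0ℚ) S) ⊥)
        (sumFin-cong {n} (λ j → begin
          total k (λ S → c (toℕ j) * splitAtFree j (free x) (free 0ℚ) S)
            ≡⟨ parkN-* k (c (toℕ j)) (splitAtFree j (free x) (free 0ℚ)) ⊥ ⟩
          c (toℕ j) * total k (splitAtFree j (free x) (free 0ℚ))
            ≡⟨ cong (c (toℕ j) *_) (total-splitAtFree k j (free x) (free 0ℚ)) ⟩
          c (toℕ j) * shuffle (λ i l → total i (free x) * total l (free 0ℚ)) k
            ≡⟨ shuffle-* k (c (toℕ j)) (λ i l → total i (free x) * total l (free 0ℚ)) ⟨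
          shuffle (λ i l → c (toℕ j) * (total i (free x) * total l (free 0ℚ))) k ∎))
  where open ≡-Reasoning

x*[y*0] : ∀ x y {z} → z ≡ 0ℚ → x * (y * z) ≡ 0ℚ
x*[y*0] x y refl = trans (cong (x *_) (*-zeroʳ y)) (*-zeroʳ x)

-- The `l` cars behind the last free spot must fill all spots behind it. Once the cars are divided
-- into `i` before and `l` behind, that spot is therefore determined: `i ℕ.+ e` spots precede it,
-- and the sum over positions collapses.
total-last-run : ∀ n k e (c : ℕ → ℚ) x → n ≡ suc (k ℕ.+ e) →
  total {n} k (λ S → sumFin (λ j → c (toℕ j) * splitAtFree j (free x) (free 0ℚ) S)) ≡
  shuffle (λ i l → c (i ℕ.+ e) * (total {i ℕ.+ e} i (free x) * b l)) k
total-last-run n k e c x n≡ =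
  trans (total-sum-splits {n} k c x)
        (shuffle-diagonal n k 0 e
           (λ a b i l → c a * (total {a} i (free x) * total {b} l (free 0ℚ)))
           (trans n≡ (cong suc (sym (ℕ.+-identityʳ (k ℕ.+ e)))))
           (λ a b i l b≢l → x*[y*0] (c a) (total {a} i (free x)) (total-free-0 b l b≢l)))

-- Cutting at the last free spot removes one gap and one run. With `b≡v₀`, `v e` is therefore the
-- convolution power of `b` with one factor for each of the e + 1 runs, empty ones included.
v-convolution : ∀ e k → v (suc e) k ≡ shuffle (λ i l → v e i * b l) k
v-convolution e k = begin
  total {n} k (free 1ℚ)
    ≡⟨ total-cong {n} k (free-split 1ℚ) ⟩
  total {n} k (λ S → free 0ℚ S + 1ℚ * sumFin (λ j → splitAtFree j (free 1ℚ) (free 0ℚ) S))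
    ≡⟨ total-cong {n} k (λ S → cong (free 0ℚ S +_) (sym (sumFin-* 1ℚ (λ j → splitAtFree j (free 1ℚ) (free 0ℚ) S)))) ⟩
  total {n} k (λ S → free 0ℚ S + sumFin (λ j → 1ℚ * splitAtFree j (free 1ℚ) (free 0ℚ) S))
    ≡⟨ parkN-+ {n} k (free 0ℚ) (λ S → sumFin (λ j → 1ℚ * splitAtFree j (free 1ℚ) (free 0ℚ) S)) ⊥ ⟩
  total {n} k (free 0ℚ) + total {n} k (λ S → sumFin (λ j → 1ℚ * splitAtFree j (free 1ℚ) (free 0ℚ) S))
    ≡⟨ cong₂ _+_ (total-free-0 n k (λ n≡k → ℕ.m+1+n≢m k n≡k)) (total-last-run n k e one 1ℚ (ℕ.+-suc k e)) ⟩
  0ℚ + shuffle (λ i l → 1ℚ * (v e i * b l)) k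
    ≡⟨ +-identityˡ _ ⟩
  shuffle (λ i l → 1ℚ * (v e i * b l)) k
    ≡⟨ shuffle-cong k (λ i l _ → *-identityˡ (v e i * b l)) ⟩
  shuffle (λ i l → v e i * b l) k ∎
  where
  open ≡-Reasoning
  n : ℕ
  n = k ℕ.+ suc e

total-park : ∀ n k e g → n ≡ suc (k ℕ.+ e) →
  total {n} k (park g (free 1ℚ)) ≡ shuffle (λ i l → sumBefore g (suc (i ℕ.+ e)) * (v e i * b l)) k
total-park n k e g n≡ =
  trans (total-cong {n} k (park-free g 1ℚ)) (total-last-run n k e (sumBefore g ∘ suc) 1ℚ n≡)

-- The `s` cars leave a single gap, with `i` of them before and `l` behind it; the further car
-- closes the gap, and both sides of it are full runs.
total-park-full : ∀ s g →
  total {suc s} s (park g (free 0ℚ)) ≡ shuffle (λ i l → sumBefore g (suc i) * (b i * b l)) s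
total-park-full s g = begin
  total {suc s} s (park g (free 0ℚ))
    ≡⟨ total-cong {suc s} s (park-free g 0ℚ) ⟩
  total {suc s} s (λ S → sumFin (λ j → sumBefore g (suc (toℕ j)) * splitAtFree j (free 0ℚ) (free 0ℚ) S))
    ≡⟨ total-last-run (suc s) s 0 (sumBefore g ∘ suc) 0ℚ (cong suc (sym (ℕ.+-identityʳ s))) ⟩
  shuffle (λ i l → sumBefore g (suc (i ℕ.+ 0)) * (total {i ℕ.+ 0} i (free 0ℚ) * b l)) s
    ≡⟨ shuffle-cong s (λ i l _ → cong (λ m → sumBefore g (suc m) * (total {m} i (free 0ℚ) * b l)) (ℕ.+-identityʳ i)) ⟩
  shuffle (λ i l → sumBefore g (suc i) * (b i * b l)) s ∎
  where open ≡-Reasoning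

v-suc : ∀ e k → v e (suc k) ≡ shuffle (λ i l → sumBefore one (suc (i ℕ.+ e)) * (v e i * b l)) k
v-suc e k = total-park (suc (k ℕ.+ e)) k e one refl

sumBefore-+ : ∀ g a b → sumBefore g (a ℕ.+ b) ≡ sumBefore g a + sumBefore (λ m → g (a ℕ.+ m)) b
sumBefore-+ g zero    b = sym (+-identityˡ _)
sumBefore-+ g (suc a) b =
  trans (cong (g 0 +_) (sumBefore-+ (g ∘ suc) a b)) (sym (+-assoc (g 0) (sumBefore (g ∘ suc) a) _))

-- i, j and l are the number of cars before the last but one free spot, between
-- the last two free spots, and after the last one.

shuffle₃ : (ℕ → ℕ → ℕ → ℚ) → ℕ → ℚ
shuffle₃ Ψ k = shuffle (λ t l → shuffle (λ i j → Ψ i j l) t) k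

shuffle₃-cong : ∀ k {Ψ Φ : ℕ → ℕ → ℕ → ℚ} → (∀ i j l → i ℕ.+ j ℕ.+ l ≡ k → Ψ i j l ≡ Φ i j l) →
  shuffle₃ Ψ k ≡ shuffle₃ Φ k
shuffle₃-cong k Ψ≗Φ = shuffle-cong k (λ t l t+l≡k →
  shuffle-cong t (λ i j i+j≡t → Ψ≗Φ i j l (trans (cong (ℕ._+ l) i+j≡t) t+l≡k)))

-- Two further cars both park iff neither prefers a spot beyond the last free one and they do not
-- both prefer spots beyond the last but one. Writing G(x), G(y) for the weights up to the last but
-- one and the last free spot, this is G(y)^2 - (G(y) - G(x))^2 = G(x) (2 G(y) - G(x)).
total-park-park : ∀ n k e g → n ≡ suc (suc (k ℕ.+ e)) →
  let G = sumBefore g in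
  total {n} k (park g (park g (free 1ℚ))) ≡
  shuffle₃ (λ i j l → let x = suc (i ℕ.+ e) ; y = suc (i ℕ.+ j ℕ.+ suc e) in
                      (G x * (G y + (G y - G x))) * (v e i * b j * b l)) k
total-park-park n k e g n≡ = begin
  total {n} k (park g (park g (free 1ℚ)))
    ≡⟨ total-cong {n} k (λ S → trans (park-cong g (park-free g 1ℚ) S)
          (trans (park-sumFin g (λ j S → G₁ (toℕ j) * splitAtFree j (free 1ℚ) (free 0ℚ) S) S)
                 (sumFin-cong (λ j → trans (park-* g (G₁ (toℕ j)) (splitAtFree j (free 1ℚ) (free 0ℚ)) S)
                   (cong (G₁ (toℕ j) *_) (park-splitAtFree j g (free 1ℚ) (free 0ℚ) S)))))) ⟩
  total {n} k (λ S → sumFin (λ j → G₁ (toℕ j) * (P j S + Q j S)))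
    ≡⟨ parkN-sumFin k (λ j S → G₁ (toℕ j) * (P j S + Q j S)) ⊥ ⟩
  sumFin {n} (λ j → total k (λ S → G₁ (toℕ j) * (P j S + Q j S)))
    ≡⟨ sumFin-cong (λ j → trans (parkN-* k (G₁ (toℕ j)) (λ S → P j S + Q j S) ⊥)
         (trans (cong (G₁ (toℕ j) *_) (trans (parkN-+ k (P j) (Q j) ⊥)
                  (cong₂ _+_ (total-splitAtFree k j (park g (free 1ℚ)) (free 0ℚ))
                             (total-splitAtFree k j (free 1ℚ) (park (after g (toℕ j)) (free 0ℚ))))))
                (push k (G₁ (toℕ j)) (λ i l → total {toℕ j} i (park g (free 1ℚ)) * total {right j} l (free 0ℚ))
                        (λ i s → total {toℕ j} i (free 1ℚ) * total {right j} s (park (after g (toℕ j)) (free 0ℚ)))))) ⟩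
  sumFin {n} (λ j → shuffle (Ψ₁ (toℕ j) (right j)) k + shuffle (Ψ₂ (toℕ j) (right j)) k)
    ≡⟨ sumFin-+ {n} (λ j → shuffle (Ψ₁ (toℕ j) (right j)) k) (λ j → shuffle (Ψ₂ (toℕ j) (right j)) k) ⟩
  sumFin {n} (λ j → shuffle (Ψ₁ (toℕ j) (right j)) k) + sumFin {n} (λ j → shuffle (Ψ₂ (toℕ j) (right j)) k)
    -- In `Ψ₁` the outer car stops before the last free spot `j`, which has e + 1 other gaps before
    -- it. In `Ψ₂` it prefers a spot behind `j` and closes the gap there, so s cars stand on s + 1
    -- spots behind `j` and only e gaps precede it; this is the offset 1.
    ≡⟨ cong₂ _+_
         (shuffle-diagonal n k 0 (suc e) Ψ₁ (trans n≡ (cong suc (trans (sym (ℕ.+-suc k e)) (sym (ℕ.+-identityʳ _)))))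
            (λ a b i l b≢l → x*[y*0] (G₁ a) (total {a} i (park g (free 1ℚ))) (total-free-0 b l b≢l)))
         (shuffle-diagonal n k 1 e Ψ₂ (trans n≡ (cong suc (ℕ.+-comm 1 (k ℕ.+ e))))
            (λ a b i s b≢ → x*[y*0] (G₁ a) (total {a} i (free 1ℚ))
               (total-vanish s _ (λ S p → park-vanish (after g a) (suc s) (free 0ℚ)
                 (λ T q → free-0-vanish T (λ r → b≢ (trans (sym r) q))) S (cong suc p))))) ⟩
  shuffle (λ t l → Ψ₁ (t ℕ.+ suc e) l t l) k + shuffle (λ i s → Ψ₂ (i ℕ.+ e) (suc s) i s) k
    ≡⟨ cong₂ _+_ (shuffle-cong k first) second ⟩
  shuffle₃ Φ₁ k + shuffle₃ Φ₂ k
    ≡⟨ shuffle-+ k (λ t l → shuffle (λ i j → Φ₁ i j l) t) (λ t l → shuffle (λ i j → Φ₂ i j l) t) ⟨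
  shuffle (λ t l → shuffle (λ i j → Φ₁ i j l) t + shuffle (λ i j → Φ₂ i j l) t) k
    ≡⟨ shuffle-cong k (λ t l _ → sym (shuffle-+ t (λ i j → Φ₁ i j l) (λ i j → Φ₂ i j l))) ⟩
  shuffle₃ (λ i j l → Φ₁ i j l + Φ₂ i j l) k
    ≡⟨ shuffle₃-cong k (λ i j l _ → combine i j l) ⟩
  _ ∎
  where
  open ≡-Reasoning
  G₁ : ℕ → ℚ
  G₁ j = sumBefore g (suc j)
  after : (ℕ → ℚ) → ℕ → ℕ → ℚ
  after g a m = g (suc (a ℕ.+ m))
  P Q : (j : Fin n) → Functional n
  P j = splitAtFree j (park g (free 1ℚ)) (free 0ℚ)
  Q j = splitAtFree j (free 1ℚ) (park (after g (toℕ j)) (free 0ℚ))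
  Ψ₁ Ψ₂ : ℕ → ℕ → ℕ → ℕ → ℚ
  Ψ₁ a b i l = G₁ a * (total {a} i (park g (free 1ℚ)) * total {b} l (free 0ℚ))
  Ψ₂ a b i s = G₁ a * (total {a} i (free 1ℚ) * total {b} s (park (after g a) (free 0ℚ)))
  Φ₁ Φ₂ : ℕ → ℕ → ℕ → ℚ
  Φ₁ i j l = (G₁ (i ℕ.+ j ℕ.+ suc e) * b l) * (G₁ (i ℕ.+ e) * (v e i * b j))
  Φ₂ i j l = (G₁ (i ℕ.+ e) * v e i) * (sumBefore (after g (i ℕ.+ e)) (suc j) * (b j * b l))
  push : ∀ k c Ψ Φ → c * (shuffle Ψ k + shuffle Φ k) ≡
    shuffle (λ i l → c * Ψ i l) k + shuffle (λ i l → c * Φ i l) k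
  push k c Ψ Φ = trans (*-distribˡ-+ c (shuffle Ψ k) (shuffle Φ k))
    (sym (cong₂ _+_ (shuffle-* k c Ψ) (shuffle-* k c Φ)))
  rotate : ∀ x y z → x * (y * z) ≡ (x * z) * y
  rotate = solve-∀ ℚ-ring
  first : ∀ t l → t ℕ.+ l ≡ k → Ψ₁ (t ℕ.+ suc e) l t l ≡ shuffle (λ i j → Φ₁ i j l) t
  first t l _ = begin
    G₁ (t ℕ.+ suc e) * (total {t ℕ.+ suc e} t (park g (free 1ℚ)) * b l)
      ≡⟨ rotate (G₁ (t ℕ.+ suc e)) (total {t ℕ.+ suc e} t (park g (free 1ℚ))) (b l) ⟩
    (G₁ (t ℕ.+ suc e) * b l) * total {t ℕ.+ suc e} t (park g (free 1ℚ))
      ≡⟨ cong ((G₁ (t ℕ.+ suc e) * b l) *_) (total-park (t ℕ.+ suc e) t e g (ℕ.+-suc t e)) ⟩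
    (G₁ (t ℕ.+ suc e) * b l) * shuffle (λ i j → G₁ (i ℕ.+ e) * (v e i * b j)) t
      ≡⟨ shuffle-* t (G₁ (t ℕ.+ suc e) * b l) (λ i j → G₁ (i ℕ.+ e) * (v e i * b j)) ⟨
    shuffle (λ i j → (G₁ (t ℕ.+ suc e) * b l) * (G₁ (i ℕ.+ e) * (v e i * b j))) t
      ≡⟨ shuffle-cong t (λ i j i+j≡t → cong (λ m → (G₁ (m ℕ.+ suc e) * b l) * (G₁ (i ℕ.+ e) * (v e i * b j))) (sym i+j≡t)) ⟩
    shuffle (λ i j → Φ₁ i j l) t ∎
  second : shuffle (λ i s → Ψ₂ (i ℕ.+ e) (suc s) i s) k ≡ shuffle₃ Φ₂ k
  second = trans (shuffle-cong k (λ i s _ → begin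
      G₁ (i ℕ.+ e) * (v e i * total {suc s} s (park (after g (i ℕ.+ e)) (free 0ℚ)))
        ≡⟨ *-assoc (G₁ (i ℕ.+ e)) (v e i) _ ⟨
      (G₁ (i ℕ.+ e) * v e i) * total {suc s} s (park (after g (i ℕ.+ e)) (free 0ℚ))
        ≡⟨ cong ((G₁ (i ℕ.+ e) * v e i) *_) (total-park-full s (after g (i ℕ.+ e))) ⟩
      (G₁ (i ℕ.+ e) * v e i) * shuffle (λ j l → sumBefore (after g (i ℕ.+ e)) (suc j) * (b j * b l)) s
        ≡⟨ shuffle-* s (G₁ (i ℕ.+ e) * v e i) (λ j l → sumBefore (after g (i ℕ.+ e)) (suc j) * (b j * b l)) ⟨
      shuffle (Φ₂ i) s ∎))
    (shuffle-assoc k Φ₂)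
  difference : ∀ i j → sumBefore (after g (i ℕ.+ e)) (suc j) ≡ G₁ (i ℕ.+ j ℕ.+ suc e) - G₁ (i ℕ.+ e)
  difference i j = begin
    sumBefore (after g (i ℕ.+ e)) (suc j)
      ≡⟨ cancel (G₁ (i ℕ.+ e)) (sumBefore (after g (i ℕ.+ e)) (suc j)) ⟩
    (G₁ (i ℕ.+ e) + sumBefore (after g (i ℕ.+ e)) (suc j)) - G₁ (i ℕ.+ e)
      ≡⟨ cong (_- G₁ (i ℕ.+ e)) (sumBefore-+ g (suc (i ℕ.+ e)) (suc j)) ⟨
    sumBefore g (suc (i ℕ.+ e) ℕ.+ suc j) - G₁ (i ℕ.+ e)
      ≡⟨ cong (λ m → sumBefore g (suc m) - G₁ (i ℕ.+ e)) (size i e j) ⟩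
    G₁ (i ℕ.+ j ℕ.+ suc e) - G₁ (i ℕ.+ e) ∎
    where
    cancel : ∀ x y → y ≡ (x + y) - x
    cancel = solve-∀ ℚ-ring
    size : ∀ i e j → i ℕ.+ e ℕ.+ suc j ≡ i ℕ.+ j ℕ.+ suc e
    size = +-*-Solver.solve 3 (λ i e j → i :+ e :+ (con 1 :+ j) := i :+ j :+ (con 1 :+ e)) refl
      where open +-*-Solver
  combine : ∀ i j l → Φ₁ i j l + Φ₂ i j l ≡
    (G₁ (i ℕ.+ e) * (G₁ (i ℕ.+ j ℕ.+ suc e) + (G₁ (i ℕ.+ j ℕ.+ suc e) - G₁ (i ℕ.+ e)))) * (v e i * b j * b l)
  combine i j l = trans
    (cong (λ D → Φ₁ i j l + (G₁ (i ℕ.+ e) * v e i) * (D * (b j * b l))) (difference i j))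
    (lemma (G₁ (i ℕ.+ e)) (G₁ (i ℕ.+ j ℕ.+ suc e)) (v e i) (b j) (b l))
    where
    lemma : ∀ x y v b b′ → (y * b′) * (x * (v * b)) + (x * v) * ((y - x) * (b * b′)) ≡
                           (x * (y + (y - x))) * (v * b * b′)
    lemma = solve-∀ ℚ-ring

-- A second embedding beside `ℕ→ℚ`: by recursion `ι (suc n)` unfolds to `1ℚ + ι n`, so that
-- identities about successors become polynomial identities. `ℕ→ℚ≡ι` identifies the two.
ι : ℕ → ℚ
ι zero    = 0ℚ
ι (suc n) = 1ℚ + ι n

ι-+ : ∀ a b → ι (a ℕ.+ b) ≡ ι a + ι b
ι-+ zero    b = sym (+-identityˡ (ι b))
ι-+ (suc a) b = trans (cong (1ℚ +_) (ι-+ a b)) (sym (+-assoc 1ℚ (ι a) (ι b)))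

sumBefore-one : ∀ j → sumBefore one j ≡ ι j
sumBefore-one zero    = refl
sumBefore-one (suc j) = cong (1ℚ +_) (sumBefore-one j)

-- Sequences as exponential generating functions, with variable 𝕩 and θ = 𝕩 d/d𝕩

Sequence : Set
Sequence = ℕ → ℚ

infixl 6 _⊕_
infixl 7 _⊛_

_⊕_ _⊛_ : Sequence → Sequence → Sequence
(f ⊕ g) k = f k + g k
(f ⊛ g) k = shuffle (λ i l → f i * g l) k

𝟎 𝟏 𝕩 : Sequence
𝟎 _ = 0ℚ
𝟏 zero    = 1ℚ
𝟏 (suc _) = 0ℚ
𝕩 zero    = 0ℚ
𝕩 (suc k) = 𝟏 k

⊛-cong : ∀ {f f′ g g′} → f ≗ f′ → g ≗ g′ → f ⊛ g ≗ f′ ⊛ g′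
⊛-cong f≗ g≗ k = shuffle-cong k (λ i l _ → cong₂ _*_ (f≗ i) (g≗ l))

⊛-comm : ∀ f g → f ⊛ g ≗ g ⊛ f
⊛-comm f g k = trans (shuffle-comm k (λ i l → f i * g l)) (shuffle-cong k (λ i l _ → *-comm (f l) (g i)))

⊛-assoc : ∀ f g h → (f ⊛ g) ⊛ h ≗ f ⊛ (g ⊛ h)
⊛-assoc f g h k = let open ≡-Reasoning in begin
  shuffle (λ t l → shuffle (λ i j → f i * g j) t * h l) k
    ≡⟨ shuffle-cong k (λ t l _ → begin
         shuffle (λ i j → f i * g j) t * h l
           ≡⟨ *-comm _ (h l) ⟩
         h l * shuffle (λ i j → f i * g j) t
           ≡⟨ shuffle-* t (h l) (λ i j → f i * g j) ⟨
         shuffle (λ i j → h l * (f i * g j)) t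
           ≡⟨ shuffle-cong t (λ i j _ → rotate (h l) (f i) (g j)) ⟩
         shuffle (λ i j → f i * (g j * h l)) t ∎) ⟩
  shuffle (λ t l → shuffle (λ i j → f i * (g j * h l)) t) k
    ≡⟨ shuffle-assoc k (λ i j l → f i * (g j * h l)) ⟨
  shuffle (λ i s → shuffle (λ j l → f i * (g j * h l)) s) k
    ≡⟨ shuffle-cong k (λ i s _ → shuffle-* s (f i) (λ j l → g j * h l)) ⟩
  shuffle (λ i s → f i * shuffle (λ j l → g j * h l) s) k ∎
  where
  rotate : ∀ x y z → x * (y * z) ≡ y * (z * x)
  rotate = solve-∀ ℚ-ring

⊛-identityˡ : ∀ f → 𝟏 ⊛ f ≗ f
⊛-identityˡ f zero    = *-identityˡ (f 0)
⊛-identityˡ f (suc k) = trans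
  (cong₂ _+_ (shuffle-0 k (λ i l → *-zeroˡ (f l))) (⊛-identityˡ (f ∘ suc) k)) (+-identityˡ (f (suc k)))

⊛-zeroˡ : ∀ f → 𝟎 ⊛ f ≗ 𝟎
⊛-zeroˡ f k = shuffle-0 k (λ i l → *-zeroˡ (f l))

⊛-distribˡ : ∀ f g h → f ⊛ (g ⊕ h) ≗ f ⊛ g ⊕ f ⊛ h
⊛-distribˡ f g h k = trans (shuffle-cong k (λ i l _ → *-distribˡ-+ (f i) (g l) (h l)))
  (shuffle-+ k (λ i l → f i * g l) (λ i l → f i * h l))

⊛-distribʳ : ∀ f g h → (g ⊕ h) ⊛ f ≗ g ⊛ f ⊕ h ⊛ f
⊛-distribʳ f g h k = trans (shuffle-cong k (λ i l _ → *-distribʳ-+ (f l) (g i) (h i)))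
  (shuffle-+ k (λ i l → g i * f l) (λ i l → h i * f l))

⊛-commutativeSemiring : CommutativeSemiring 0ℓ 0ℓ
⊛-commutativeSemiring = record
  { Carrier = Sequence
  ; _≈_ = _≗_
  ; _+_ = _⊕_
  ; _*_ = _⊛_
  ; 0# = 𝟎
  ; 1# = 𝟏
  ; isCommutativeSemiring = record
    { isSemiring = record
      { isSemiringWithoutAnnihilatingZero = record
        { +-isCommutativeMonoid = record
          { isMonoid = record
            { isSemigroup = record
              { isMagma = record
                { isEquivalence = record
                  { refl = λ _ → refl
                  ; sym = λ p k → sym (p k)
                  ; trans = λ p q k → trans (p k) (q k)
                  }
                ; ∙-cong = λ p q k → cong₂ _+_ (p k) (q k)
                }
              ; assoc = λ f g h k → +-assoc (f k) (g k) (h k)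
              }
            ; identity = (λ f k → +-identityˡ (f k)) , (λ f k → +-identityʳ (f k))
            }
          ; comm = λ f g k → +-comm (f k) (g k)
          }
        ; *-cong = ⊛-cong
        ; *-assoc = ⊛-assoc
        ; *-identity = ⊛-identityˡ , (λ f k → trans (⊛-comm f 𝟏 k) (⊛-identityˡ f k))
        ; distrib = ⊛-distribˡ , ⊛-distribʳ
        }
      ; zero = ⊛-zeroˡ , (λ f k → trans (⊛-comm f 𝟎 k) (⊛-zeroˡ f k))
      }
    ; *-comm = ⊛-comm
    }
  }

module ⊛-Solver = Algebra.Solver.Ring.NaturalCoefficients.Default ⊛-commutativeSemiring

module ≗-Reasoning where
  open import Relation.Binary.Reasoning.Setoid (CommutativeSemiring.setoid ⊛-commutativeSemiring) public

scale : ℚ → Sequence → Sequence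
scale a f k = a * f k

scale-⊛ : ∀ a f g → scale a f ⊛ g ≗ scale a (f ⊛ g)
scale-⊛ a f g k = trans (shuffle-cong k (λ i l _ → *-assoc a (f i) (g l)))
                        (shuffle-* k a (λ i l → f i * g l))

𝕩-⊛ : ∀ f k → (𝕩 ⊛ f) (suc k) ≡ ι (suc k) * f k
𝕩-⊛ f zero    = lemma (f 0) (f 1)
  where
  lemma : ∀ x y → 1ℚ * x + 0ℚ * y ≡ (1ℚ + 0ℚ) * x
  lemma = solve-∀ ℚ-ring
𝕩-⊛ f (suc k) = trans (cong₂ _+_ (⊛-identityˡ f (suc k)) (𝕩-⊛ (f ∘ suc) k)) (lemma (f (suc k)) (ι (suc k)))
  where
  lemma : ∀ x y → x + y * x ≡ (1ℚ + y) * x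
  lemma = solve-∀ ℚ-ring

θ : Sequence → Sequence
θ f k = ι k * f k

θ-⊛ : ∀ f g → θ (f ⊛ g) ≗ θ f ⊛ g ⊕ f ⊛ θ g
θ-⊛ f g k = begin
  ι k * shuffle (λ i l → f i * g l) k
    ≡⟨ shuffle-* k (ι k) (λ i l → f i * g l) ⟨
  shuffle (λ i l → ι k * (f i * g l)) k
    ≡⟨ shuffle-cong k (λ i l i+l≡k → trans (cong (λ n → n * (f i * g l)) (trans (cong ι (sym i+l≡k)) (ι-+ i l)))
                                           (lemma (ι i) (ι l) (f i) (g l))) ⟩
  shuffle (λ i l → θ f i * g l + f i * θ g l) k
    ≡⟨ shuffle-+ k (λ i l → θ f i * g l) (λ i l → f i * θ g l) ⟩
  (θ f ⊛ g) k + (f ⊛ θ g) k ∎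
  where
  open ≡-Reasoning
  lemma : ∀ a c x y → (a + c) * (x * y) ≡ (a * x) * y + x * (c * y)
  lemma = solve-∀ ℚ-ring

θ-cong : ∀ {f g} → f ≗ g → θ f ≗ θ g
θ-cong f≗g k = cong (ι k *_) (f≗g k)

θ-⊕ : ∀ f g → θ (f ⊕ g) ≗ θ f ⊕ θ g
θ-⊕ f g k = *-distribˡ-+ (ι k) (f k) (g k)

θ-𝟏 : θ 𝟏 ≗ 𝟎
θ-𝟏 zero    = refl
θ-𝟏 (suc k) = *-zeroʳ (ι (suc k))

θ-𝕩 : θ 𝕩 ≗ 𝕩
θ-𝕩 zero          = refl
θ-𝕩 (suc zero)    = refl
θ-𝕩 (suc (suc k)) = *-zeroʳ (ι (suc (suc k)))

-- The runs are exchangeable, so the mean of the last one is k over their number.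

θ-v : ∀ e → θ (v e) ⊛ b ≗ scale (ι (suc e)) (v e ⊛ θ b)
θ-v zero = begin
  θ (v 0) ⊛ b            ≈⟨ ⊛-cong (θ-cong b≡v₀) (λ _ → refl) ⟨
  θ b ⊛ b                ≈⟨ ⊛-comm (θ b) b ⟩
  b ⊛ θ b                ≈⟨ ⊛-cong b≡v₀ (λ _ → refl) ⟩
  v 0 ⊛ θ b              ≈⟨ (λ k → lemma ((v 0 ⊛ θ b) k)) ⟩
  scale (ι 1) (v 0 ⊛ θ b) ∎
  where
  open ≗-Reasoning
  lemma : ∀ x → x ≡ (1ℚ + 0ℚ) * x
  lemma = solve-∀ ℚ-ring
θ-v (suc e) = begin
  θ (v (suc e)) ⊛ b
    ≈⟨ ⊛-cong (θ-cong (v-convolution e)) (λ _ → refl) ⟩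
  θ (v e ⊛ b) ⊛ b
    ≈⟨ ⊛-cong (θ-⊛ (v e) b) (λ _ → refl) ⟩
  (θ (v e) ⊛ b ⊕ v e ⊛ θ b) ⊛ b
    ≈⟨ ⊛-cong (λ k → cong (_+ (v e ⊛ θ b) k) (θ-v e k)) (λ _ → refl) ⟩
  (scale (ι (suc e)) (v e ⊛ θ b) ⊕ v e ⊛ θ b) ⊛ b
    ≈⟨ ⊛-cong (λ k → lemma (ι (suc e)) ((v e ⊛ θ b) k)) (λ _ → refl) ⟩
  scale (ι (suc (suc e))) (v e ⊛ θ b) ⊛ b
    ≈⟨ scale-⊛ (ι (suc (suc e))) (v e ⊛ θ b) b ⟩
  scale (ι (suc (suc e))) ((v e ⊛ θ b) ⊛ b)
    ≈⟨ (λ k → cong (ι (suc (suc e)) *_) (swap (v e) (θ b) b k)) ⟩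
  scale (ι (suc (suc e))) ((v e ⊛ b) ⊛ θ b)
    ≈⟨ (λ k → cong (ι (suc (suc e)) *_) (⊛-cong (v-convolution e) (λ _ → refl) k)) ⟨
  scale (ι (suc (suc e))) (v (suc e) ⊛ θ b) ∎
  where
  open ≗-Reasoning
  lemma : ∀ a x → a * x + x ≡ (1ℚ + a) * x
  lemma = solve-∀ ℚ-ring
  swap : ∀ f g h → (f ⊛ g) ⊛ h ≗ (f ⊛ h) ⊛ g
  swap = ⊛-Solver.solve 3 (λ f g h → (f :* g) :* h := (f :* h) :* g) (λ _ → refl)
    where open ⊛-Solver using (_:*_; _:=_)

-- The lengths of the e + 2 runs add up to `k`, and `θ` marks one car. By the product rule the
-- marked car lies in the last run or before it, and `θ-v` says that the second case weighs e + 1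
-- times the first.
mean-run : ∀ e k → ι (suc (suc e)) * (v e ⊛ θ b) k ≡ ι k * v (suc e) k
mean-run e k = sym (begin
  ι k * v (suc e) k
    ≡⟨ cong (ι k *_) (v-convolution e k) ⟩
  θ (v e ⊛ b) k
    ≡⟨ θ-⊛ (v e) b k ⟩
  (θ (v e) ⊛ b) k + (v e ⊛ θ b) k
    ≡⟨ cong (_+ (v e ⊛ θ b) k) (θ-v e k) ⟩
  ι (suc e) * (v e ⊛ θ b) k + (v e ⊛ θ b) k
    ≡⟨ lemma (ι (suc e)) ((v e ⊛ θ b) k) ⟩
  ι (suc (suc e)) * (v e ⊛ θ b) k ∎)
  where
  open ≡-Reasoning
  lemma : ∀ a x → a * x + x ≡ (1ℚ + a) * x
  lemma = solve-∀ ℚ-ring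

-- The car parked last may prefer every spot except the `l` in the final run; the subtracted term is
-- the sum of these lengths.
v-suc′ : ∀ e k → v e (suc k) ≡ ι (suc (k ℕ.+ e)) * v (suc e) k - (v e ⊛ θ b) k
v-suc′ e k = begin
  v e (suc k)
    ≡⟨ v-suc e k ⟩
  shuffle (λ i l → sumBefore one (suc (i ℕ.+ e)) * (v e i * b l)) k
    ≡⟨ shuffle-cong k (λ i l i+l≡k → trans (cong (_* (v e i * b l)) (weight i l i+l≡k))
                                           (lemma n (ι l) (v e i) (b l))) ⟩
  shuffle (λ i l → n * (v e i * b l) + (- 1ℚ) * (v e i * θ b l)) k
    ≡⟨ shuffle-linear k n (- 1ℚ) (λ i l → v e i * b l) (λ i l → v e i * θ b l) ⟩
  n * (v e ⊛ b) k + (- 1ℚ) * (v e ⊛ θ b) k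
    ≡⟨ cong₂ (λ x y → n * x + y) (sym (v-convolution e k)) (minus ((v e ⊛ θ b) k)) ⟩
  n * v (suc e) k - (v e ⊛ θ b) k ∎
  where
  open ≡-Reasoning
  n : ℚ
  n = ι (suc (k ℕ.+ e))
  lemma : ∀ n l x y → (n - l) * (x * y) ≡ n * (x * y) + (- 1ℚ) * (x * (l * y))
  lemma = solve-∀ ℚ-ring
  minus : ∀ x → (- 1ℚ) * x ≡ - x
  minus = solve-∀ ℚ-ring
  cancel : ∀ i l e → 1ℚ + (i + e) ≡ (1ℚ + ((i + l) + e)) - l
  cancel = solve-∀ ℚ-ring
  weight : ∀ i l → i ℕ.+ l ≡ k → sumBefore one (suc (i ℕ.+ e)) ≡ n - ι l
  weight i l refl = trans (sumBefore-one (suc (i ℕ.+ e))) (trans (cong (1ℚ +_) (ι-+ i e))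
    (trans (cancel (ι i) (ι l) (ι e))
           (cong (λ x → (1ℚ + x) - ι l) (sym (trans (ι-+ (i ℕ.+ l) e) (cong (_+ ι e) (ι-+ i l)))))))

-- With the exact mean inserted, `v-suc′` closes up into a recursion that trades one car for one gap
-- on a street of fixed length.
v-suc-v : ∀ e k → ι (suc (suc e)) * v e (suc k) ≡ (ι (suc e) * ι (suc (suc (k ℕ.+ e)))) * v (suc e) k
v-suc-v e k = begin
  ι (suc (suc e)) * v e (suc k)
    ≡⟨ cong (ι (suc (suc e)) *_) (v-suc′ e k) ⟩
  ι (suc (suc e)) * (ι (suc (k ℕ.+ e)) * v (suc e) k - (v e ⊛ θ b) k)
    ≡⟨ distrib (ι (suc (suc e))) (ι (suc (k ℕ.+ e))) (v (suc e) k) ((v e ⊛ θ b) k) ⟩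
  (ι (suc (suc e)) * ι (suc (k ℕ.+ e))) * v (suc e) k - ι (suc (suc e)) * (v e ⊛ θ b) k
    ≡⟨ cong₂ (λ x y → (ι (suc (suc e)) * (1ℚ + x)) * v (suc e) k - y) (ι-+ k e) (mean-run e k) ⟩
  (ι (suc (suc e)) * (1ℚ + (ι k + ι e))) * v (suc e) k - ι k * v (suc e) k
    ≡⟨ lemma (ι e) (ι k) (v (suc e) k) ⟩
  (ι (suc e) * (1ℚ + (1ℚ + (ι k + ι e)))) * v (suc e) k
    ≡⟨ cong (λ x → (ι (suc e) * (1ℚ + (1ℚ + x))) * v (suc e) k) (ι-+ k e) ⟨
  (ι (suc e) * ι (suc (suc (k ℕ.+ e)))) * v (suc e) k ∎
  where
  open ≡-Reasoning
  distrib : ∀ a n x y → a * (n * x - y) ≡ (a * n) * x - a * y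
  distrib = solve-∀ ℚ-ring
  lemma : ∀ e k x → ((1ℚ + (1ℚ + e)) * (1ℚ + (k + e))) * x - k * x ≡ ((1ℚ + e) * (1ℚ + (1ℚ + (k + e)))) * x
  lemma = solve-∀ ℚ-ring

-- Order and powers

*-mono-≤ˡ : ∀ a {x y} → 0ℚ ≤ a → x ≤ y → a * x ≤ a * y
*-mono-≤ˡ a 0≤a = *-monoˡ-≤-nonNeg a {{nonNegative 0≤a}}
  where open import Data.Rational.Base using (nonNegative)

*-mono-≤ʳ : ∀ a {x y} → 0ℚ ≤ a → x ≤ y → x * a ≤ y * a
*-mono-≤ʳ a 0≤a = *-monoʳ-≤-nonNeg a {{nonNegative 0≤a}}
  where open import Data.Rational.Base using (nonNegative)

*-nonNeg : ∀ {x y} → 0ℚ ≤ x → 0ℚ ≤ y → 0ℚ ≤ x * y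
*-nonNeg {x} {y} 0≤x 0≤y = subst (_≤ x * y) (*-zeroʳ x) (*-mono-≤ˡ x 0≤x 0≤y)

+-nonNeg : ∀ {x y} → 0ℚ ≤ x → 0ℚ ≤ y → 0ℚ ≤ x + y
+-nonNeg = +-mono-≤

*-pos : ∀ {x y} → 0ℚ < x → 0ℚ < y → 0ℚ < x * y
*-pos {x} {y} 0<x 0<y = subst (_< x * y) (*-zeroʳ x) (*-monoʳ-<-pos x {{positive 0<x}} 0<y)
  where open import Data.Rational.Base using (positive)

*-cancelˡ-≤ : ∀ a {x y} → 0ℚ < a → a * x ≤ a * y → x ≤ y
*-cancelˡ-≤ a 0<a = *-cancelˡ-≤-pos a {{positive 0<a}}
  where open import Data.Rational.Base using (positive)

*-cancelˡ-≡ : ∀ a {x y} → 0ℚ < a → a * x ≡ a * y → x ≡ y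
*-cancelˡ-≡ a 0<a p = ≤-antisym (*-cancelˡ-≤ a 0<a (≤-reflexive p)) (*-cancelˡ-≤ a 0<a (≤-reflexive (sym p)))

*-cancelˡ-pos : ∀ a {x} → 0ℚ ≤ a → 0ℚ < a * x → 0ℚ < x
*-cancelˡ-pos a {x} 0≤a p = *-cancelˡ-<-nonNeg a {{nonNegative 0≤a}} (subst (_< a * x) (sym (*-zeroʳ a)) p)
  where open import Data.Rational.Base using (nonNegative)

0≤1 : 0ℚ ≤ 1ℚ
0≤1 = <⇒≤ (positive⁻¹ 1ℚ)

ι-nonNeg : ∀ n → 0ℚ ≤ ι n
ι-nonNeg zero    = ≤-refl
ι-nonNeg (suc n) = +-nonNeg 0≤1 (ι-nonNeg n)

ι-pos : ∀ n → 0ℚ < ι (suc n)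
ι-pos n = +-mono-<-≤ (positive⁻¹ 1ℚ) (ι-nonNeg n)

x≤x+y : ∀ x {y} → 0ℚ ≤ y → x ≤ x + y
x≤x+y x {y} 0≤y = subst (_≤ x + y) (+-identityʳ x) (+-monoʳ-≤ x 0≤y)

x≤y+x : ∀ x {y} → 0ℚ ≤ y → x ≤ y + x
x≤y+x x {y} 0≤y = subst (_≤ y + x) (+-identityˡ x) (+-monoˡ-≤ x 0≤y)

pow : ℚ → ℕ → ℚ
pow x zero    = 1ℚ
pow x (suc r) = x * pow x r

pow-pos : ∀ {x} r → 0ℚ < x → 0ℚ < pow x r
pow-pos zero    0<x = positive⁻¹ 1ℚ
pow-pos (suc r) 0<x = *-pos 0<x (pow-pos r 0<x)

pow-nonNeg : ∀ {x} r → 0ℚ ≤ x → 0ℚ ≤ pow x r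
pow-nonNeg zero    0≤x = 0≤1
pow-nonNeg (suc r) 0≤x = *-nonNeg 0≤x (pow-nonNeg r 0≤x)

v-zero : ∀ e → v e 0 ≡ 1ℚ
v-zero e = free-1 (⊥ {e})
  where open import Data.Fin.Subset using (⊥)

-- With n = k + e this is the classical count (n-k+1)(n+1)^(k-1), multiplied by n + 1 to avoid the
-- exponent -1 at k = 0. The recursion `v-suc-v` keeps n fixed, so each step contributes one more
-- factor n + 1.
v-closed : ∀ e k → ι (suc (k ℕ.+ e)) * v e k ≡ ι (suc e) * pow (ι (suc (k ℕ.+ e))) k
v-closed e zero    = cong (ι (suc e) *_) (v-zero e)
v-closed e (suc k) = *-cancelˡ-≡ (ι (suc (suc e))) (ι-pos (suc e)) (begin
  ι (suc (suc e)) * (N * v e (suc k))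
    ≡⟨ swap (ι (suc (suc e))) N (v e (suc k)) ⟩
  N * (ι (suc (suc e)) * v e (suc k))
    ≡⟨ cong (N *_) (v-suc-v e k) ⟩
  N * ((ι (suc e) * N) * v (suc e) k)
    ≡⟨ assoc N (ι (suc e)) (v (suc e) k) ⟩
  (N * ι (suc e)) * (N * v (suc e) k)
    ≡⟨ cong (λ m → (N * ι (suc e)) * (ι (suc m) * v (suc e) k)) (sym (ℕ.+-suc k e)) ⟩
  (N * ι (suc e)) * (ι (suc (k ℕ.+ suc e)) * v (suc e) k)
    ≡⟨ cong ((N * ι (suc e)) *_) (v-closed (suc e) k) ⟩
  (N * ι (suc e)) * (ι (suc (suc e)) * pow (ι (suc (k ℕ.+ suc e))) k)
    ≡⟨ cong (λ m → (N * ι (suc e)) * (ι (suc (suc e)) * pow (ι (suc m)) k)) (ℕ.+-suc k e) ⟩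
  (N * ι (suc e)) * (ι (suc (suc e)) * pow N k)
    ≡⟨ reorder N (ι (suc e)) (ι (suc (suc e))) (pow N k) ⟩
  ι (suc (suc e)) * (ι (suc e) * (N * pow N k)) ∎)
  where
  open ≡-Reasoning
  N : ℚ
  N = ι (suc (suc (k ℕ.+ e)))
  swap : ∀ a n x → a * (n * x) ≡ n * (a * x)
  swap = solve-∀ ℚ-ring
  assoc : ∀ n a x → n * ((a * n) * x) ≡ (n * a) * (n * x)
  assoc = solve-∀ ℚ-ring
  reorder : ∀ n a c p → (n * a) * (c * p) ≡ c * (a * (n * p))
  reorder = solve-∀ ℚ-ring

v-pos : ∀ e k → 0ℚ < v e k
v-pos e k = *-cancelˡ-pos (ι (suc (k ℕ.+ e))) (ι-nonNeg (suc (k ℕ.+ e)))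
  (subst (0ℚ <_) (sym (v-closed e k)) (*-pos (ι-pos e) (pow-pos k (ι-pos (k ℕ.+ e)))))

b-nonNeg : ∀ k → 0ℚ ≤ b k
b-nonNeg k = subst (0ℚ ≤_) (sym (b≡v₀ k)) (<⇒≤ (v-pos 0 k))

shuffle-mono-≤ : ∀ k {Ψ Φ : ℕ → ℕ → ℚ} → (∀ i l → Ψ i l ≤ Φ i l) → shuffle Ψ k ≤ shuffle Φ k
shuffle-mono-≤ zero    Ψ≤Φ = Ψ≤Φ 0 0
shuffle-mono-≤ (suc k) Ψ≤Φ =
  +-mono-≤ (shuffle-mono-≤ k (λ i l → Ψ≤Φ (suc i) l)) (shuffle-mono-≤ k (λ i l → Ψ≤Φ i (suc l)))

shuffle-nonNeg : ∀ k {Ψ : ℕ → ℕ → ℚ} → (∀ i l → 0ℚ ≤ Ψ i l) → 0ℚ ≤ shuffle Ψ k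
shuffle-nonNeg zero    0≤Ψ = 0≤Ψ 0 0
shuffle-nonNeg (suc k) 0≤Ψ =
  +-nonNeg (shuffle-nonNeg k (λ i l → 0≤Ψ (suc i) l)) (shuffle-nonNeg k (λ i l → 0≤Ψ i (suc l)))

NonNeg : Sequence → Set
NonNeg f = ∀ k → 0ℚ ≤ f k

⊛-nonNeg : ∀ {f g} → NonNeg f → NonNeg g → NonNeg (f ⊛ g)
⊛-nonNeg 0≤f 0≤g k = shuffle-nonNeg k (λ i l → *-nonNeg (0≤f i) (0≤g l))

⊛-monoʳ-≤ : ∀ {f g h} → NonNeg f → (∀ k → g k ≤ h k) → ∀ k → (f ⊛ g) k ≤ (f ⊛ h) k
⊛-monoʳ-≤ {f} 0≤f g≤h k = shuffle-mono-≤ k (λ i l → *-mono-≤ˡ (f i) (0≤f i) (g≤h l))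

𝕩-nonNeg : NonNeg 𝕩
𝕩-nonNeg zero          = ≤-refl
𝕩-nonNeg (suc zero)    = 0≤1
𝕩-nonNeg (suc (suc k)) = ≤-refl

𝟏-nonNeg : NonNeg 𝟏
𝟏-nonNeg zero    = 0≤1
𝟏-nonNeg (suc k) = ≤-refl

-- T is the tree function, and D = 1 / (1 - T) as T satisfies θ T = T / (1 - T).

T D : Sequence
T = 𝕩 ⊛ b
D = 𝟏 ⊕ θ T

v-one : v 1 ≗ b ⊛ b
v-one k = trans (v-convolution 0 k) (⊛-cong (λ i → sym (b≡v₀ i)) (λ _ → refl) k)

-- The car parked last closes the only gap, and i + 1 preferences lead there when i cars stand
-- before it; so b(k+1) is a coefficient of b (b + θ b). Multiplication by k + 1 turns this into a
-- differential equation. It is read off `v-suc′` and `mean-run` at e = 0.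
θ-b : θ b ≗ 𝕩 ⊛ (b ⊛ (b ⊕ θ b))
θ-b zero    = trans (*-zeroˡ (b 0)) (sym (*-zeroˡ ((b ⊛ (b ⊕ θ b)) 0)))
θ-b (suc k) = trans (cong (ι (suc k) *_) step) (sym (𝕩-⊛ (b ⊛ (b ⊕ θ b)) k))
  where
  open ≡-Reasoning
  R : ℚ
  R = (v 0 ⊛ θ b) k
  regroup : ∀ k x r → k * x ≡ (1ℚ + (1ℚ + 0ℚ)) * r → (1ℚ + k) * x - r ≡ x + r
  regroup k x r p = trans (expand k x r) (trans (cong (λ y → x + y - r) p) (collapse x r))
    where
    expand : ∀ k x r → (1ℚ + k) * x - r ≡ x + k * x - r
    expand = solve-∀ ℚ-ring
    collapse : ∀ x r → x + (1ℚ + (1ℚ + 0ℚ)) * r - r ≡ x + r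
    collapse = solve-∀ ℚ-ring
  step : b (suc k) ≡ (b ⊛ (b ⊕ θ b)) k
  step = begin
    b (suc k)                                 ≡⟨ b≡v₀ (suc k) ⟩
    v 0 (suc k)                               ≡⟨ v-suc′ 0 k ⟩
    ι (suc (k ℕ.+ 0)) * v 1 k - R             ≡⟨ cong (λ m → ι (suc m) * v 1 k - R) (ℕ.+-identityʳ k) ⟩
    ι (suc k) * v 1 k - R                     ≡⟨ regroup (ι k) (v 1 k) R (sym (mean-run 0 k)) ⟩
    v 1 k + R                                 ≡⟨ cong₂ _+_ (v-one k) (⊛-cong (λ i → sym (b≡v₀ i)) (λ _ → refl) k) ⟩
    (b ⊛ b) k + (b ⊛ θ b) k                   ≡⟨ ⊛-distribˡ b b (θ b) k ⟨
    (b ⊛ (b ⊕ θ b)) k                         ∎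

θ-T : θ T ≗ 𝕩 ⊛ (b ⊕ θ b)
θ-T = begin
  θ (𝕩 ⊛ b)            ≈⟨ θ-⊛ 𝕩 b ⟩
  θ 𝕩 ⊛ b ⊕ 𝕩 ⊛ θ b    ≈⟨ (λ k → cong (_+ (𝕩 ⊛ θ b) k) (⊛-cong θ-𝕩 (λ _ → refl) k)) ⟩
  𝕩 ⊛ b ⊕ 𝕩 ⊛ θ b      ≈⟨ ⊛-distribˡ 𝕩 b (θ b) ⟨
  𝕩 ⊛ (b ⊕ θ b)        ∎
  where open ≗-Reasoning

b-D : b ⊛ D ≗ b ⊕ θ b
b-D = begin
  b ⊛ (𝟏 ⊕ θ T)                 ≈⟨ ⊛-cong {b} (λ _ → refl) (λ k → cong (𝟏 k +_) (θ-T k)) ⟩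
  b ⊛ (𝟏 ⊕ 𝕩 ⊛ (b ⊕ θ b))       ≈⟨ lemma b 𝕩 (b ⊕ θ b) ⟩
  b ⊕ 𝕩 ⊛ (b ⊛ (b ⊕ θ b))       ≈⟨ (λ k → cong (b k +_) (θ-b k)) ⟨
  b ⊕ θ b                       ∎
  where
  open ≗-Reasoning
  lemma : ∀ f x g → f ⊛ (𝟏 ⊕ x ⊛ g) ≗ f ⊕ x ⊛ (f ⊛ g)
  lemma = ⊛-Solver.solve 3 (λ f x g → f :* (con 1 :+ x :* g) := f :+ x :* (f :* g)) (λ _ → refl)
    where open ⊛-Solver using (_:*_; _:+_; con; _:=_)

θT≗T⊛D : θ T ≗ T ⊛ D
θT≗T⊛D = begin
  θ T              ≈⟨ θ-T ⟩
  𝕩 ⊛ (b ⊕ θ b)    ≈⟨ ⊛-cong {𝕩} (λ _ → refl) b-D ⟨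
  𝕩 ⊛ (b ⊛ D)      ≈⟨ ⊛-assoc 𝕩 b D ⟨
  T ⊛ D            ∎
  where open ≗-Reasoning

-- This is D (1 - T) = 1 without subtraction, so that the whole calculus stays in a commutative
-- semiring with nonnegative coefficients, where dropping summands gives inequalities.
D-unfold : D ≗ 𝟏 ⊕ T ⊛ D
D-unfold k = cong (𝟏 k +_) (θT≗T⊛D k)

-- From D = 1/(1 - T) one expects θ D = D^2 θ T = T D^3. To avoid inverting a series, D θ D is
-- expanded in two ways, through `D-unfold` and through its derivative, and the common summand T D θ
-- D is cancelled.
θ-D : θ D ≗ T ⊛ (D ⊛ (D ⊛ D))
θ-D k = cancel (θ D k) _ ((T ⊛ (D ⊛ θ D)) k) (trans (sym (via k)) (via′ k))
  where
  open ≗-Reasoning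
  open ⊛-Solver using (_:*_; _:+_; con; _:=_)
  cancel : ∀ x y z → x + z ≡ y + z → x ≡ y
  cancel x y z p = trans (undo x z) (trans (cong (_- z) p) (sym (undo y z)))
    where
    undo : ∀ x z → x ≡ x + z - z
    undo = solve-∀ ℚ-ring
  θ-D-unfold : θ D ≗ (T ⊛ D) ⊛ D ⊕ T ⊛ θ D
  θ-D-unfold = begin
    θ (𝟏 ⊕ θ T)                   ≈⟨ θ-⊕ 𝟏 (θ T) ⟩
    θ 𝟏 ⊕ θ (θ T)                 ≈⟨ (λ k → cong₂ _+_ (θ-𝟏 k) (θ-cong θT≗T⊛D k)) ⟩
    𝟎 ⊕ θ (T ⊛ D)                 ≈⟨ (λ k → +-identityˡ (θ (T ⊛ D) k)) ⟩
    θ (T ⊛ D)                     ≈⟨ θ-⊛ T D ⟩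
    θ T ⊛ D ⊕ T ⊛ θ D             ≈⟨ (λ k → cong (_+ (T ⊛ θ D) k) (⊛-cong θT≗T⊛D (λ _ → refl) k)) ⟩
    (T ⊛ D) ⊛ D ⊕ T ⊛ θ D         ∎
  via : D ⊛ θ D ≗ θ D ⊕ T ⊛ (D ⊛ θ D)
  via = begin
    D ⊛ θ D                       ≈⟨ ⊛-cong D-unfold (λ _ → refl) ⟩
    (𝟏 ⊕ T ⊛ D) ⊛ θ D             ≈⟨ ⊛-Solver.solve 3 (λ t d e → (con 1 :+ t :* d) :* e := e :+ t :* (d :* e))
                                        (λ _ → refl) T D (θ D) ⟩
    θ D ⊕ T ⊛ (D ⊛ θ D)           ∎
  via′ : D ⊛ θ D ≗ T ⊛ (D ⊛ (D ⊛ D)) ⊕ T ⊛ (D ⊛ θ D)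
  via′ = begin
    D ⊛ θ D                       ≈⟨ ⊛-cong {D} (λ _ → refl) θ-D-unfold ⟩
    D ⊛ ((T ⊛ D) ⊛ D ⊕ T ⊛ θ D)   ≈⟨ ⊛-Solver.solve 3
                                       (λ t d e → d :* ((t :* d) :* d :+ t :* e) :=
                                                  t :* (d :* (d :* d)) :+ t :* (d :* e))
                                       (λ _ → refl) T D (θ D) ⟩
    T ⊛ (D ⊛ (D ⊛ D)) ⊕ T ⊛ (D ⊛ θ D) ∎

bD^ : ℕ → Sequence
bD^ zero    = b
bD^ (suc j) = bD^ j ⊛ D

bD^-unfold : ∀ j → bD^ (suc j) ≗ bD^ j ⊕ T ⊛ bD^ (suc j)
bD^-unfold j = begin
  bD^ j ⊛ D                  ≈⟨ ⊛-cong {bD^ j} (λ _ → refl) D-unfold ⟩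
  bD^ j ⊛ (𝟏 ⊕ T ⊛ D)        ≈⟨ ⊛-Solver.solve 3 (λ g t d → g :* (con 1 :+ t :* d) := g :+ t :* (g :* d))
                                   (λ _ → refl) (bD^ j) T D ⟩
  bD^ j ⊕ T ⊛ (bD^ j ⊛ D)    ∎
  where
  open ≗-Reasoning
  open ⊛-Solver using (_:*_; _:+_; con; _:=_)

-- The product rule with θ b = T b D and θ D = T D^3: differentiating `b` costs one power of `D`,
-- differentiating any of the `j` factors `D` costs two.
θ-bD^ : ∀ j → θ (bD^ j) ≗ T ⊛ (bD^ (suc j) ⊕ scale (ι j) (bD^ (suc (suc j))))
θ-bD^ zero = begin
  θ b                               ≈⟨ θ-b ⟩
  𝕩 ⊛ (b ⊛ (b ⊕ θ b))               ≈⟨ ⊛-assoc 𝕩 b (b ⊕ θ b) ⟨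
  T ⊛ (b ⊕ θ b)                     ≈⟨ ⊛-cong {T} (λ _ → refl) (λ k → lemma k) ⟩
  T ⊛ (b ⊛ D ⊕ scale 0ℚ ((b ⊛ D) ⊛ D))   ∎
  where
  open ≗-Reasoning
  pad : ∀ x y → x ≡ x + 0ℚ * y
  pad = solve-∀ ℚ-ring
  lemma : ∀ k → b k + θ b k ≡ (b ⊛ D) k + 0ℚ * ((b ⊛ D) ⊛ D) k
  lemma k = trans (sym (b-D k)) (pad ((b ⊛ D) k) (((b ⊛ D) ⊛ D) k))
θ-bD^ (suc j) = begin
  θ (bD^ j ⊛ D)
    ≈⟨ θ-⊛ (bD^ j) D ⟩
  θ (bD^ j) ⊛ D ⊕ bD^ j ⊛ θ D
    ≈⟨ (λ k → cong₂ _+_ (⊛-cong (θ-bD^ j) (λ _ → refl) k) (⊛-cong {bD^ j} (λ _ → refl) θ-D k)) ⟩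
  (T ⊛ (bD^ (suc j) ⊕ S)) ⊛ D ⊕ bD^ j ⊛ (T ⊛ (D ⊛ (D ⊛ D)))
    ≈⟨ ⊛-Solver.solve 5 (λ t p s d q → (t :* (p :+ s)) :* d :+ q :* (t :* (d :* (d :* d))) :=
         t :* (p :* d :+ (s :* d :+ ((q :* d) :* d) :* d))) (λ _ → refl) T (bD^ (suc j)) S D (bD^ j) ⟩
  T ⊛ (bD^ (suc (suc j)) ⊕ (S ⊛ D ⊕ bD^ (suc (suc (suc j)))))
    ≈⟨ ⊛-cong {T} (λ _ → refl) (λ k → cong (bD^ (suc (suc j)) k +_)
         (trans (cong (_+ bD^ (suc (suc (suc j))) k) (scale-⊛ (ι j) (bD^ (suc (suc j))) D k))
                (lemma (ι j) (bD^ (suc (suc (suc j))) k)))) ⟩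
  T ⊛ (bD^ (suc (suc j)) ⊕ scale (ι (suc j)) (bD^ (suc (suc (suc j))))) ∎
  where
  open ≗-Reasoning
  open ⊛-Solver using (_:*_; _:+_; _:=_)
  S : Sequence
  S = scale (ι j) (bD^ (suc (suc j)))
  lemma : ∀ a x → a * x + x ≡ (1ℚ + a) * x
  lemma = solve-∀ ℚ-ring

T-nonNeg : NonNeg T
T-nonNeg = ⊛-nonNeg 𝕩-nonNeg b-nonNeg

D-nonNeg : NonNeg D
D-nonNeg k = +-nonNeg (𝟏-nonNeg k) (*-nonNeg (ι-nonNeg k) (T-nonNeg k))

bD^-nonNeg : ∀ j → NonNeg (bD^ j)
bD^-nonNeg zero    = b-nonNeg
bD^-nonNeg (suc j) = ⊛-nonNeg (bD^-nonNeg j) D-nonNeg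

T⊛bD^≤ : ∀ j k → (T ⊛ bD^ (suc j)) k ≤ bD^ (suc j) k
T⊛bD^≤ j k = subst ((T ⊛ bD^ (suc j)) k ≤_) (sym (bD^-unfold j k)) (x≤y+x _ (bD^-nonNeg j k))

bD^-mono : ∀ j k → bD^ j k ≤ bD^ (suc j) k
bD^-mono j k = subst (bD^ j k ≤_) (sym (bD^-unfold j k))
  (x≤x+y (bD^ j k) (⊛-nonNeg T-nonNeg (bD^-nonNeg (suc j)) k))

θ-bD^≤ : ∀ j k → θ (bD^ j) k ≤ ι (suc j) * bD^ (suc (suc j)) k
θ-bD^≤ j k = begin
  θ (bD^ j) k
    ≡⟨ θ-bD^ j k ⟩
  (T ⊛ (bD^ (suc j) ⊕ scale (ι j) (bD^ (suc (suc j))))) k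
    ≡⟨ ⊛-distribˡ T (bD^ (suc j)) (scale (ι j) (bD^ (suc (suc j)))) k ⟩
  (T ⊛ bD^ (suc j)) k + (T ⊛ scale (ι j) (bD^ (suc (suc j)))) k
    ≡⟨ cong ((T ⊛ bD^ (suc j)) k +_) ((trans (⊛-comm T (scale (ι j) (bD^ (suc (suc j)))) k)
         (trans (scale-⊛ (ι j) (bD^ (suc (suc j))) T k) (cong (ι j *_) (⊛-comm (bD^ (suc (suc j))) T k))))) ⟩
  (T ⊛ bD^ (suc j)) k + ι j * (T ⊛ bD^ (suc (suc j))) k
    ≤⟨ +-mono-≤ (≤-trans (T⊛bD^≤ j k) (bD^-mono (suc j) k)) (*-mono-≤ˡ (ι j) (ι-nonNeg j) (T⊛bD^≤ (suc j) k)) ⟩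
  bD^ (suc (suc j)) k + ι j * bD^ (suc (suc j)) k
    ≡⟨ lemma (ι j) (bD^ (suc (suc j)) k) ⟩
  ι (suc j) * bD^ (suc (suc j)) k ∎
  where
  open ≤-Reasoning
  lemma : ∀ a x → x + a * x ≡ (1ℚ + a) * x
  lemma = solve-∀ ℚ-ring

-- Moments of the last run

moment : ℕ → Sequence
moment r l = pow (ι l) r * b l

-- Each factor l is one application of `θ`, which by `θ-bD^≤` raises the exponent by 2. The
-- witnesses are j = 2r and C = 1 · 3 · 5 ⋯ (2r-1).
moment-bound : ∀ r → ∃[ C ] 0ℚ ≤ C × ∃[ j ] ∀ l → moment r l ≤ C * bD^ j l
moment-bound zero    = 1ℚ , 0≤1 , 0 , (λ l → ≤-refl)
moment-bound (suc r) with moment-bound r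
... | C , 0≤C , j , bound = C * ι (suc j) , *-nonNeg 0≤C (ι-nonNeg (suc j)) , suc (suc j) , λ l → begin
  (ι l * pow (ι l) r) * b l                        ≡⟨ *-assoc (ι l) (pow (ι l) r) (b l) ⟩
  ι l * (pow (ι l) r * b l)                        ≤⟨ *-mono-≤ˡ (ι l) (ι-nonNeg l) (bound l) ⟩
  ι l * (C * bD^ j l)                              ≡⟨ swap (ι l) C (bD^ j l) ⟩
  C * (ι l * bD^ j l)                              ≤⟨ *-mono-≤ˡ C 0≤C (θ-bD^≤ j l) ⟩
  C * (ι (suc j) * bD^ (suc (suc j)) l)            ≡⟨ *-assoc C (ι (suc j)) (bD^ (suc (suc j)) l) ⟨
  (C * ι (suc j)) * bD^ (suc (suc j)) l            ∎
  where
  open ≤-Reasoning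
  swap : ∀ a c x → a * (c * x) ≡ c * (a * x)
  swap = solve-∀ ℚ-ring

module _ (c κ : ℚ) (0≤κ : 0ℚ ≤ κ) (κ-fix : 1ℚ + c * κ ≡ κ) where

  -- In bD^(j+1) = bD^j + 𝕩 b bD^(j+1) the factor `b` is absorbed into `v e`, giving `v (suc e)`,
  -- and `𝕩` lowers the number of cars by one at the price of a factor at most c q. Since k + e, and
  -- with it q, is preserved, the bounds add up to (1 + c κ) κ^j q^k = κ^(j+1) q^k; κ is the sum of
  -- the geometric series in c.
  v⊛bD^-bound : ∀ j k e → let q = ι (suc (suc (k ℕ.+ e))) in
    ι k ≤ c * q → (v e ⊛ bD^ j) k ≤ pow κ j * pow q k
  v⊛bD^-bound zero k e k≤cq = *-cancelˡ-≤ q (ι-pos (suc (k ℕ.+ e))) (begin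
    q * (v e ⊛ b) k                                 ≡⟨ cong₂ (λ m x → ι (suc m) * x) (sym (ℕ.+-suc k e)) (sym (v-convolution e k)) ⟩
    ι (suc (k ℕ.+ suc e)) * v (suc e) k             ≡⟨ v-closed (suc e) k ⟩
    ι (suc (suc e)) * pow (ι (suc (k ℕ.+ suc e))) k ≡⟨ cong (λ m → ι (suc (suc e)) * pow (ι (suc m)) k) (ℕ.+-suc k e) ⟩
    ι (suc (suc e)) * pow q k                       ≤⟨ *-mono-≤ʳ (pow q k) (<⇒≤ (pow-pos k (ι-pos (suc (k ℕ.+ e)))))
                                                                  (+-monoʳ-≤ 1ℚ (+-monoʳ-≤ 1ℚ e≤)) ⟩
    q * pow q k                                     ≡⟨ cong (q *_) (sym (*-identityˡ (pow q k))) ⟩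
    q * (1ℚ * pow q k)                              ∎)
    where
    open ≤-Reasoning
    q : ℚ
    q = ι (suc (suc (k ℕ.+ e)))
    e≤ : ι e ≤ ι (k ℕ.+ e)
    e≤ = subst (ι e ≤_) (sym (ι-+ k e)) (x≤y+x (ι e) (ι-nonNeg k))
  v⊛bD^-bound (suc j) zero e k≤cq = begin
    v e 0 * bD^ (suc j) 0                     ≡⟨ cong (v e 0 *_) (bD^-unfold j 0) ⟩
    v e 0 * (bD^ j 0 + (0ℚ * b 0) * bD^ (suc j) 0) ≡⟨ drop (v e 0) (bD^ j 0) (b 0) (bD^ (suc j) 0) ⟩
    v e 0 * bD^ j 0                           ≤⟨ v⊛bD^-bound j zero e k≤cq ⟩
    pow κ j * 1ℚ                              ≤⟨ *-mono-≤ʳ 1ℚ 0≤1 κ-grow ⟩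
    (κ * pow κ j) * 1ℚ                        ∎
    where
    open ≤-Reasoning
    drop : ∀ v x y z → v * (x + (0ℚ * y) * z) ≡ v * x
    drop = solve-∀ ℚ-ring
    -- For k = 0 the hypothesis reads 0 ≤ c q, which supplies the sign of `c`; hence κ = 1 + c κ is
    -- at least 1.
    0≤cκ : 0ℚ ≤ c * κ
    0≤cκ = *-nonNeg 0≤c 0≤κ
      where
      0≤c : 0ℚ ≤ c
      0≤c = *-cancelˡ-≤ (ι (suc (suc e))) (ι-pos (suc e))
        (subst₂ _≤_ (sym (*-zeroʳ (ι (suc (suc e))))) (*-comm c (ι (suc (suc e)))) k≤cq)
    κ-grow : pow κ j ≤ κ * pow κ j
    κ-grow = subst (_≤ κ * pow κ j) (*-identityˡ (pow κ j))
      (*-mono-≤ʳ (pow κ j) (pow-nonNeg j 0≤κ) (subst (1ℚ ≤_) κ-fix (x≤x+y 1ℚ 0≤cκ)))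
  v⊛bD^-bound (suc j) (suc k) e k≤cq = begin
    (v e ⊛ bD^ (suc j)) (suc k)
      ≡⟨ ⊛-cong {v e} (λ _ → refl) (bD^-unfold j) (suc k) ⟩
    (v e ⊛ (bD^ j ⊕ T ⊛ bD^ (suc j))) (suc k)
      ≡⟨ rearrange (suc k) ⟩
    (v e ⊛ bD^ j) (suc k) + (𝕩 ⊛ ((v e ⊛ b) ⊛ bD^ (suc j))) (suc k)
      ≡⟨ cong ((v e ⊛ bD^ j) (suc k) +_) (trans (𝕩-⊛ ((v e ⊛ b) ⊛ bD^ (suc j)) k)
           (cong (ι (suc k) *_) (⊛-cong (λ i → sym (v-convolution e i)) (λ _ → refl) k))) ⟩
    (v e ⊛ bD^ j) (suc k) + ι (suc k) * (v (suc e) ⊛ bD^ (suc j)) k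
      ≤⟨ +-mono-≤ (v⊛bD^-bound j (suc k) e k≤cq)
           (*-mono-≤ˡ (ι (suc k)) (ι-nonNeg (suc k))
             (subst (λ m → (v (suc e) ⊛ bD^ (suc j)) k ≤ pow κ (suc j) * pow (ι (suc (suc m))) k)
             (ℕ.+-suc k e) (v⊛bD^-bound (suc j) k (suc e) k≤cq′))) ⟩
    pow κ j * (q * pow q k) + ι (suc k) * (pow κ (suc j) * pow q k)
      ≤⟨ +-monoʳ-≤ (pow κ j * (q * pow q k)) (*-mono-≤ʳ (pow κ (suc j) * pow q k)
           (*-nonNeg (*-nonNeg 0≤κ (pow-nonNeg j 0≤κ)) (<⇒≤ (pow-pos k (ι-pos (suc (suc (k ℕ.+ e))))))) k≤cq) ⟩
    pow κ j * (q * pow q k) + (c * q) * (pow κ (suc j) * pow q k)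
      ≡⟨ collect (pow κ j) q (pow q k) c κ ⟩
    ((1ℚ + c * κ) * pow κ j) * (q * pow q k)
      ≡⟨ cong (λ x → (x * pow κ j) * (q * pow q k)) κ-fix ⟩
    pow κ (suc j) * pow q (suc k) ∎
    where
    open ≤-Reasoning
    open ⊛-Solver using (_:*_; _:+_; _:=_)
    q : ℚ
    q = ι (suc (suc (suc k ℕ.+ e)))
    rearrange : v e ⊛ (bD^ j ⊕ T ⊛ bD^ (suc j)) ≗ v e ⊛ bD^ j ⊕ 𝕩 ⊛ ((v e ⊛ b) ⊛ bD^ (suc j))
    rearrange = ⊛-Solver.solve 5 (λ v g x b h → v :* (g :+ (x :* b) :* h) := v :* g :+ x :* ((v :* b) :* h))
      (λ _ → refl) (v e) (bD^ j) 𝕩 b (bD^ (suc j))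
    k≤cq′ : ι k ≤ c * ι (suc (suc (k ℕ.+ suc e)))
    k≤cq′ = subst (λ m → ι k ≤ c * ι (suc (suc m))) (sym (ℕ.+-suc k e)) (≤-trans (x≤y+x (ι k) 0≤1) k≤cq)
    collect : ∀ p q r c κ → p * (q * r) + (c * q) * ((κ * p) * r) ≡ ((1ℚ + c * κ) * p) * (q * r)
    collect = solve-∀ ℚ-ring

  moments-bounded : ∀ r → ∃[ C ] ∀ k e → ι k ≤ c * ι (suc (suc (k ℕ.+ e))) →
    (v e ⊛ moment r) k ≤ C * v (suc e) k
  moments-bounded r with moment-bound r
  ... | C , 0≤C , j , bound = C * pow κ j * κ , λ k e k≤cq →
    let q = ι (suc (suc (k ℕ.+ e))) in begin
    (v e ⊛ moment r) k              ≤⟨ ⊛-monoʳ-≤ (λ i → <⇒≤ (v-pos e i)) bound k ⟩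
    (v e ⊛ scale C (bD^ j)) k       ≡⟨ trans (⊛-comm (v e) (scale C (bD^ j)) k)
                                         (trans (scale-⊛ C (bD^ j) (v e) k) (cong (C *_) (⊛-comm (bD^ j) (v e) k))) ⟩
    C * (v e ⊛ bD^ j) k             ≤⟨ *-mono-≤ˡ C 0≤C (v⊛bD^-bound j k e k≤cq) ⟩
    C * (pow κ j * pow q k)         ≤⟨ *-mono-≤ˡ C 0≤C (*-mono-≤ˡ (pow κ j) (pow-nonNeg j 0≤κ) (pow≤κv k e k≤cq)) ⟩
    C * (pow κ j * (κ * v (suc e) k)) ≡⟨ assoc C (pow κ j) κ (v (suc e) k) ⟩
    C * pow κ j * κ * v (suc e) k   ∎
    where
    open ≤-Reasoning
    assoc : ∀ a p k x → a * (p * (k * x)) ≡ a * p * k * x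
    assoc = solve-∀ ℚ-ring
    pow≤κv : ∀ k e → let q = ι (suc (suc (k ℕ.+ e))) in ι k ≤ c * q → pow q k ≤ κ * v (suc e) k
    pow≤κv k e k≤cq = *-cancelˡ-≤ q (ι-pos (suc (k ℕ.+ e))) (begin
      q * pow q k                         ≤⟨ *-mono-≤ʳ (pow q k) (<⇒≤ (pow-pos k (ι-pos (suc (k ℕ.+ e))))) q≤κe ⟩
      (κ * ι (suc (suc e))) * pow q k     ≡⟨ *-assoc κ (ι (suc (suc e))) (pow q k) ⟩
      κ * (ι (suc (suc e)) * pow q k)     ≡⟨ cong (λ m → κ * (ι (suc (suc e)) * pow (ι (suc m)) k)) (sym (ℕ.+-suc k e)) ⟩
      κ * (ι (suc (suc e)) * pow (ι (suc (k ℕ.+ suc e))) k)  ≡⟨ cong (κ *_) (sym (v-closed (suc e) k)) ⟩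
      κ * (ι (suc (k ℕ.+ suc e)) * v (suc e) k)  ≡⟨ cong (λ m → κ * (ι (suc m) * v (suc e) k)) (ℕ.+-suc k e) ⟩
      κ * (q * v (suc e) k)               ≡⟨ swap κ q (v (suc e) k) ⟩
      q * (κ * v (suc e) k)               ∎)
      where
      q : ℚ
      q = ι (suc (suc (k ℕ.+ e)))
      swap : ∀ a b x → a * (b * x) ≡ b * (a * x)
      swap = solve-∀ ℚ-ring
      q-split : q ≡ ι k + ι (suc (suc e))
      q-split = trans (cong (λ x → 1ℚ + (1ℚ + x)) (ι-+ k e)) (lemma (ι k) (ι e))
        where
        lemma : ∀ k e → 1ℚ + (1ℚ + (k + e)) ≡ k + (1ℚ + (1ℚ + e))
        lemma = solve-∀ ℚ-ring
      -- As q = k + (e + 2) and k ≤ c q, the gaps satisfy e + 2 ≥ (1 - c) q. Multiplied by κ, this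
      -- makes q^k comparable with the closed form (e + 2) q^(k-1) of the total weight.
      q≤κe : q ≤ κ * ι (suc (suc e))
      q≤κe = subst₂ _≤_ (lemma₁ (κ * ι k) q) (lemma₂ κ (ι k) (ι (suc (suc e))))
        (+-monoʳ-≤ (- (κ * ι k)) (begin
          κ * ι k + q                    ≤⟨ +-monoˡ-≤ q (*-mono-≤ˡ κ 0≤κ k≤cq) ⟩
          κ * (c * q) + q                ≡⟨ factor κ c q ⟩
          (1ℚ + c * κ) * q               ≡⟨ cong₂ _*_ κ-fix q-split ⟩
          κ * (ι k + ι (suc (suc e)))    ∎))
        where
        factor : ∀ κ c q → κ * (c * q) + q ≡ (1ℚ + c * κ) * q
        factor = solve-∀ ℚ-ring
        lemma₁ : ∀ x q → - x + (x + q) ≡ q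
        lemma₁ = solve-∀ ℚ-ring
        lemma₂ : ∀ κ k e → - (κ * k) + κ * (k + e) ≡ κ * e
        lemma₂ = solve-∀ ℚ-ring

-- Natural numbers, reciprocals and absolute values in ℚ

toℚᵘ-ℕ→ℚ : ∀ n → toℚᵘ (ℕ→ℚ n) ℚᵘ.≃ mkℚᵘ (ℤ.+ n) 0
toℚᵘ-ℕ→ℚ n = toℚᵘ-fromℚᵘ (mkℚᵘ (ℤ.+ n) 0)

ℕ→ℚ≡ι : ∀ n → ℕ→ℚ n ≡ ι n
ℕ→ℚ≡ι zero    = refl
ℕ→ℚ≡ι (suc n) = trans (toℚᵘ-injective (begin
  toℚᵘ (ℕ→ℚ (suc n))                  ≈⟨ toℚᵘ-ℕ→ℚ (suc n) ⟩
  mkℚᵘ (ℤ.+ suc n) 0                    ≈⟨ *≡* (cong (λ x → (ℤ.+ 1 ℤ.+ x) ℤ.* ℤ.+ 1) (sym (ℤ.*-identityʳ (ℤ.+ n)))) ⟩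
  mkℚᵘ (ℤ.+ 1) 0 ℚᵘ.+ mkℚᵘ (ℤ.+ n) 0  ≈⟨ ℚᵘ.+-cong {mkℚᵘ (ℤ.+ 1) 0} {mkℚᵘ (ℤ.+ 1) 0} (*≡* refl) (ℚᵘ.≃-sym (toℚᵘ-ℕ→ℚ n)) ⟩
  toℚᵘ 1ℚ ℚᵘ.+ toℚᵘ (ℕ→ℚ n)           ≈⟨ toℚᵘ-homo-+ 1ℚ (ℕ→ℚ n) ⟨
  toℚᵘ (1ℚ + ℕ→ℚ n)                   ∎)) (cong (1ℚ +_) (ℕ→ℚ≡ι n))
  where open ℚᵘ.≃-Reasoning

1/n*n : ∀ n → (ℤ.+ 1 / suc n) * ι (suc n) ≡ 1ℚ
1/n*n n = trans (cong ((ℤ.+ 1 / suc n) *_) (sym (ℕ→ℚ≡ι (suc n)))) (toℚᵘ-injective (begin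
  toℚᵘ ((ℤ.+ 1 / suc n) * ℕ→ℚ (suc n))          ≈⟨ toℚᵘ-homo-* (ℤ.+ 1 / suc n) (ℕ→ℚ (suc n)) ⟩
  toℚᵘ (ℤ.+ 1 / suc n) ℚᵘ.* toℚᵘ (ℕ→ℚ (suc n))  ≈⟨ ℚᵘ.*-cong (toℚᵘ-fromℚᵘ (mkℚᵘ (ℤ.+ 1) n)) (toℚᵘ-ℕ→ℚ (suc n)) ⟩
  mkℚᵘ (ℤ.+ 1) n ℚᵘ.* mkℚᵘ (ℤ.+ suc n) 0          ≈⟨ *≡* (cong (λ m → ℤ.+ suc m)
                                                   (trans (cong (ℕ._* 1) (ℕ.+-identityʳ n)) (sym (ℕ.+-identityʳ (n ℕ.* 1))))) ⟩
  toℚᵘ 1ℚ                                     ∎))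
  where open ℚᵘ.≃-Reasoning

archimedean : ∀ p → ∃[ N ] p ≤ ι N
archimedean p = ℤ.∣ ↥ p ∣ , subst (p ≤_) (ℕ→ℚ≡ι ℤ.∣ ↥ p ∣)
  (toℚᵘ-cancel-≤ (ℚᵘ.≤-trans (bound p) (ℚᵘ.≤-reflexive (ℚᵘ.≃-sym (toℚᵘ-ℕ→ℚ ℤ.∣ ↥ p ∣)))))
  where
  bound : ∀ p → toℚᵘ p ℚᵘ.≤ mkℚᵘ (ℤ.+ ℤ.∣ ↥ p ∣) 0
  bound (mkℚ (ℤ.+ n) d _)    = *≤* (ℤ.*-monoˡ-≤-nonNeg (ℤ.+ n) (ℤ.+≤+ (ℕ.s≤s ℕ.z≤n)))
  bound (mkℚ ℤ.-[1+ n ] d _) = *≤* ℤ.-≤+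

ι-mono : ∀ {m n} → m ℕ.≤ n → ι m ≤ ι n
ι-mono {n = n} ℕ.z≤n = ι-nonNeg n
ι-mono (ℕ.s≤s m≤n)   = +-monoʳ-≤ 1ℚ (ι-mono m≤n)

inv : ∀ x → 0ℚ < x → ℚ
inv x 0<x = (1/ x) {{pos⇒nonZero x {{positive 0<x}}}}

inv-* : ∀ x (0<x : 0ℚ < x) → inv x 0<x * x ≡ 1ℚ
inv-* x 0<x = *-inverseˡ x {{pos⇒nonZero x {{positive 0<x}}}}

inv-nonNeg : ∀ x (0<x : 0ℚ < x) → 0ℚ ≤ inv x 0<x
inv-nonNeg x 0<x = <⇒≤ (positive⁻¹ (inv x 0<x) {{1/pos⇒pos x {{positive 0<x}}}})

∣x∣≤ : ∀ {x y} → 0ℚ ≤ y - x → 0ℚ ≤ y + x → ∣ x ∣ ≤ y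
∣x∣≤ {x} {y} 0≤y-x 0≤y+x with ∣p∣≡p∨∣p∣≡-p x
... | inj₁ p = subst₂ _≤_ (trans (lemma x) (sym p)) (lemma′ x y) (+-monoʳ-≤ x 0≤y-x)
  where
  lemma : ∀ x → x + 0ℚ ≡ x
  lemma = solve-∀ ℚ-ring
  lemma′ : ∀ x y → x + (y - x) ≡ y
  lemma′ = solve-∀ ℚ-ring
... | inj₂ p = subst₂ _≤_ (trans (lemma x) (sym p)) (lemma′ x y) (+-monoʳ-≤ (- x) 0≤y+x)
  where
  lemma : ∀ x → - x + 0ℚ ≡ - x
  lemma = solve-∀ ℚ-ring
  lemma′ : ∀ x y → - x + (y + x) ≡ y
  lemma′ = solve-∀ ℚ-ring

square-nonNeg : ∀ x → 0ℚ ≤ x * x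
square-nonNeg x with ≤-total 0ℚ x
... | inj₁ 0≤x = *-nonNeg 0≤x 0≤x
... | inj₂ x≤0 = subst (0ℚ ≤_) (lemma x) (*-nonNeg (neg-antimono-≤ x≤0) (neg-antimono-≤ x≤0))
  where
  lemma : ∀ x → (- x) * (- x) ≡ x * x
  lemma = solve-∀ ℚ-ring

-- Bounded families

record Bounded {I : Set} (f : I → ℚ) : Set where
  constructor _,_
  field
    bound   : ℚ
    bounded : ∀ i → ∣ f i ∣ ≤ bound

module _ {I : Set} where

  bounded-const : ∀ x → Bounded {I} (λ _ → x)
  bounded-const x = ∣ x ∣ , λ _ → ≤-refl

  bounded-+ : ∀ {f g : I → ℚ} → Bounded f → Bounded g → Bounded (λ i → f i + g i)
  bounded-+ {f} {g} (C , p) (C′ , q) =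
    C + C′ , λ i → ≤-trans (∣p+q∣≤∣p∣+∣q∣ (f i) (g i)) (+-mono-≤ (p i) (q i))

  bounded-neg : ∀ {f : I → ℚ} → Bounded f → Bounded (λ i → - f i)
  bounded-neg {f} (C , p) = C , λ i → subst (_≤ C) (sym (∣-p∣≡∣p∣ (f i))) (p i)

  bounded-- : ∀ {f g : I → ℚ} → Bounded f → Bounded g → Bounded (λ i → f i - g i)
  bounded-- p q = bounded-+ p (bounded-neg q)

  bounded-* : ∀ {f g : I → ℚ} → Bounded f → Bounded g → Bounded (λ i → f i * g i)
  bounded-* {f} {g} (C , p) (C′ , q) = C * C′ , λ i → begin
    ∣ f i * g i ∣      ≡⟨ ∣p*q∣≡∣p∣*∣q∣ (f i) (g i) ⟩
    ∣ f i ∣ * ∣ g i ∣  ≤⟨ *-mono-≤ˡ ∣ f i ∣ (0≤∣p∣ (f i)) (q i) ⟩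
    ∣ f i ∣ * C′       ≤⟨ *-mono-≤ʳ C′ (≤-trans (0≤∣p∣ (g i)) (q i)) (p i) ⟩
    C * C′             ∎
    where open ≤-Reasoning

  bounded-≡ : ∀ {f g : I → ℚ} → Bounded g → (∀ i → f i ≡ g i) → Bounded f
  bounded-≡ (C , p) f≗g = C , λ i → subst (λ x → ∣ x ∣ ≤ C) (sym (f≗g i)) (p i)

  bounded-≤ : ∀ {f g : I → ℚ} → Bounded g → (∀ i → ∣ f i ∣ ≤ g i) → Bounded f
  bounded-≤ {g = g} (C , p) f≤g = C , λ i → ≤-trans (f≤g i) (≤-trans (p≤∣p∣ (g i)) (p i))
    where
    p≤∣p∣ : ∀ p → p ≤ ∣ p ∣
    p≤∣p∣ p with ≤-total 0ℚ p
    ... | inj₁ 0≤p = ≤-reflexive (sym (0≤p⇒∣p∣≡p 0≤p))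
    ... | inj₂ p≤0 = ≤-trans p≤0 (0≤∣p∣ p)

  bounded-between : ∀ {f : I → ℚ} C → (∀ i → 0ℚ ≤ f i) → (∀ i → f i ≤ C) → Bounded f
  bounded-between {f} C 0≤f f≤C = C , λ i → subst (_≤ C) (sym (0≤p⇒∣p∣≡p (0≤f i))) (f≤C i)

bounded-∘ : ∀ {I J : Set} {f : J → ℚ} (φ : I → J) → Bounded f → Bounded (f ∘ φ)
bounded-∘ φ (C , p) = C , λ i → p (φ i)

-- Covariance

module _ {A : Set} (Ω : List A) where

  sumℚ-+ : ∀ X Y → sumℚ Ω (λ ω → X ω + Y ω) ≡ sumℚ Ω X + sumℚ Ω Y
  sumℚ-+ X Y = go Ω
    where
    go : ∀ Ω → sumℚ Ω (λ ω → X ω + Y ω) ≡ sumℚ Ω X + sumℚ Ω Y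
    go []      = refl
    go (ω ∷ Ω) = trans (cong (X ω + Y ω +_) (go Ω)) (interchange (X ω) (Y ω) (sumℚ Ω X) (sumℚ Ω Y))

  module _ (i : ℚ) (i*Ω : i * sumℚ Ω (λ _ → 1ℚ) ≡ 1ℚ) where

    -- The normalising factor becomes any rational inverse to the size of `Ω`, because sizes are
    -- later obtained as operator totals and never as lengths of lists.
    𝔼-sumℚ : ∀ X → 𝔼 Ω X ≡ i * sumℚ Ω X
    𝔼-sumℚ X = go Ω i*Ω
      where
      unique : ∀ x y n → x * n ≡ 1ℚ → y * n ≡ 1ℚ → x ≡ y
      unique x y n p q = begin
        x              ≡⟨ *-identityʳ x ⟨
        x * 1ℚ         ≡⟨ cong (x *_) q ⟨
        x * (y * n)    ≡⟨ swap x y n ⟩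
        y * (x * n)    ≡⟨ cong (y *_) p ⟩
        y * 1ℚ         ≡⟨ *-identityʳ y ⟩
        y              ∎
        where
        open ≡-Reasoning
        swap : ∀ x y n → x * (y * n) ≡ y * (x * n)
        swap = solve-∀ ℚ-ring
      length-sum : ∀ Ω → sumℚ Ω (λ _ → 1ℚ) ≡ ι (length Ω)
      length-sum []      = refl
      length-sum (_ ∷ Ω) = cong (1ℚ +_) (length-sum Ω)
      go : ∀ Ω → i * sumℚ Ω (λ _ → 1ℚ) ≡ 1ℚ → 𝔼 Ω X ≡ i * sumℚ Ω X
      go []      _ = sym (*-zeroʳ i)
      go (ω ∷ Ω) p = cong (_* sumℚ (ω ∷ Ω) X)
        (unique (ℤ.+ 1 / suc (length Ω)) i (ι (suc (length Ω))) (1/n*n (length Ω))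
                (trans (cong (i *_) (sym (length-sum (ω ∷ Ω)))) p))

    -- Covariance ignores a shift. It will be applied with μ = (n + 1)/2, the midpoint of the spot
    -- numbers.
    Cov-centred : ∀ (X Y X₀ Y₀ : A → ℚ) μ → (∀ ω → X ω ≡ X₀ ω + μ) → (∀ ω → Y ω ≡ Y₀ ω + μ) →
      Cov Ω X Y ≡ i * sumℚ Ω (λ ω → X₀ ω * Y₀ ω) - (i * sumℚ Ω X₀) * (i * sumℚ Ω Y₀)
    Cov-centred X Y X₀ Y₀ μ X≗ Y≗ = begin
      𝔼 Ω (λ ω → (X ω - 𝔼 Ω X) * (Y ω - 𝔼 Ω Y))
        ≡⟨ 𝔼-sumℚ _ ⟩
      i * sumℚ Ω (λ ω → (X ω - 𝔼 Ω X) * (Y ω - 𝔼 Ω Y))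
        ≡⟨ cong (i *_) (sumℚ-cong Ω (λ ω → trans (cong₂ _*_ (centre X X₀ X≗ ω) (centre Y Y₀ Y≗ ω))
             (expand (X₀ ω) (Y₀ ω) α β))) ⟩
      i * sumℚ Ω (λ ω → X₀ ω * Y₀ ω + ((- β) * X₀ ω + ((- α) * Y₀ ω + (α * β) * 1ℚ)))
        ≡⟨ cong (i *_)
             (trans (sumℚ-+ (λ ω → X₀ ω * Y₀ ω) (λ ω → (- β) * X₀ ω + ((- α) * Y₀ ω + (α * β) * 1ℚ)))
             (cong (Σ₂ +_)
               (trans (sumℚ-+ (λ ω → (- β) * X₀ ω) (λ ω → (- α) * Y₀ ω + (α * β) * 1ℚ))
               (cong₂ _+_ (sumℚ-* Ω (- β) X₀)
                 (trans (sumℚ-+ (λ ω → (- α) * Y₀ ω) (λ ω → (α * β) * 1ℚ))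
                 (cong₂ _+_ (sumℚ-* Ω (- α) Y₀) (sumℚ-* Ω (α * β) (λ _ → 1ℚ)))))))) ⟩
      i * (Σ₂ + ((- β) * sumℚ Ω X₀ + ((- α) * sumℚ Ω Y₀ + (α * β) * Σ₀)))
        ≡⟨ collect i Σ₂ (sumℚ Ω X₀) (sumℚ Ω Y₀) Σ₀ ⟩
      i * Σ₂ - (α * β + α * β) + (α * β) * (i * Σ₀)
        ≡⟨ cong (λ x → i * Σ₂ - (α * β + α * β) + (α * β) * x) i*Ω ⟩
      i * Σ₂ - (α * β + α * β) + (α * β) * 1ℚ
        ≡⟨ finish (i * Σ₂) (α * β) ⟩
      i * Σ₂ - α * β ∎
      where
      open ≡-Reasoning
      α β Σ₀ Σ₂ : ℚ
      α = i * sumℚ Ω X₀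
      β = i * sumℚ Ω Y₀
      Σ₀ = sumℚ Ω (λ _ → 1ℚ)
      Σ₂ = sumℚ Ω (λ ω → X₀ ω * Y₀ ω)
      expand : ∀ x y a b → (x - a) * (y - b) ≡ x * y + ((- b) * x + ((- a) * y + (a * b) * 1ℚ))
      expand = solve-∀ ℚ-ring
      collect : ∀ i s x y z → i * (s + ((- (i * y)) * x + ((- (i * x)) * y + ((i * x) * (i * y)) * z))) ≡
        i * s - ((i * x) * (i * y) + (i * x) * (i * y)) + ((i * x) * (i * y)) * (i * z)
      collect = solve-∀ ℚ-ring
      finish : ∀ s p → s - (p + p) + p * 1ℚ ≡ s - p
      finish = solve-∀ ℚ-ring
      mean : ∀ X X₀ → (∀ ω → X ω ≡ X₀ ω + μ) → 𝔼 Ω X ≡ i * sumℚ Ω X₀ + μ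
      mean X X₀ X≗ = begin
        𝔼 Ω X
          ≡⟨ 𝔼-sumℚ X ⟩
        i * sumℚ Ω X
          ≡⟨ cong (i *_) (sumℚ-cong Ω (λ ω → trans (X≗ ω) (cong (X₀ ω +_) (sym (*-identityʳ μ))))) ⟩
        i * sumℚ Ω (λ ω → X₀ ω + μ * 1ℚ)
          ≡⟨ cong (i *_) (trans (sumℚ-+ X₀ (λ _ → μ * 1ℚ)) (cong (sumℚ Ω X₀ +_) (sumℚ-* Ω μ (λ _ → 1ℚ)))) ⟩
        i * (sumℚ Ω X₀ + μ * Σ₀)
          ≡⟨ distrib i (sumℚ Ω X₀) μ Σ₀ ⟩
        i * sumℚ Ω X₀ + μ * (i * Σ₀)
          ≡⟨ cong (λ x → i * sumℚ Ω X₀ + μ * x) i*Ω ⟩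
        i * sumℚ Ω X₀ + μ * 1ℚ
          ≡⟨ cong (i * sumℚ Ω X₀ +_) (*-identityʳ μ) ⟩
        i * sumℚ Ω X₀ + μ ∎
        where
        distrib : ∀ i x m z → i * (x + m * z) ≡ i * x + m * (i * z)
        distrib = solve-∀ ℚ-ring
      centre : ∀ X X₀ → (∀ ω → X ω ≡ X₀ ω + μ) → ∀ ω → X ω - 𝔼 Ω X ≡ X₀ ω - i * sumℚ Ω X₀
      centre X X₀ X≗ ω = trans (cong₂ _-_ (X≗ ω) (mean X X₀ X≗)) (cancel (X₀ ω) μ (i * sumℚ Ω X₀))
        where
        cancel : ∀ x m a → x + m - (a + m) ≡ x - a
        cancel = solve-∀ ℚ-ring

-- Centred preferences

¼ ⅓ 1/12 2ℚ : ℚ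
¼ = ℤ.+ 1 / 4
⅓ = ℤ.+ 1 / 3
1/12 = ℤ.+ 1 / 12
2ℚ = 1ℚ + 1ℚ

sumBefore-∷ʳ : ∀ g j → sumBefore g (suc j) ≡ sumBefore g j + g j
sumBefore-∷ʳ g zero    = +-comm (g 0) 0ℚ
sumBefore-∷ʳ g (suc j) = trans (cong (g 0 +_) (sumBefore-∷ʳ (g ∘ suc) j))
                               (sym (+-assoc (g 0) (sumBefore (g ∘ suc) j) (g (suc j))))

sumBefore-telescope : ∀ g (P : ℚ → ℚ) → P 0ℚ ≡ 0ℚ → (∀ j → P (1ℚ + ι j) ≡ P (ι j) + g j) →
  ∀ j → sumBefore g j ≡ P (ι j)
sumBefore-telescope g P P0 ΔP zero    = sym P0
sumBefore-telescope g P P0 ΔP (suc j) = trans (sumBefore-∷ʳ g j)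
  (trans (cong (_+ g j) (sumBefore-telescope g P P0 ΔP j)) (sym (ΔP j)))

-- Preferences p ∈ {0,…,n-1} measured from their midpoint, where h = n.

centred : ℚ → ℕ → ℚ
centred h p = ι p - ½ * (h - 1ℚ)

-- Power sums of the centred preferences below `x`. The first vanishes at x = h, so at h - l it
-- equals -l (h - l)/2, of order h rather than h^2; this is the gain from centring.
Σcentred Σcentred² : ℚ → ℚ → ℚ
Σcentred h x = ½ * (x * (x - h))
Σcentred² h x =
  ⅓ * (½ * (x * ((x - 1ℚ) * (x + x - 1ℚ)))) - m * (x * (x - 1ℚ)) + m * m * x
  where
  m : ℚ
  m = ½ * (h - 1ℚ)

sumBefore-centred : ∀ h j → sumBefore (centred h) j ≡ Σcentred h (ι j)
sumBefore-centred h = sumBefore-telescope (centred h) (Σcentred h) (P0 h) (λ j → ΔP h (ι j))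
  where
  P0 : ∀ h → ½ * (0ℚ * (0ℚ - h)) ≡ 0ℚ
  P0 = solve-∀ ℚ-ring
  ΔP : ∀ h x → ½ * ((1ℚ + x) * ((1ℚ + x) - h)) ≡ ½ * (x * (x - h)) + (x - ½ * (h - 1ℚ))
  ΔP = solve-∀ ℚ-ring

sumBefore-centred² : ∀ h j → sumBefore (λ p → centred h p * centred h p) j ≡ Σcentred² h (ι j)
sumBefore-centred² h =
  sumBefore-telescope (λ p → centred h p * centred h p) (Σcentred² h) (P0 h) (λ j → ΔP h (ι j))
  where
  P0 : ∀ h → Σcentred² h 0ℚ ≡ 0ℚ
  P0 = lemma
    where
    lemma : ∀ h → ⅓ * (½ * (0ℚ * ((0ℚ - 1ℚ) * (0ℚ + 0ℚ - 1ℚ)))) - ½ * (h - 1ℚ) * (0ℚ * (0ℚ - 1ℚ))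
                  + ½ * (h - 1ℚ) * (½ * (h - 1ℚ)) * 0ℚ ≡ 0ℚ
    lemma = solve-∀ ℚ-ring
  ΔP : ∀ h x → ⅓ * (½ * ((1ℚ + x) * (((1ℚ + x) - 1ℚ) * ((1ℚ + x) + (1ℚ + x) - 1ℚ))))
                 - ½ * (h - 1ℚ) * ((1ℚ + x) * ((1ℚ + x) - 1ℚ)) + ½ * (h - 1ℚ) * (½ * (h - 1ℚ)) * (1ℚ + x) ≡
               ⅓ * (½ * (x * ((x - 1ℚ) * (x + x - 1ℚ)))) - ½ * (h - 1ℚ) * (x * (x - 1ℚ))
                 + ½ * (h - 1ℚ) * (½ * (h - 1ℚ)) * x + (x - ½ * (h - 1ℚ)) * (x - ½ * (h - 1ℚ))
  ΔP = solve-∀ ℚ-ring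

-- k cars on suc (k + e) spots, hence suc (suc e) runs of occupied spots

runs : ℕ → ℚ
runs e = ι (suc (suc e))

runs-pos : ∀ e → 0ℚ < runs e
runs-pos e = ι-pos (suc e)

spots weight weight⁻¹ meanRun : ℕ → ℕ → ℚ
spots k e = ι (suc (k ℕ.+ e))
weight k e = v (suc e) k
weight⁻¹ k e = inv (weight k e) (v-pos (suc e) k)
meanRun k e = ι k * inv (runs e) (runs-pos e)

runMoment : ℕ → ℕ → ℕ → ℚ
runMoment r k e = weight⁻¹ k e * (v e ⊛ moment r) k

spots-split : ∀ k e → spots k e ≡ 1ℚ + (ι k + ι e)
spots-split k e = cong (1ℚ +_) (ι-+ k e)

weight-weight⁻¹ : ∀ k e x → weight k e * (weight⁻¹ k e * x) ≡ x
weight-weight⁻¹ k e x = begin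
  weight k e * (weight⁻¹ k e * x)   ≡⟨ lemma (weight k e) (weight⁻¹ k e) x ⟩
  weight⁻¹ k e * weight k e * x     ≡⟨ cong (_* x) (inv-* (weight k e) (v-pos (suc e) k)) ⟩
  1ℚ * x                            ≡⟨ *-identityˡ x ⟩
  x                                 ∎
  where
  open ≡-Reasoning
  lemma : ∀ a b x → a * (b * x) ≡ b * a * x
  lemma = solve-∀ ℚ-ring

runs*meanRun : ∀ k e → runs e * meanRun k e ≡ ι k
runs*meanRun k e = begin
  runs e * (ι k * inv (runs e) (runs-pos e))   ≡⟨ lemma (runs e) (ι k) (inv (runs e) (runs-pos e)) ⟩
  ι k * (inv (runs e) (runs-pos e) * runs e)   ≡⟨ cong (ι k *_) (inv-* (runs e) (runs-pos e)) ⟩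
  ι k * 1ℚ                                     ≡⟨ *-identityʳ (ι k) ⟩
  ι k                                          ∎
  where
  open ≡-Reasoning
  lemma : ∀ a b c → a * (b * c) ≡ b * (c * a)
  lemma = solve-∀ ℚ-ring

v⊛θb : ∀ k e → (v e ⊛ θ b) k ≡ weight k e * meanRun k e
v⊛θb k e = *-cancelˡ-≡ (runs e) (runs-pos e) (begin
  runs e * (v e ⊛ θ b) k                  ≡⟨ mean-run e k ⟩
  ι k * weight k e                        ≡⟨ cong (_* weight k e) (runs*meanRun k e) ⟨
  runs e * meanRun k e * weight k e       ≡⟨ lemma (runs e) (meanRun k e) (weight k e) ⟩
  runs e * (weight k e * meanRun k e)     ∎)
  where
  open ≡-Reasoning
  lemma : ∀ a b c → a * b * c ≡ a * (c * b)
  lemma = solve-∀ ℚ-ring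

cubic : ℚ → ℚ → ℚ → ℚ → ℚ → ℚ
cubic c₀ c₁ c₂ c₃ x = c₀ + c₁ * x + c₂ * (x * x) + c₃ * (x * x * x)

-- Degree 3 is enough for one further car, since the partial sums of squared preferences are cubic.
-- The linear coefficient meets the exact mean; the moments of order 2 and 3 stay symbolic and are
-- only bounded later.
shuffle-cubic : ∀ c₀ c₁ c₂ c₃ k e →
  shuffle (λ i l → cubic c₀ c₁ c₂ c₃ (ι l) * (v e i * b l)) k ≡
  weight k e * (c₀ + c₁ * meanRun k e + c₂ * runMoment 2 k e + c₃ * runMoment 3 k e)
shuffle-cubic c₀ c₁ c₂ c₃ k e = begin
  shuffle (λ i l → cubic c₀ c₁ c₂ c₃ (ι l) * (v e i * b l)) k
    ≡⟨ shuffle-cong k (λ i l _ → expand c₀ c₁ c₂ c₃ (ι l) (v e i) (b l)) ⟩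
  shuffle (λ i l → 1ℚ * (c₀ * (v e i * b l) + c₁ * (v e i * θ b l)) +
                   1ℚ * (c₂ * (v e i * moment 2 l) + c₃ * (v e i * moment 3 l))) k
    ≡⟨ shuffle-linear k 1ℚ 1ℚ (λ i l → c₀ * (v e i * b l) + c₁ * (v e i * θ b l))
                              (λ i l → c₂ * (v e i * moment 2 l) + c₃ * (v e i * moment 3 l)) ⟩
  1ℚ * shuffle (λ i l → c₀ * (v e i * b l) + c₁ * (v e i * θ b l)) k +
  1ℚ * shuffle (λ i l → c₂ * (v e i * moment 2 l) + c₃ * (v e i * moment 3 l)) k
    ≡⟨ cong₂ (λ x y → 1ℚ * x + 1ℚ * y)
         (shuffle-linear k c₀ c₁ (λ i l → v e i * b l) (λ i l → v e i * θ b l))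
         (shuffle-linear k c₂ c₃ (λ i l → v e i * moment 2 l) (λ i l → v e i * moment 3 l)) ⟩
  1ℚ * (c₀ * (v e ⊛ b) k + c₁ * (v e ⊛ θ b) k) + 1ℚ * (c₂ * (v e ⊛ moment 2) k + c₃ * (v e ⊛ moment 3) k)
    ≡⟨ cong₂ (λ x y → 1ℚ * x + 1ℚ * y)
         (cong₂ (λ x y → c₀ * x + c₁ * y) (sym (v-convolution e k)) (v⊛θb k e))
         (cong₂ (λ x y → c₂ * x + c₃ * y) (sym (weight-weight⁻¹ k e _)) (sym (weight-weight⁻¹ k e _))) ⟩
  1ℚ * (c₀ * W + c₁ * (W * meanRun k e)) + 1ℚ * (c₂ * (W * runMoment 2 k e) + c₃ * (W * runMoment 3 k e))
    ≡⟨ collect c₀ c₁ c₂ c₃ W (meanRun k e) (runMoment 2 k e) (runMoment 3 k e) ⟩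
  W * (c₀ + c₁ * meanRun k e + c₂ * runMoment 2 k e + c₃ * runMoment 3 k e) ∎
  where
  open ≡-Reasoning
  W : ℚ
  W = weight k e
  expand : ∀ c₀ c₁ c₂ c₃ x v b → (c₀ + c₁ * x + c₂ * (x * x) + c₃ * (x * x * x)) * (v * b) ≡
    1ℚ * (c₀ * (v * b) + c₁ * (v * (x * b))) + 1ℚ * (c₂ * (v * (x * (x * 1ℚ) * b)) + c₃ * (v * (x * (x * (x * 1ℚ)) * b)))
  expand = solve-∀ ℚ-ring
  collect : ∀ c₀ c₁ c₂ c₃ w a p q → 1ℚ * (c₀ * w + c₁ * (w * a)) + 1ℚ * (c₂ * (w * p) + c₃ * (w * q)) ≡
    w * (c₀ + c₁ * a + c₂ * p + c₃ * q)
  collect = solve-∀ ℚ-ring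

total-park-cubic : ∀ k e g (P : ℚ → ℚ) c₀ c₁ c₂ c₃ →
  (∀ j → sumBefore g j ≡ P (ι j)) → (∀ x → P (spots k e - x) ≡ cubic c₀ c₁ c₂ c₃ x) →
  total {suc (k ℕ.+ e)} k (park g all) ≡
  weight k e * (c₀ + c₁ * meanRun k e + c₂ * runMoment 2 k e + c₃ * runMoment 3 k e)
total-park-cubic k e g P c₀ c₁ c₂ c₃ g≗P P≗ = begin
  total {suc (k ℕ.+ e)} k (park g all)
    ≡⟨ total-cong {suc (k ℕ.+ e)} k (park-cong g (λ S → sym (free-1 S))) ⟩
  total {suc (k ℕ.+ e)} k (park g (free 1ℚ))
    ≡⟨ total-park (suc (k ℕ.+ e)) k e g refl ⟩
  shuffle (λ i l → sumBefore g (suc (i ℕ.+ e)) * (v e i * b l)) k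
    ≡⟨ shuffle-cong k (λ i l i+l≡k → cong (_* (v e i * b l))
         (trans (g≗P (suc (i ℕ.+ e))) (trans (cong P (free-spots i l i+l≡k)) (P≗ (ι l))))) ⟩
  shuffle (λ i l → cubic c₀ c₁ c₂ c₃ (ι l) * (v e i * b l)) k
    ≡⟨ shuffle-cubic c₀ c₁ c₂ c₃ k e ⟩
  weight k e * (c₀ + c₁ * meanRun k e + c₂ * runMoment 2 k e + c₃ * runMoment 3 k e) ∎
  where
  open ≡-Reasoning
  lemma : ∀ i l e → 1ℚ + (i + e) ≡ 1ℚ + ((i + l) + e) - l
  lemma = solve-∀ ℚ-ring
  free-spots : ∀ i l → i ℕ.+ l ≡ k → ι (suc (i ℕ.+ e)) ≡ spots k e - ι l
  free-spots i l refl = trans (spots-split i e) (trans (lemma (ι i) (ι l) (ι e))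
    (cong (_- ι l) (sym (trans (spots-split (i ℕ.+ l) e) (cong (λ x → 1ℚ + (x + ι e)) (ι-+ i l))))))

-- The mean number of preferences with which one more car can park; pairPreferences
-- is its analogue for two more cars.

preferences : ℕ → ℕ → ℚ
preferences k e = spots k e - meanRun k e

total-park-one : ∀ k e → total {suc (k ℕ.+ e)} k (park one all) ≡ weight k e * preferences k e
total-park-one k e = trans
  (total-park-cubic k e one (λ x → x) (spots k e) (- 1ℚ) 0ℚ 0ℚ sumBefore-one (λ x → expand (spots k e) x))
  (cong (weight k e *_) (collect (spots k e) (meanRun k e) (runMoment 2 k e) (runMoment 3 k e)))
  where
  expand : ∀ h x → h - x ≡ h + (- 1ℚ) * x + 0ℚ * (x * x) + 0ℚ * (x * x * x)
  expand = solve-∀ ℚ-ring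
  collect : ∀ h a p q → h + (- 1ℚ) * a + 0ℚ * p + 0ℚ * q ≡ h - a
  collect = solve-∀ ℚ-ring

total-park-centred : ∀ k e → let h = spots k e in
  total {suc (k ℕ.+ e)} k (park (centred h) all) ≡
  weight k e * (½ * (runMoment 2 k e - h * meanRun k e))
total-park-centred k e = trans
  (total-park-cubic k e (centred (spots k e)) (Σcentred (spots k e)) 0ℚ (- (½ * spots k e)) ½ 0ℚ
    (sumBefore-centred (spots k e)) (λ x → expand (spots k e) x))
  (cong (weight k e *_) (collect (spots k e) (meanRun k e) (runMoment 2 k e) (runMoment 3 k e)))
  where
  expand : ∀ h x → ½ * ((h - x) * ((h - x) - h)) ≡ 0ℚ + (- (½ * h)) * x + ½ * (x * x) + 0ℚ * (x * x * x)
  expand = solve-∀ ℚ-ring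
  collect : ∀ h a p q → 0ℚ + (- (½ * h)) * a + ½ * p + 0ℚ * q ≡ ½ * (p - h * a)
  collect = solve-∀ ℚ-ring

-- The coefficients are those of `Σcentred² h (h - x)` in powers of `x`. The constant one, (h^3 -
-- h)/12, is the sum over the whole street and, divided by about h, the source of n^2/12.
total-park-centred² : ∀ k e → let h = spots k e in
  total {suc (k ℕ.+ e)} k (park (λ p → centred h p * centred h p) all) ≡
  weight k e * (1/12 * (h * h * h - h) + (1/12 - ¼ * (h * h)) * meanRun k e
                + ½ * h * runMoment 2 k e + (- ⅓) * runMoment 3 k e)
total-park-centred² k e =
  total-park-cubic k e (λ p → centred h p * centred h p) (Σcentred² h)
    (1/12 * (h * h * h - h)) (1/12 - ¼ * (h * h)) (½ * h) (- ⅓)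
    (sumBefore-centred² h) (λ x → expand h x)
  where
  h : ℚ
  h = spots k e
  expand : ∀ h x →
    ⅓ * (½ * ((h - x) * ((h - x - 1ℚ) * (h - x + (h - x) - 1ℚ)))) - ½ * (h - 1ℚ) * ((h - x) * (h - x - 1ℚ))
      + ½ * (h - 1ℚ) * (½ * (h - 1ℚ)) * (h - x) ≡
    1/12 * (h * h * h - h) + (1/12 - ¼ * (h * h)) * x + ½ * h * (x * x) + (- ⅓) * (x * x * x)
  expand = solve-∀ ℚ-ring

-- Two further cars

shuffle₃-comm : ∀ k (Ψ : ℕ → ℕ → ℕ → ℚ) → shuffle₃ Ψ k ≡ shuffle₃ (λ i j l → Ψ i l j) k
shuffle₃-comm k Ψ = trans (sym (shuffle-assoc k Ψ))
  (trans (shuffle-cong k (λ i s _ → shuffle-comm s (Ψ i))) (shuffle-assoc k (λ i j l → Ψ i l j)))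

shuffle₃-linear : ∀ k a c (Ψ Φ : ℕ → ℕ → ℕ → ℚ) →
  shuffle₃ (λ i j l → a * Ψ i j l + c * Φ i j l) k ≡ a * shuffle₃ Ψ k + c * shuffle₃ Φ k
shuffle₃-linear k a c Ψ Φ = trans
  (shuffle-cong k (λ t l _ → shuffle-linear t a c (λ i j → Ψ i j l) (λ i j → Φ i j l)))
  (shuffle-linear k a c (λ t l → shuffle (λ i j → Ψ i j l) t) (λ t l → shuffle (λ i j → Φ i j l) t))

shuffle-∣∣ : ∀ k {Ψ Φ : ℕ → ℕ → ℚ} → (∀ i l → ∣ Ψ i l ∣ ≤ Φ i l) → ∣ shuffle Ψ k ∣ ≤ shuffle Φ k
shuffle-∣∣ zero    Ψ≤Φ = Ψ≤Φ 0 0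
shuffle-∣∣ (suc k) {Ψ} {Φ} Ψ≤Φ = ≤-trans
  (∣p+q∣≤∣p∣+∣q∣ (shuffle (λ i l → Ψ (suc i) l) k) (shuffle (λ i l → Ψ i (suc l)) k))
  (+-mono-≤ (shuffle-∣∣ k (λ i l → Ψ≤Φ (suc i) l)) (shuffle-∣∣ k (λ i l → Ψ≤Φ i (suc l))))

shuffle₃-∣∣ : ∀ k {Ψ Φ : ℕ → ℕ → ℕ → ℚ} → (∀ i j l → ∣ Ψ i j l ∣ ≤ Φ i j l) →
  ∣ shuffle₃ Ψ k ∣ ≤ shuffle₃ Φ k
shuffle₃-∣∣ k Ψ≤Φ = shuffle-∣∣ k (λ t l → shuffle-∣∣ t (λ i j → Ψ≤Φ i j l))

-- k cars on suc (suc (k + e)) spots.  In pairSum the function f is applied to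
-- the lengths of the last but one and of the last run.

pairSum : ℕ → ℕ → (ℚ → ℚ → ℚ) → ℚ
pairSum k e f = shuffle₃ (λ i j l → f (ι j) (ι l) * (v e i * b j * b l)) k

pairSum-linear : ∀ k e a c f g →
  pairSum k e (λ x y → a * f x y + c * g x y) ≡ a * pairSum k e f + c * pairSum k e g
pairSum-linear k e a c f g = trans
  (shuffle₃-cong k (λ i j l _ → distrib a c (f (ι j) (ι l)) (g (ι j) (ι l)) (v e i * b j * b l)))
  (shuffle₃-linear k a c (λ i j l → f (ι j) (ι l) * (v e i * b j * b l)) (λ i j l → g (ι j) (ι l) * (v e i * b j * b l)))
  where
  distrib : ∀ a c x y w → (a * x + c * y) * w ≡ a * (x * w) + c * (y * w)
  distrib = solve-∀ ℚ-ring

-- Exchangeability of the last two runs: the weight contains the same factor `b` for each.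
pairSum-comm : ∀ k e f → pairSum k e f ≡ pairSum k e (λ x y → f y x)
pairSum-comm k e f = trans (shuffle₃-comm k (λ i j l → f (ι j) (ι l) * (v e i * b j * b l)))
  (shuffle₃-cong k (λ i j l _ → cong (f (ι l) (ι j) *_) (swap (v e i) (b l) (b j))))
  where
  swap : ∀ x y z → x * y * z ≡ x * z * y
  swap = solve-∀ ℚ-ring

-- Summing out the last but one run convolves `v e` with `b`, so the last run is distributed as for
-- one gap more.
pairSum-last : ∀ k e (f : ℚ → ℚ) →
  pairSum k e (λ _ y → f y) ≡ shuffle (λ i l → f (ι l) * (v (suc e) i * b l)) k
pairSum-last k e f = shuffle-cong k (λ t l _ → begin
  shuffle (λ i j → f (ι l) * (v e i * b j * b l)) t
    ≡⟨ shuffle-cong t (λ i j _ → regroup (f (ι l)) (v e i) (b j) (b l)) ⟩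
  shuffle (λ i j → (f (ι l) * b l) * (v e i * b j)) t
    ≡⟨ shuffle-* t (f (ι l) * b l) (λ i j → v e i * b j) ⟩
  (f (ι l) * b l) * shuffle (λ i j → v e i * b j) t
    ≡⟨ cong ((f (ι l) * b l) *_) (v-convolution e t) ⟨
  (f (ι l) * b l) * v (suc e) t
    ≡⟨ rotate (f (ι l)) (b l) (v (suc e) t) ⟩
  f (ι l) * (v (suc e) t * b l) ∎)
  where
  open ≡-Reasoning
  regroup : ∀ f x y z → f * (x * y * z) ≡ (f * z) * (x * y)
  regroup = solve-∀ ℚ-ring
  rotate : ∀ f z x → (f * z) * x ≡ f * (x * z)
  rotate = solve-∀ ℚ-ring

pairSum-cong : ∀ k e {f g : ℚ → ℚ → ℚ} → (∀ x y → f x y ≡ g x y) → pairSum k e f ≡ pairSum k e g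
pairSum-cong k e f≗g = shuffle₃-cong k (λ i j l _ → cong (_* (v e i * b j * b l)) (f≗g (ι j) (ι l)))

-- By exchangeability of the two runs the squares cancel.

pairSum-difference : ∀ k e →
  pairSum k e (λ x y → y * y - (1ℚ + x) * (1ℚ + x)) ≡
  weight k (suc e) * (- (2ℚ * meanRun k (suc e) + 1ℚ))
pairSum-difference k e = begin
  pairSum k e (λ x y → y * y - (1ℚ + x) * (1ℚ + x))
    ≡⟨ pairSum-cong k e split ⟩
  pairSum k e (λ x y → 1ℚ * f y + 1ℚ * g x)
    ≡⟨ pairSum-linear k e 1ℚ 1ℚ (λ _ y → f y) (λ x _ → g x) ⟩
  1ℚ * pairSum k e (λ _ y → f y) + 1ℚ * pairSum k e (λ x _ → g x)
    ≡⟨ cong₂ (λ p q → 1ℚ * p + 1ℚ * q) (pairSum-last k e f)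
         (trans (pairSum-comm k e (λ x _ → g x)) (pairSum-last k e g)) ⟩
  1ℚ * shuffle (λ i l → f (ι l) * (v (suc e) i * b l)) k + 1ℚ * shuffle (λ i l → g (ι l) * (v (suc e) i * b l)) k
    ≡⟨ cong₂ (λ p q → 1ℚ * p + 1ℚ * q) (shuffle-cubic 0ℚ 0ℚ 1ℚ 0ℚ k (suc e))
         (shuffle-cubic (- 1ℚ) (- 2ℚ) (- 1ℚ) 0ℚ k (suc e)) ⟩
  1ℚ * (w * (0ℚ + 0ℚ * a + 1ℚ * s₂ + 0ℚ * s₃)) + 1ℚ * (w * (- 1ℚ + (- 2ℚ) * a + (- 1ℚ) * s₂ + 0ℚ * s₃))
    ≡⟨ collect w a s₂ s₃ ⟩
  w * (- (2ℚ * a + 1ℚ)) ∎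
  where
  open ≡-Reasoning
  w a s₂ s₃ : ℚ
  w = weight k (suc e)
  a = meanRun k (suc e)
  s₂ = runMoment 2 k (suc e)
  s₃ = runMoment 3 k (suc e)
  f g : ℚ → ℚ
  f = cubic 0ℚ 0ℚ 1ℚ 0ℚ
  g = cubic (- 1ℚ) (- 2ℚ) (- 1ℚ) 0ℚ
  split : ∀ x y → y * y - (1ℚ + x) * (1ℚ + x) ≡
    1ℚ * (0ℚ + 0ℚ * y + 1ℚ * (y * y) + 0ℚ * (y * y * y)) +
    1ℚ * (- 1ℚ + (- 2ℚ) * x + (- 1ℚ) * (x * x) + 0ℚ * (x * x * x))
  split = solve-∀ ℚ-ring
  collect : ∀ w a p q → 1ℚ * (w * (0ℚ + 0ℚ * a + 1ℚ * p + 0ℚ * q)) + 1ℚ * (w * (- 1ℚ + (- 2ℚ) * a + (- 1ℚ) * p + 0ℚ * q)) ≡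
    w * (- (2ℚ * a + 1ℚ))
  collect = solve-∀ ℚ-ring

-- A majorant of (x + y + 1)^4 without mixed terms, so that fourth moments of a single run control
-- it. The constants come from (a + b)^4 ≤ 8 a^4 + 8 b^4, applied first to x + 1 and y, then to x
-- and 1.
quartic : ℚ → ℚ → ℚ
quartic x y = ι 64 * (1ℚ + x * x * (x * x)) + ι 8 * (y * y * (y * y))

pairSum-quartic : ∀ k e →
  pairSum k e quartic ≡
  weight k (suc e) * (ι 64 + ι 72 * runMoment 4 k (suc e))
pairSum-quartic k e = begin
  pairSum k e quartic
    ≡⟨ pairSum-linear k e (ι 64) (ι 8) (λ x _ → 1ℚ + x * x * (x * x)) (λ _ y → y * y * (y * y)) ⟩
  ι 64 * pairSum k e (λ x _ → 1ℚ + x * x * (x * x)) + ι 8 * pairSum k e (λ _ y → y * y * (y * y))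
    ≡⟨ cong (λ p → ι 64 * p + ι 8 * pairSum k e (λ _ y → y * y * (y * y)))
         (trans (pairSum-comm k e (λ x _ → 1ℚ + x * x * (x * x)))
         (trans (pairSum-cong k e (λ _ y → linear-+ 1ℚ (y * y * (y * y))))
            (pairSum-linear k e 1ℚ 1ℚ (λ _ _ → 1ℚ) (λ _ y → y * y * (y * y))))) ⟩
  ι 64 * (1ℚ * pairSum k e (λ _ _ → 1ℚ) + 1ℚ * pairSum k e (λ _ y → y * y * (y * y))) +
  ι 8 * pairSum k e (λ _ y → y * y * (y * y))
    ≡⟨ cong₂ (λ p q → ι 64 * (1ℚ * p + 1ℚ * q) + ι 8 * q) zeroth fourth ⟩
  ι 64 * (1ℚ * w + 1ℚ * (w * s₄)) + ι 8 * (w * s₄)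
    ≡⟨ collect w s₄ ⟩
  w * (ι 64 + ι 72 * s₄) ∎
  where
  open ≡-Reasoning
  w s₄ : ℚ
  w = weight k (suc e)
  s₄ = runMoment 4 k (suc e)
  zeroth : pairSum k e (λ _ _ → 1ℚ) ≡ w
  zeroth = trans (pairSum-last k e (λ _ → 1ℚ))
    (trans (shuffle-cong k (λ i l _ → *-identityˡ (v (suc e) i * b l))) (sym (v-convolution (suc e) k)))
  fourth : pairSum k e (λ _ y → y * y * (y * y)) ≡ w * s₄
  fourth = trans (pairSum-last k e (λ y → y * y * (y * y)))
    (trans (shuffle-cong k (λ i l _ → expand (ι l) (v (suc e) i) (b l))) (sym (weight-weight⁻¹ k (suc e) _)))
    where
    expand : ∀ x v b → x * x * (x * x) * (v * b) ≡ v * (x * (x * (x * (x * 1ℚ))) * b)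
    expand = solve-∀ ℚ-ring
  expand : ∀ w s x y → x * (1ℚ * w + 1ℚ * (w * s)) + y * (w * s) ≡ w * (x + (x + y) * s)
  expand = solve-∀ ℚ-ring
  -- The numerals enter the ring identity as variables; `ι 64 + ι 8` then computes to `ι 72`.
  collect : ∀ w s → ι 64 * (1ℚ * w + 1ℚ * (w * s)) + ι 8 * (w * s) ≡ w * (ι 64 + ι 72 * s)
  collect w s = expand w s (ι 64) (ι 8)

-- The coefficients of h and 1 in 4 Σcentred h (h - M) (2 Σcentred h (h - y) - Σcentred h (h - M))
-- where M = x + y + 1.

pair₁ pair₀ : ℚ → ℚ → ℚ
pair₁ x y = let M = x + y + 1ℚ in 2ℚ * (M * M * M - M * y * y - M * M * y)
pair₀ x y = let M = x + y + 1ℚ in 2ℚ * (M * M * y * y) - M * M * M * M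

-- The power mean inequality, with the explicit difference (x - y)^2 (7 x^2 + 10 x y + 7 y^2).
fourth-power-≤ : ∀ {x y} → 0ℚ ≤ x → 0ℚ ≤ y →
  (x + y) * (x + y) * (x + y) * (x + y) ≤ ι 8 * (x * x * x * x) + ι 8 * (y * y * y * y)
fourth-power-≤ {x} {y} 0≤x 0≤y = subst ((x + y) * (x + y) * (x + y) * (x + y) ≤_) (lemma x y)
  (x≤x+y ((x + y) * (x + y) * (x + y) * (x + y)) (*-nonNeg (square-nonNeg (x - y))
    (+-nonNeg (+-nonNeg (*-nonNeg (ι-nonNeg 7) (*-nonNeg 0≤x 0≤x)) (*-nonNeg (ι-nonNeg 10) (*-nonNeg 0≤x 0≤y)))
              (*-nonNeg (ι-nonNeg 7) (*-nonNeg 0≤y 0≤y)))))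
  where
  lemma : ∀ x y → (x + y) * (x + y) * (x + y) * (x + y) +
    (x - y) * (x - y) * (ι 7 * (x * x) + ι 10 * (x * y) + ι 7 * (y * y)) ≡
    ι 8 * (x * x * x * x) + ι 8 * (y * y * y * y)
  lemma = solve-∀ ℚ-ring

module _ {x y : ℚ} (0≤x : 0ℚ ≤ x) (0≤y : 0ℚ ≤ y) where

  private
    M K : ℚ
    M = x + y + 1ℚ
    K = x + 1ℚ

    0≤K : 0ℚ ≤ K
    0≤K = +-nonNeg 0≤x 0≤1
    0≤M : 0ℚ ≤ M
    0≤M = +-nonNeg (+-nonNeg 0≤x 0≤y) 0≤1

    M⁴≤quartic : M * M * M * M ≤ quartic x y
    M⁴≤quartic = begin
      M * M * M * M
        ≡⟨ cong (λ m → m * m * m * m) (reorder x y) ⟩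
      (K + y) * (K + y) * (K + y) * (K + y)
        ≤⟨ fourth-power-≤ 0≤K 0≤y ⟩
      ι 8 * (K * K * K * K) + ι 8 * (y * y * y * y)
        ≤⟨ +-monoˡ-≤ (ι 8 * (y * y * y * y)) (*-mono-≤ˡ (ι 8) (ι-nonNeg 8) (fourth-power-≤ 0≤x 0≤1)) ⟩
      ι 8 * (ι 8 * (x * x * x * x) + ι 8 * (1ℚ * 1ℚ * 1ℚ * 1ℚ)) + ι 8 * (y * y * y * y)
        ≡⟨ expand x y ⟩
      quartic x y ∎
      where
      open ≤-Reasoning
      reorder : ∀ x y → x + y + 1ℚ ≡ x + 1ℚ + y
      reorder = solve-∀ ℚ-ring
      expand : ∀ x y → ι 8 * (ι 8 * (x * x * x * x) + ι 8 * (1ℚ * 1ℚ * 1ℚ * 1ℚ)) + ι 8 * (y * y * y * y) ≡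
        ι 64 * (1ℚ + x * x * (x * x)) + ι 8 * (y * y * (y * y))
      expand = solve-∀ ℚ-ring

    0≤M² : 0ℚ ≤ M * M
    0≤M² = *-nonNeg 0≤M 0≤M

    0≤2 : 0ℚ ≤ 2ℚ
    0≤2 = ι-nonNeg 2

  -- Since 0 ≤ y ≤ M, both M y^2 and M^2 y lie between 0 and M^3, whence the bound 2 M^3; and M ≥ 1
  -- allows M^4 in place of M^3. The distances to both bounds are written as sums of products of
  -- `M`, `y` and K = M - y.
  pair₁-bound : ∣ pair₁ x y ∣ ≤ 2ℚ * quartic x y
  pair₁-bound = ≤-trans
    (∣x∣≤ {y = 2ℚ * (M * M * M)}
      (subst (0ℚ ≤_) (upper M y) (*-nonNeg 0≤2 (+-nonNeg (*-nonNeg (*-nonNeg 0≤M 0≤y) 0≤y) (*-nonNeg 0≤M² 0≤y))))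
      (subst (0ℚ ≤_) (lower x y) (*-nonNeg 0≤2 (+-nonNeg (*-nonNeg (*-nonNeg 0≤M 0≤K) (+-nonNeg 0≤M 0≤y)) (*-nonNeg 0≤M² 0≤K)))))
    (*-mono-≤ˡ 2ℚ 0≤2 (≤-trans
      (subst (M * M * M ≤_) (raise x y) (x≤x+y (M * M * M) (*-nonNeg (*-nonNeg 0≤M² 0≤M) (+-nonNeg 0≤x 0≤y))))
      M⁴≤quartic))
    where
    upper : ∀ M y → 2ℚ * (M * y * y + M * M * y) ≡ 2ℚ * (M * M * M) - 2ℚ * (M * M * M - M * y * y - M * M * y)
    upper = solve-∀ ℚ-ring
    lower : ∀ x y → let M = x + y + 1ℚ ; K = x + 1ℚ in
      2ℚ * (M * K * (M + y) + M * M * K) ≡ 2ℚ * (M * M * M) + 2ℚ * (M * M * M - M * y * y - M * M * y)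
    lower = solve-∀ ℚ-ring
    raise : ∀ x y → let M = x + y + 1ℚ in M * M * M + M * M * M * (x + y) ≡ M * M * M * M
    raise = solve-∀ ℚ-ring

  pair₀-bound : ∣ pair₀ x y ∣ ≤ quartic x y
  pair₀-bound = ≤-trans
    (∣x∣≤ {y = M * M * M * M}
      (subst (0ℚ ≤_) (upper x y) (*-nonNeg 0≤2 (*-nonNeg (*-nonNeg 0≤M² 0≤K) (+-nonNeg 0≤M 0≤y))))
      (subst (0ℚ ≤_) (lower M y) (*-nonNeg 0≤2 (*-nonNeg (*-nonNeg 0≤M² 0≤y) 0≤y))))
    M⁴≤quartic
    where
    upper : ∀ x y → let M = x + y + 1ℚ ; K = x + 1ℚ in
      2ℚ * (M * M * K * (M + y)) ≡ M * M * M * M - (2ℚ * (M * M * y * y) - M * M * M * M)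
    upper = solve-∀ ℚ-ring
    lower : ∀ M y → 2ℚ * (M * M * y * y) ≡ M * M * M * M + (2ℚ * (M * M * y * y) - M * M * M * M)
    lower = solve-∀ ℚ-ring

pairMoment : (ℚ → ℚ → ℚ) → ℕ → ℕ → ℚ
pairMoment f k e = weight⁻¹ k (suc e) * pairSum k e f

pairMoment-bound : ∀ {f} C → 0ℚ ≤ C → (∀ {x y} → 0ℚ ≤ x → 0ℚ ≤ y → ∣ f x y ∣ ≤ C * quartic x y) →
  ∀ k e → ∣ pairMoment f k e ∣ ≤ C * (ι 64 + ι 72 * runMoment 4 k (suc e))
pairMoment-bound {f} C 0≤C f≤ k e = begin
  ∣ weight⁻¹ k (suc e) * pairSum k e f ∣
    ≡⟨ ∣p*q∣≡∣p∣*∣q∣ (weight⁻¹ k (suc e)) (pairSum k e f) ⟩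
  ∣ weight⁻¹ k (suc e) ∣ * ∣ pairSum k e f ∣
    ≡⟨ cong (_* ∣ pairSum k e f ∣) (0≤p⇒∣p∣≡p 0≤w⁻¹) ⟩
  weight⁻¹ k (suc e) * ∣ pairSum k e f ∣
    ≤⟨ *-mono-≤ˡ (weight⁻¹ k (suc e)) 0≤w⁻¹ (shuffle₃-∣∣ k pointwise) ⟩
  -- The zero summand only gives the integrand the shape that `pairSum-linear` expects.
  weight⁻¹ k (suc e) * pairSum k e (λ x y → C * quartic x y + 0ℚ * quartic x y)
    ≡⟨ cong (weight⁻¹ k (suc e) *_) (trans (pairSum-linear k e C 0ℚ quartic quartic)
         (cong (λ x → C * x + 0ℚ * x) (pairSum-quartic k e))) ⟩
  weight⁻¹ k (suc e) * (C * (w * X) + 0ℚ * (w * X))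
    ≡⟨ regroup (weight⁻¹ k (suc e)) C w X ⟩
  C * (w * (weight⁻¹ k (suc e) * X))
    ≡⟨ cong (C *_) (weight-weight⁻¹ k (suc e) X) ⟩
  C * X ∎
  where
  open ≤-Reasoning
  w X : ℚ
  w = weight k (suc e)
  X = ι 64 + ι 72 * runMoment 4 k (suc e)
  0≤w⁻¹ : 0ℚ ≤ weight⁻¹ k (suc e)
  0≤w⁻¹ = inv-nonNeg w (v-pos (suc (suc e)) k)
  regroup : ∀ i c w x → i * (c * (w * x) + 0ℚ * (w * x)) ≡ c * (w * (i * x))
  regroup = solve-∀ ℚ-ring
  pad : ∀ c q → c * q ≡ c * q + 0ℚ * q
  pad = solve-∀ ℚ-ring
  pointwise : ∀ i j l → ∣ f (ι j) (ι l) * (v e i * b j * b l) ∣ ≤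
    (C * quartic (ι j) (ι l) + 0ℚ * quartic (ι j) (ι l)) * (v e i * b j * b l)
  pointwise i j l = begin
    ∣ f (ι j) (ι l) * (v e i * b j * b l) ∣
      ≡⟨ ∣p*q∣≡∣p∣*∣q∣ (f (ι j) (ι l)) (v e i * b j * b l) ⟩
    ∣ f (ι j) (ι l) ∣ * ∣ v e i * b j * b l ∣
      ≡⟨ cong (∣ f (ι j) (ι l) ∣ *_) (0≤p⇒∣p∣≡p 0≤vbb) ⟩
    ∣ f (ι j) (ι l) ∣ * (v e i * b j * b l)
      ≤⟨ *-mono-≤ʳ (v e i * b j * b l) 0≤vbb (f≤ (ι-nonNeg j) (ι-nonNeg l)) ⟩
    C * quartic (ι j) (ι l) * (v e i * b j * b l)
      ≡⟨ cong (_* (v e i * b j * b l)) (pad C (quartic (ι j) (ι l))) ⟩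
    (C * quartic (ι j) (ι l) + 0ℚ * quartic (ι j) (ι l)) * (v e i * b j * b l) ∎
    where
    0≤vbb : 0ℚ ≤ v e i * b j * b l
    0≤vbb = *-nonNeg (*-nonNeg (<⇒≤ (v-pos e i)) (b-nonNeg j)) (b-nonNeg l)

-- Behind the last but one free spot lie x + y + 1 spots: both runs and the last free spot between
-- them. Behind the last free spot lie y.
total-pair : ∀ k e g (P : ℚ → ℚ) (f : ℚ → ℚ → ℚ) → (∀ j → sumBefore g j ≡ P (ι j)) →
  (∀ x y → let X = P (spots (suc k) e - (x + y + 1ℚ)) ; Y = P (spots (suc k) e - y) in
           X * (Y + (Y - X)) ≡ f x y) →
  total {suc (suc (k ℕ.+ e))} k (park g (park g all)) ≡ pairSum k e f
total-pair k e g P f g≗P P≗f = begin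
  total {n} k (park g (park g all))
    ≡⟨ total-cong {n} k (park-cong g (park-cong g (λ S → sym (free-1 S)))) ⟩
  total {n} k (park g (park g (free 1ℚ)))
    ≡⟨ total-park-park n k e g refl ⟩
  shuffle₃ (λ i j l → weigh₂ (sumBefore g (suc (i ℕ.+ e))) (sumBefore g (suc (i ℕ.+ j ℕ.+ suc e))) * (v e i * b j * b l)) k
    ≡⟨ shuffle₃-cong k (λ i j l i+j+l≡k → cong (_* (v e i * b j * b l))
         (trans (cong₂ weigh₂ (trans (g≗P (suc (i ℕ.+ e))) (cong P (size₂ i j l i+j+l≡k)))
                              (trans (g≗P (suc (i ℕ.+ j ℕ.+ suc e))) (cong P (size₁ i j l i+j+l≡k))))
                (P≗f (ι j) (ι l)))) ⟩
  pairSum k e f ∎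
  where
  open ≡-Reasoning
  n : ℕ
  n = suc (suc (k ℕ.+ e))
  weigh₂ : ℚ → ℚ → ℚ
  weigh₂ X Y = X * (Y + (Y - X))
  h≡ : ∀ i j l → i ℕ.+ j ℕ.+ l ≡ k → spots (suc k) e ≡ 1ℚ + (1ℚ + (ι i + ι j + ι l) + ι e)
  h≡ i j l refl = trans (spots-split (suc k) e)
    (cong (λ x → 1ℚ + (1ℚ + x + ι e)) (trans (ι-+ (i ℕ.+ j) l) (cong (_+ ι l) (ι-+ i j))))
  size₂ : ∀ i j l → i ℕ.+ j ℕ.+ l ≡ k → ι (suc (i ℕ.+ e)) ≡ spots (suc k) e - (ι j + ι l + 1ℚ)
  size₂ i j l p = trans (spots-split i e) (trans (lemma (ι i) (ι j) (ι l) (ι e))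
    (cong (_- (ι j + ι l + 1ℚ)) (sym (h≡ i j l p))))
    where
    lemma : ∀ i j l e → 1ℚ + (i + e) ≡ 1ℚ + (1ℚ + (i + j + l) + e) - (j + l + 1ℚ)
    lemma = solve-∀ ℚ-ring
  size₁ : ∀ i j l → i ℕ.+ j ℕ.+ l ≡ k → ι (suc (i ℕ.+ j ℕ.+ suc e)) ≡ spots (suc k) e - ι l
  size₁ i j l p = trans (spots-split (i ℕ.+ j) (suc e)) (trans (cong (λ x → 1ℚ + (x + ι (suc e))) (ι-+ i j))
    (trans (lemma (ι i) (ι j) (ι l) (ι e)) (cong (_- ι l) (sym (h≡ i j l p)))))
    where
    lemma : ∀ i j l e → 1ℚ + (i + j + (1ℚ + e)) ≡ 1ℚ + (1ℚ + (i + j + l) + e) - l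
    lemma = solve-∀ ℚ-ring

pairPreferences : ℕ → ℕ → ℚ
pairPreferences k e = let h = spots (suc k) e ; a = meanRun k (suc e) in h * h - 2ℚ * h * a - 2ℚ * a - 1ℚ

pairSum-quadratic : ∀ k e α f g →
  pairSum k e (λ x y → α * (y * y - (1ℚ + x) * (1ℚ + x)) + (f * pair₁ x y + g * pair₀ x y)) ≡
  weight k (suc e) * (α * (- (2ℚ * meanRun k (suc e) + 1ℚ)) + (f * pairMoment pair₁ k e + g * pairMoment pair₀ k e))
pairSum-quadratic k e α f g = begin
  pairSum k e (λ x y → α * (y * y - (1ℚ + x) * (1ℚ + x)) + (f * pair₁ x y + g * pair₀ x y))
    ≡⟨ pairSum-cong k e (λ x y → cong (α * (y * y - (1ℚ + x) * (1ℚ + x)) +_)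
                                     (sym (*-identityˡ (f * pair₁ x y + g * pair₀ x y)))) ⟩
  pairSum k e (λ x y → α * (y * y - (1ℚ + x) * (1ℚ + x)) + 1ℚ * (f * pair₁ x y + g * pair₀ x y))
    ≡⟨ pairSum-linear k e α 1ℚ (λ x y → y * y - (1ℚ + x) * (1ℚ + x)) (λ x y → f * pair₁ x y + g * pair₀ x y) ⟩
  α * pairSum k e (λ x y → y * y - (1ℚ + x) * (1ℚ + x)) + 1ℚ * pairSum k e (λ x y → f * pair₁ x y + g * pair₀ x y)
    ≡⟨ cong₂ (λ p q → α * p + 1ℚ * q) (pairSum-difference k e) (trans (pairSum-linear k e f g pair₁ pair₀)
         (cong₂ (λ p q → f * p + g * q) (sym (weight-weight⁻¹ k (suc e) (pairSum k e pair₁)))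
                                        (sym (weight-weight⁻¹ k (suc e) (pairSum k e pair₀))))) ⟩
  α * (w * (- (2ℚ * a + 1ℚ))) + 1ℚ * (f * (w * f₁) + g * (w * f₀))
    ≡⟨ collect α w (- (2ℚ * a + 1ℚ)) f g f₁ f₀ ⟩
  w * (α * (- (2ℚ * a + 1ℚ)) + (f * f₁ + g * f₀)) ∎
  where
  open ≡-Reasoning
  w a f₁ f₀ : ℚ
  w = weight k (suc e)
  a = meanRun k (suc e)
  f₁ = pairMoment pair₁ k e
  f₀ = pairMoment pair₀ k e
  collect : ∀ α w d f g x y → α * (w * d) + 1ℚ * (f * (w * x) + g * (w * y)) ≡ w * (α * d + (f * x + g * y))
  collect = solve-∀ ℚ-ring

-- Of the (h - y)^2 pairs of preferences up to the last free spot, the (1 + x)^2 lying entirely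
-- beyond the last but one fail. Exchangeability removes the squares, so the count depends on the
-- run lengths only through their mean.
total-pair-one : ∀ k e →
  total {suc (suc (k ℕ.+ e))} k (park one (park one all)) ≡ weight k (suc e) * pairPreferences k e
total-pair-one k e = begin
  total {suc (suc (k ℕ.+ e))} k (park one (park one all))
    ≡⟨ total-pair k e one (λ x → x) (λ x y → 1ℚ * (y * y - (1ℚ + x) * (1ℚ + x)) + 1ℚ * cubic (h * h) (- (2ℚ * h)) 0ℚ 0ℚ y)
         sumBefore-one (expand h) ⟩
  pairSum k e (λ x y → 1ℚ * (y * y - (1ℚ + x) * (1ℚ + x)) + 1ℚ * cubic (h * h) (- (2ℚ * h)) 0ℚ 0ℚ y)
    ≡⟨ pairSum-linear k e 1ℚ 1ℚ (λ x y → y * y - (1ℚ + x) * (1ℚ + x)) (λ _ y → cubic (h * h) (- (2ℚ * h)) 0ℚ 0ℚ y) ⟩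
  1ℚ * pairSum k e (λ x y → y * y - (1ℚ + x) * (1ℚ + x)) + 1ℚ * pairSum k e (λ _ y → cubic (h * h) (- (2ℚ * h)) 0ℚ 0ℚ y)
    ≡⟨ cong₂ (λ p q → 1ℚ * p + 1ℚ * q) (pairSum-difference k e)
         (trans (pairSum-last k e (cubic (h * h) (- (2ℚ * h)) 0ℚ 0ℚ)) (shuffle-cubic (h * h) (- (2ℚ * h)) 0ℚ 0ℚ k (suc e))) ⟩
  _ ≡⟨ collect (weight k (suc e)) h (meanRun k (suc e)) (runMoment 2 k (suc e)) (runMoment 3 k (suc e)) ⟩
  weight k (suc e) * pairPreferences k e ∎
  where
  open ≡-Reasoning
  h : ℚ
  h = spots (suc k) e
  expand : ∀ h x y → (h - (x + y + 1ℚ)) * ((h - y) + ((h - y) - (h - (x + y + 1ℚ)))) ≡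
    1ℚ * (y * y - (1ℚ + x) * (1ℚ + x)) + 1ℚ * (h * h + (- (2ℚ * h)) * y + 0ℚ * (y * y) + 0ℚ * (y * y * y))
  expand = solve-∀ ℚ-ring
  collect : ∀ w h a p q → 1ℚ * (w * (- (2ℚ * a + 1ℚ))) + 1ℚ * (w * (h * h + (- (2ℚ * h)) * a + 0ℚ * p + 0ℚ * q)) ≡
    w * (h * h - 2ℚ * h * a - 2ℚ * a - 1ℚ)
  collect = solve-∀ ℚ-ring

-- The number of admissible pairs is of order h^2, so only the coefficient of h^2 survives in the
-- limit, and there the squares cancel. `pair₁` and `pair₀` go with lower powers of h and need only
-- bounds.
total-pair-centred : ∀ k e → let h = spots (suc k) e in
  total {suc (suc (k ℕ.+ e))} k (park (centred h) (park (centred h) all)) ≡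
  weight k (suc e) * (¼ * (h * h) * (- (2ℚ * meanRun k (suc e) + 1ℚ))
    + (¼ * h * pairMoment pair₁ k e + ¼ * pairMoment pair₀ k e))
total-pair-centred k e = trans
  (total-pair k e (centred h) (Σcentred h)
    (λ x y → ¼ * (h * h) * (y * y - (1ℚ + x) * (1ℚ + x)) + (¼ * h * pair₁ x y + ¼ * pair₀ x y))
    (sumBefore-centred h) (expand h))
  (pairSum-quadratic k e (¼ * (h * h)) (¼ * h) ¼)
  where
  h : ℚ
  h = spots (suc k) e
  expand : ∀ h x y →
    let M = x + y + 1ℚ ; X = ½ * ((h - M) * (h - M - h)) ; Y = ½ * ((h - y) * (h - y - h)) in
    X * (Y + (Y - X)) ≡ ¼ * (h * h) * (y * y - (1ℚ + x) * (1ℚ + x))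
      + (¼ * h * (2ℚ * (M * M * M - M * y * y - M * M * y)) + ¼ * (2ℚ * (M * M * y * y) - M * M * M * M))
  expand = solve-∀ ℚ-ring

-- Normalisation and exact moment formulas

⅙ : ℚ
⅙ = ℤ.+ 1 / 6

1≤spots : ∀ k e → 1ℚ ≤ spots k e
1≤spots k e = x≤x+y 1ℚ (ι-nonNeg (k ℕ.+ e))

1≤preferences : ∀ k e → 1ℚ ≤ preferences k e
1≤preferences k e = *-cancelˡ-≤ (runs e) (runs-pos e) (begin
  runs e * 1ℚ
    ≤⟨ x≤x+y (runs e * 1ℚ) (+-nonNeg (ι-nonNeg k) (*-nonNeg (ι-nonNeg e) (+-nonNeg 0≤1 (ι-nonNeg (suc (k ℕ.+ e)))))) ⟩
  runs e * 1ℚ + (ι k + ι e * (1ℚ + spots k e))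
    ≡⟨ cong (λ h → runs e * 1ℚ + (ι k + ι e * (1ℚ + h))) (spots-split k e) ⟩
  runs e * 1ℚ + (ι k + ι e * (1ℚ + (1ℚ + (ι k + ι e))))
    ≡⟨ lemma (ι k) (ι e) ⟩
  runs e * (1ℚ + (ι k + ι e)) - ι k
    ≡⟨ cong₂ (λ h x → runs e * h - x) (sym (spots-split k e)) (sym (runs*meanRun k e)) ⟩
  runs e * spots k e - runs e * meanRun k e
    ≡⟨ factor (runs e) (spots k e) (meanRun k e) ⟩
  runs e * preferences k e ∎)
  where
  open ≤-Reasoning
  lemma : ∀ k e → (1ℚ + (1ℚ + e)) * 1ℚ + (k + e * (1ℚ + (1ℚ + (k + e)))) ≡ (1ℚ + (1ℚ + e)) * (1ℚ + (k + e)) - k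
  lemma = solve-∀ ℚ-ring
  factor : ∀ r h a → r * h - r * a ≡ r * (h - a)
  factor = solve-∀ ℚ-ring

preferences-pos : ∀ k e → 0ℚ < preferences k e
preferences-pos k e = <-≤-trans (positive⁻¹ 1ℚ) (1≤preferences k e)

preferences⁻¹ : ℕ → ℕ → ℚ
preferences⁻¹ k e = inv (preferences k e) (preferences-pos k e)

-- This crude bound on a quantity u of order 1/h suffices, because products h u are rewritten as 1 +
-- a u by means of u (h - a) = 1.
preferences⁻¹≤1 : ∀ k e → preferences⁻¹ k e ≤ 1ℚ
preferences⁻¹≤1 k e = subst₂ _≤_ (*-identityʳ (preferences⁻¹ k e)) (inv-* (preferences k e) (preferences-pos k e))
  (*-mono-≤ˡ (preferences⁻¹ k e) (inv-nonNeg (preferences k e) (preferences-pos k e)) (1≤preferences k e))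

-- Substituting the mean k/(e + 3) makes the count factor, in agreement with the quotient of two
-- instances of `v-closed`; positivity and the lower bound of order h^2 can be read off.
runs*pairPreferences : ∀ k e → let h = spots (suc k) e in
  runs (suc e) * pairPreferences k e ≡ (1ℚ + ι e) * ((1ℚ + h) * (1ℚ + h))
runs*pairPreferences k e = begin
  R * (h * h - 2ℚ * h * a - 2ℚ * a - 1ℚ)
    ≡⟨ isolate R h a ⟩
  R * (h * h - 1ℚ) - 2ℚ * (1ℚ + h) * (R * a)
    ≡⟨ cong (λ x → R * (h * h - 1ℚ) - 2ℚ * (1ℚ + h) * x) (runs*meanRun k (suc e)) ⟩
  R * (h * h - 1ℚ) - 2ℚ * (1ℚ + h) * ι k
    ≡⟨ cong (λ h → R * (h * h - 1ℚ) - 2ℚ * (1ℚ + h) * ι k) (spots-split (suc k) e) ⟩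
  R * (h′ * h′ - 1ℚ) - 2ℚ * (1ℚ + h′) * ι k
    ≡⟨ factor (ι k) (ι e) ⟩
  (1ℚ + ι e) * ((1ℚ + h′) * (1ℚ + h′))
    ≡⟨ cong (λ h → (1ℚ + ι e) * ((1ℚ + h) * (1ℚ + h))) (spots-split (suc k) e) ⟨
  (1ℚ + ι e) * ((1ℚ + h) * (1ℚ + h)) ∎
  where
  open ≡-Reasoning
  R h h′ a : ℚ
  R = runs (suc e)
  h = spots (suc k) e
  h′ = 1ℚ + (ι (suc k) + ι e)
  a = meanRun k (suc e)
  isolate : ∀ r h a → r * (h * h - 2ℚ * h * a - 2ℚ * a - 1ℚ) ≡ r * (h * h - 1ℚ) - 2ℚ * (1ℚ + h) * (r * a)
  isolate = solve-∀ ℚ-ring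
  factor : ∀ k e → let h = 1ℚ + ((1ℚ + k) + e) in
    (1ℚ + (1ℚ + (1ℚ + e))) * (h * h - 1ℚ) - 2ℚ * (1ℚ + h) * k ≡ (1ℚ + e) * ((1ℚ + h) * (1ℚ + h))
  factor = solve-∀ ℚ-ring

pairPreferences-pos : ∀ k e → 0ℚ < pairPreferences k e
pairPreferences-pos k e = *-cancelˡ-pos (runs (suc e)) (ι-nonNeg (suc (suc (suc e))))
  (subst (0ℚ <_) (sym (runs*pairPreferences k e))
    (*-pos (ι-pos e) (*-pos (ι-pos (suc (suc k ℕ.+ e))) (ι-pos (suc (suc k ℕ.+ e))))))

-- The constant is the largest value of (e + 3)/(e + 1), attained at e = 0.
spots²≤3*pairPreferences : ∀ k e → spots (suc k) e * spots (suc k) e ≤ ι 3 * pairPreferences k e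
spots²≤3*pairPreferences k e = *-cancelˡ-≤ (runs (suc e)) (runs-pos (suc e)) (begin
  runs (suc e) * (h * h)
    ≤⟨ x≤x+y (runs (suc e) * (h * h)) (+-nonNeg (*-nonNeg (*-nonNeg (ι-nonNeg 2) (ι-nonNeg e)) (*-nonNeg 0≤h 0≤h))
         (*-nonNeg (*-nonNeg (ι-nonNeg 3) (ι-nonNeg (suc e))) (+-nonNeg (*-nonNeg (ι-nonNeg 2) 0≤h) 0≤1))) ⟩
  runs (suc e) * (h * h) + (ι 2 * ι e * (h * h) + ι 3 * ι (suc e) * (ι 2 * h + 1ℚ))
    ≡⟨ lemma h (ι e) ⟩
  ι 3 * ((1ℚ + ι e) * ((1ℚ + h) * (1ℚ + h)))
    ≡⟨ cong (ι 3 *_) (runs*pairPreferences k e) ⟨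
  ι 3 * (runs (suc e) * pairPreferences k e)
    ≡⟨ swap (ι 3) (runs (suc e)) (pairPreferences k e) ⟩
  runs (suc e) * (ι 3 * pairPreferences k e) ∎)
  where
  open ≤-Reasoning
  h : ℚ
  h = spots (suc k) e
  0≤h : 0ℚ ≤ h
  0≤h = ι-nonNeg (suc (suc k ℕ.+ e))
  lemma : ∀ h e → (1ℚ + (1ℚ + (1ℚ + e))) * (h * h) + (ι 2 * e * (h * h) + ι 3 * (1ℚ + e) * (ι 2 * h + 1ℚ)) ≡
    ι 3 * ((1ℚ + e) * ((1ℚ + h) * (1ℚ + h)))
  lemma = solve-∀ ℚ-ring
  swap : ∀ a b c → a * (b * c) ≡ b * (a * c)
  swap = solve-∀ ℚ-ring

pairPreferences⁻¹ : ℕ → ℕ → ℚ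
pairPreferences⁻¹ k e = inv (pairPreferences k e) (pairPreferences-pos k e)

weight⁻¹-nonNeg : ∀ k e → 0ℚ ≤ weight⁻¹ k e
weight⁻¹-nonNeg k e = inv-nonNeg (weight k e) (v-pos (suc e) k)

runMoment-nonNeg : ∀ r k e → 0ℚ ≤ runMoment r k e
runMoment-nonNeg r k e = *-nonNeg {weight⁻¹ k e} {(v e ⊛ moment r) k} (weight⁻¹-nonNeg k e)
  (⊛-nonNeg {v e} {moment r} (λ i → <⇒≤ (v-pos e i)) (λ l → *-nonNeg (pow-nonNeg r (ι-nonNeg l)) (b-nonNeg l)) k)

runMoment-≤ : ∀ {C} r k e → (v e ⊛ moment r) k ≤ C * weight k e → runMoment r k e ≤ C
runMoment-≤ {C} r k e bound = begin
  weight⁻¹ k e * (v e ⊛ moment r) k     ≤⟨ *-mono-≤ˡ (weight⁻¹ k e) (weight⁻¹-nonNeg k e) bound ⟩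
  weight⁻¹ k e * (C * weight k e)       ≡⟨ swap (weight⁻¹ k e) C (weight k e) ⟩
  weight k e * (weight⁻¹ k e * C)       ≡⟨ weight-weight⁻¹ k e C ⟩
  C                                     ∎
  where
  open ≤-Reasoning
  swap : ∀ i c w → i * (c * w) ≡ w * (i * c)
  swap = solve-∀ ℚ-ring

cancel-weight : ∀ k e u x → (weight⁻¹ k e * u) * (weight k e * x) ≡ u * x
cancel-weight k e u x = trans (lemma (weight⁻¹ k e) u (weight k e) x) (weight-weight⁻¹ k e (u * x))
  where
  lemma : ∀ i u w x → (i * u) * (w * x) ≡ w * (i * (u * x))
  lemma = solve-∀ ℚ-ring

module _ (k e : ℕ) where

  private
    n : ℕ
    n = suc (k ℕ.+ e)
    h i : ℚ
    h = spots k e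
    i = weight⁻¹ k e * preferences⁻¹ k e

  π-centred : ∀ {m} (j : Fin m) (ps : Vec (Fin n) m) →
    π j ps ≡ centred h (toℕ (lookup ps j)) + (½ * (h - 1ℚ) + 1ℚ)
  π-centred j ps = trans (ℕ→ℚ≡ι (suc (toℕ (lookup ps j)))) (lemma (ι (toℕ (lookup ps j))) h)
    where
    lemma : ∀ x h → 1ℚ + x ≡ x - ½ * (h - 1ℚ) + (½ * (h - 1ℚ) + 1ℚ)
    lemma = solve-∀ ℚ-ring

  PF-size⁻¹ : i * sumℚ (PF (suc k) n) (λ _ → 1ℚ) ≡ 1ℚ
  PF-size⁻¹ = begin
    i * sumℚ (PF (suc k) n) (λ _ → 1ℚ)        ≡⟨ cong (i *_) (trans (sumℚ-PF₀ (suc k) n) (total-park-one k e)) ⟩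
    i * (weight k e * preferences k e)        ≡⟨ cancel-weight k e (preferences⁻¹ k e) (preferences k e) ⟩
    preferences⁻¹ k e * preferences k e       ≡⟨ inv-* (preferences k e) (preferences-pos k e) ⟩
    1ℚ                                        ∎
    where open ≡-Reasoning

  mean-centred : i * total {n} k (park (centred h) all) ≡
    preferences⁻¹ k e * (½ * (runMoment 2 k e - h * meanRun k e))
  mean-centred = trans (cong (i *_) (total-park-centred k e)) (cancel-weight k e (preferences⁻¹ k e) _)

  Var-formula : Var (PF (suc k) n) (π zero) ≡
    preferences⁻¹ k e * (1/12 * (h * h * h - h) + (1/12 - ¼ * (h * h)) * meanRun k e
                         + ½ * h * runMoment 2 k e + (- ⅓) * runMoment 3 k e)
    - (preferences⁻¹ k e * (½ * (runMoment 2 k e - h * meanRun k e)))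
      * (preferences⁻¹ k e * (½ * (runMoment 2 k e - h * meanRun k e)))
  Var-formula = begin
    Var (PF (suc k) n) (π zero)
      ≡⟨ Cov-centred (PF (suc k) n) i PF-size⁻¹ (π zero) (π zero) X X (½ * (h - 1ℚ) + 1ℚ) (π-centred zero) (π-centred zero) ⟩
    i * sumℚ (PF (suc k) n) (λ ps → X ps * X ps) - (i * sumℚ (PF (suc k) n) X) * (i * sumℚ (PF (suc k) n) X)
      ≡⟨ cong₂ (λ x y → x - y * y)
           (trans (cong (i *_) (trans (sumℚ-PF₁ k n (λ p → centred h p * centred h p)) (total-park-centred² k e)))
                  (cancel-weight k e (preferences⁻¹ k e) _))
           (trans (cong (i *_) (sumℚ-PF₁ k n (centred h))) mean-centred) ⟩
    _ ∎
    where
    open ≡-Reasoning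
    X : Vec (Fin n) (suc k) → ℚ
    X ps = centred h (toℕ (lookup ps zero))

module _ (k e : ℕ) where

  private
    n : ℕ
    n = suc (suc k ℕ.+ e)
    h i : ℚ
    h = spots (suc k) e
    i = weight⁻¹ (suc k) e * preferences⁻¹ (suc k) e

  -- The same set of parking functions is counted by setting aside one car or two. The first count
  -- defines `i`, the second is `total-pair-one`, and comparing them changes the normalisation.
  cancel-pair-weight : ∀ x → i * (weight k (suc e) * x) ≡ pairPreferences⁻¹ k e * x
  cancel-pair-weight x = begin
    i * (w * x)                  ≡⟨ *-identityʳ (i * (w * x)) ⟨
    i * (w * x) * 1ℚ             ≡⟨ cong (i * (w * x) *_) (inv-* z (pairPreferences-pos k e)) ⟨
    i * (w * x) * (u * z)        ≡⟨ swap i w x u z ⟩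
    i * (w * z) * (u * x)        ≡⟨ cong (λ s → i * s * (u * x)) (trans (sumℚ-PF₀ (suc (suc k)) n) (total-pair-one k e)) ⟨
    i * sumℚ (PF (suc (suc k)) n) (λ _ → 1ℚ) * (u * x)  ≡⟨ cong (_* (u * x)) (PF-size⁻¹ (suc k) e) ⟩
    1ℚ * (u * x)                 ≡⟨ *-identityˡ (u * x) ⟩
    u * x                        ∎
    where
    open ≡-Reasoning
    w z u : ℚ
    w = weight k (suc e)
    z = pairPreferences k e
    u = pairPreferences⁻¹ k e
    swap : ∀ i w x u z → i * (w * x) * (u * z) ≡ i * (w * z) * (u * x)
    swap = solve-∀ ℚ-ring

  Cov-formula : Cov (PF (suc (suc k)) n) (π zero) (π (suc zero)) ≡
    pairPreferences⁻¹ k e * (¼ * (h * h) * (- (2ℚ * meanRun k (suc e) + 1ℚ))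
      + (¼ * h * pairMoment pair₁ k e + ¼ * pairMoment pair₀ k e))
    - (preferences⁻¹ (suc k) e * (½ * (runMoment 2 (suc k) e - h * meanRun (suc k) e)))
      * (preferences⁻¹ (suc k) e * (½ * (runMoment 2 (suc k) e - h * meanRun (suc k) e)))
  Cov-formula = begin
    Cov Ω (π zero) (π (suc zero))
      ≡⟨ Cov-centred Ω i (PF-size⁻¹ (suc k) e) (π zero) (π (suc zero)) X Y (½ * (h - 1ℚ) + 1ℚ)
           (π-centred (suc k) e zero) (π-centred (suc k) e (suc zero)) ⟩
    i * sumℚ Ω (λ ps → X ps * Y ps) - (i * sumℚ Ω X) * (i * sumℚ Ω Y)
      ≡⟨ cong₂ _-_
           (trans (cong (i *_) (trans (sumℚ-PF₂ k n (centred h) (centred h)) (total-pair-centred k e))) (cancel-pair-weight _))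
           (cong₂ _*_ (trans (cong (i *_) (sumℚ-PF₁ (suc k) n (centred h))) (mean-centred (suc k) e))
                      (trans (cong (i *_) second) (mean-centred (suc k) e))) ⟩
    _ ∎
    where
    open ≡-Reasoning
    Ω = PF (suc (suc k)) n
    X Y : Vec (Fin n) (suc (suc k)) → ℚ
    X ps = centred h (toℕ (lookup ps zero))
    Y ps = centred h (toℕ (lookup ps (suc zero)))
    -- Giving the first car weight 1 makes it one of the unweighted cars, so the second car has the
    -- mean of the first.
    second : sumℚ Ω Y ≡ total {n} (suc k) (park (centred h) all)
    second = trans (sumℚ-cong Ω (λ ps → sym (*-identityˡ (Y ps)))) (sumℚ-PF₂ k n one (centred h))

-- Asymptotics; κ-fix makes κ = 1 / (1 - c) and γ = c / (1 - c), the limit of the mean run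

module _ (c κ : ℚ) (0≤c : 0ℚ ≤ c) (0≤κ : 0ℚ ≤ κ) (κ-fix : 1ℚ + c * κ ≡ κ) where

  private
    γ : ℚ
    γ = c * κ

  -- The street before the last d of the c n cars are parked.

  record Street (d : ℕ) : Set where
    field
      cars gaps : ℕ
      density   : ι (d ℕ.+ cars) ≡ c * spots cars gaps

  module _ {d : ℕ} where

    open Street

    slope : Street d → ℚ
    slope s = spots (cars s) (gaps s) * (meanRun (cars s) (gaps s) - γ)

    -- Obtained by eliminating c h and the gaps through d + k = c h and (e + 2) a = k. The right
    -- side is nonpositive, which yields `meanRun≤γ`; then it is bounded, so the mean run differs
    -- from γ by O(1/h).
    slope-formula : ∀ (s : Street d) → slope s ≡ - (κ * (ι d + (1ℚ + ι d) * meanRun (cars s) (gaps s)))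
    slope-formula s = begin
      h * (a - c * κ)
        ≡⟨ step₁ h a c κ ⟩
      h * a * ((1ℚ + c * κ) - c * κ) - κ * (c * h)
        ≡⟨ cong (λ x → h * a * (x - c * κ) - κ * (c * h)) κ-fix ⟩
      h * a * (κ - c * κ) - κ * (c * h)
        ≡⟨ step₂ h a c κ ⟩
      κ * (h * a - c * h * a) - κ * (c * h)
        ≡⟨ cong₂ (λ x y → κ * (x * a - y * a) - κ * y) (spots-split (cars s) (gaps s))
                 (trans (sym (density s)) (ι-+ d (cars s))) ⟩
      κ * ((1ℚ + (ι k + ι e)) * a - (ι d + ι k) * a) - κ * (ι d + ι k)
        ≡⟨ step₃ κ a (ι k) (ι e) (ι d) ⟩
      κ * (runs e * a - a - ι d * a) - κ * (ι d + ι k)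
        ≡⟨ cong (λ x → κ * (x - a - ι d * a) - κ * (ι d + ι k)) (runs*meanRun k e) ⟩
      κ * (ι k - a - ι d * a) - κ * (ι d + ι k)
        ≡⟨ step₄ κ a (ι k) (ι d) ⟩
      - (κ * (ι d + (1ℚ + ι d) * a)) ∎
      where
      open ≡-Reasoning
      k e : ℕ
      k = cars s
      e = gaps s
      h a : ℚ
      h = spots k e
      a = meanRun k e
      step₁ : ∀ h a c κ → h * (a - c * κ) ≡ h * a * ((1ℚ + c * κ) - c * κ) - κ * (c * h)
      step₁ = solve-∀ ℚ-ring
      step₂ : ∀ h a c κ → h * a * (κ - c * κ) - κ * (c * h) ≡ κ * (h * a - c * h * a) - κ * (c * h)
      step₂ = solve-∀ ℚ-ring
      step₃ : ∀ κ a k e d → κ * ((1ℚ + (k + e)) * a - (d + k) * a) - κ * (d + k) ≡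
        κ * ((1ℚ + (1ℚ + e)) * a - a - d * a) - κ * (d + k)
      step₃ = solve-∀ ℚ-ring
      step₄ : ∀ κ a k d → κ * (k - a - d * a) - κ * (d + k) ≡ - (κ * (d + (1ℚ + d) * a))
      step₄ = solve-∀ ℚ-ring

    meanRun-nonNeg : ∀ (s : Street d) → 0ℚ ≤ meanRun (cars s) (gaps s)
    meanRun-nonNeg s = *-nonNeg (ι-nonNeg (cars s)) (inv-nonNeg (runs (gaps s)) (runs-pos (gaps s)))

    meanRun≤γ : ∀ (s : Street d) → meanRun (cars s) (gaps s) ≤ γ
    meanRun≤γ s = subst₂ _≤_ (cancel γ a) (+-identityʳ γ) (+-monoʳ-≤ γ
      (*-cancelˡ-≤ h (ι-pos (cars s ℕ.+ gaps s)) (subst₂ _≤_ (sym (slope-formula s)) (sym (*-zeroʳ h))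
        (neg-antimono-≤ (*-nonNeg 0≤κ (+-nonNeg (ι-nonNeg d) (*-nonNeg (ι-nonNeg (suc d)) (meanRun-nonNeg s))))))))
      where
      h a : ℚ
      h = spots (cars s) (gaps s)
      a = meanRun (cars s) (gaps s)
      cancel : ∀ g a → g + (a - g) ≡ a
      cancel = solve-∀ ℚ-ring

    meanRun-bounded : Bounded {Street d} (λ s → meanRun (cars s) (gaps s))
    meanRun-bounded = bounded-between γ meanRun-nonNeg meanRun≤γ

    slope-bounded : Bounded slope
    slope-bounded = bounded-≡
      (bounded-neg (bounded-* (bounded-const κ)
        (bounded-+ (bounded-const (ι d)) (bounded-* (bounded-const (1ℚ + ι d)) meanRun-bounded))))
      slope-formula

    preferences⁻¹-bounded : Bounded {Street d} (λ s → preferences⁻¹ (cars s) (gaps s))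
    preferences⁻¹-bounded = bounded-between 1ℚ
      (λ s → inv-nonNeg (preferences (cars s) (gaps s)) (preferences-pos (cars s) (gaps s)))
      (λ s → preferences⁻¹≤1 (cars s) (gaps s))

    sparse : ∀ (s : Street d) → ι (cars s) ≤ c * ι (suc (suc (cars s ℕ.+ gaps s)))
    sparse s = begin
      ι (cars s)                             ≤⟨ x≤y+x (ι (cars s)) (ι-nonNeg d) ⟩
      ι d + ι (cars s)                       ≡⟨ ι-+ d (cars s) ⟨
      ι (d ℕ.+ cars s)                       ≡⟨ density s ⟩
      c * spots (cars s) (gaps s)            ≤⟨ *-mono-≤ˡ c 0≤c (x≤y+x (spots (cars s) (gaps s)) 0≤1) ⟩
      c * (1ℚ + spots (cars s) (gaps s))     ∎
      where open ≤-Reasoning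

    runMoment-bounded : ∀ r → Bounded {Street d} (λ s → runMoment r (cars s) (gaps s))
    runMoment-bounded r = bounded-between (proj₁ (moments-bounded c κ 0≤κ κ-fix r))
      (λ s → runMoment-nonNeg r (cars s) (gaps s))
      (λ s → runMoment-≤ r (cars s) (gaps s) (proj₂ (moments-bounded c κ 0≤κ κ-fix r) (cars s) (gaps s) (sparse s)))

  open Street

  Var-error : Street 1 → ℚ
  Var-error s = let h = spots (cars s) (gaps s) in
    Var (PF (suc (cars s)) (suc (cars s ℕ.+ gaps s))) (π zero) - (1/12 * (h * h) - ⅙ * γ * h)

  Var-error-bounded : Bounded Var-error
  Var-error-bounded = bounded-≡
    (bounded-- (bounded-+ (bounded-* (bounded-const (- ⅙)) slope-bounded)
      (bounded-+ (bounded-* (bounded-const 1/12) (bounded-- (bounded-+ a² (bounded-* a² au)) (bounded-+ (bounded-const 1ℚ) au)))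
      (bounded-+ (bounded-- (bounded-* (bounded-const ½) (bounded-* (bounded-+ (bounded-const 1ℚ) au) (runMoment-bounded 2)))
                            (bounded-* (bounded-const ⅓) (bounded-* preferences⁻¹-bounded (runMoment-bounded 3))))
                 (bounded-- (bounded-* (bounded-const 1/12) au)
                            (bounded-* (bounded-const ¼) (bounded-+ a² (bounded-* a² au)))))))
      (bounded-* (bounded-const ¼) (bounded-* X X)))
    formula
    where
    au = bounded-* meanRun-bounded preferences⁻¹-bounded
    a² = bounded-* meanRun-bounded meanRun-bounded
    X = bounded-- (bounded-* (bounded-+ (bounded-const 1ℚ) au) meanRun-bounded)
                  (bounded-* preferences⁻¹-bounded (runMoment-bounded 2))
    -- Products h u are replaced by 1 + a u, under which the centred mean becomes -x/2. `remainder`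
    -- collects the bounded terms left over from the second moment. `quotient` is the cofactor of u
    -- (h - a) - 1, which makes `identity` a polynomial identity without side condition.
    remainder quotient : ℚ → ℚ → ℚ → ℚ → ℚ → ℚ
    remainder h u a p q =
      (1/12 * (a * a + a * a * (a * u) - (1ℚ + a * u))
        + (½ * ((1ℚ + a * u) * p) - ⅓ * (u * q) + (1/12 * (a * u) - ¼ * (a * a + a * a * (a * u)))))
    quotient h u a p q = let x = (1ℚ + a * u) * a - u * p in
      1/12 * (h * h + a * h + a * a - 1ℚ) - ¼ * (a * (h + a)) + ½ * p - ¼ * (a * (u * (h * a - p) + x))
    identity : ∀ h u a p q γ → let x = (1ℚ + a * u) * a - u * p in
      u * (1/12 * (h * h * h - h) + (1/12 - ¼ * (h * h)) * a + ½ * h * p + (- ⅓) * q)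
        - (u * (½ * (p - h * a))) * (u * (½ * (p - h * a))) - (1/12 * (h * h) - ⅙ * γ * h) ≡
      (- ⅙) * (h * (a - γ)) + (1/12 * (a * a + a * a * (a * u) - (1ℚ + a * u))
        + (½ * ((1ℚ + a * u) * p) - ⅓ * (u * q) + (1/12 * (a * u) - ¼ * (a * a + a * a * (a * u)))))
        - ¼ * (x * x)
      + (u * (h - a) - 1ℚ) * (1/12 * (h * h + a * h + a * a - 1ℚ) - ¼ * (a * (h + a)) + ½ * p
                              - ¼ * (a * (u * (h * a - p) + x)))
    identity = solve-∀ ℚ-ring
    reduce : ∀ h u a p q γ → u * (h - a) ≡ 1ℚ → let x = (1ℚ + a * u) * a - u * p in
      u * (1/12 * (h * h * h - h) + (1/12 - ¼ * (h * h)) * a + ½ * h * p + (- ⅓) * q)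
        - (u * (½ * (p - h * a))) * (u * (½ * (p - h * a))) - (1/12 * (h * h) - ⅙ * γ * h) ≡
      (- ⅙) * (h * (a - γ)) + remainder h u a p q - ¼ * (x * x)
    reduce h u a p q γ uz≡1 = let x = (1ℚ + a * u) * a - u * p in trans (identity h u a p q γ)
      (trans (cong (λ y → (- ⅙) * (h * (a - γ)) + remainder h u a p q - ¼ * (x * x) + (y - 1ℚ) * quotient h u a p q) uz≡1)
             (vanish ((- ⅙) * (h * (a - γ)) + remainder h u a p q - ¼ * (x * x)) (quotient h u a p q)))
      where
      vanish : ∀ x q → x + (1ℚ - 1ℚ) * q ≡ x
      vanish = solve-∀ ℚ-ring
    formula : ∀ (s : Street 1) → Var-error s ≡
      (let h = spots (cars s) (gaps s) ; u = preferences⁻¹ (cars s) (gaps s) ; a = meanRun (cars s) (gaps s)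
           p = runMoment 2 (cars s) (gaps s) ; q = runMoment 3 (cars s) (gaps s) ; x = (1ℚ + a * u) * a - u * p in
       (- ⅙) * (h * (a - γ)) + remainder h u a p q - ¼ * (x * x))
    formula s = let k = cars s ; e = gaps s ; h = spots k e ; u = preferences⁻¹ k e in
      trans (cong (_- (1/12 * (h * h) - ⅙ * γ * h)) (Var-formula k e))
            (reduce h u (meanRun k e) (runMoment 2 k e) (runMoment 3 k e) γ (inv-* (preferences k e) (preferences-pos k e)))

-- The covariance error

module _ (c κ : ℚ) (0≤c : 0ℚ ≤ c) (0≤κ : 0ℚ ≤ κ) (κ-fix : 1ℚ + c * κ ≡ κ) where

  private
    γ : ℚ
    γ = c * κ

  -- The covariance mixes moments with two cars set aside and with one, so a common index is needed
  -- from which both streets are derived; their numbers of spots agree.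
  record PairStreet : Set where
    field
      cars gaps : ℕ
      density   : ι (2 ℕ.+ cars) ≡ c * spots (suc cars) gaps

  open PairStreet

  withoutOne : PairStreet → Street c κ 0≤c 0≤κ κ-fix 1
  withoutOne s = record { cars = suc (cars s) ; gaps = gaps s ; density = density s }

  withoutBoth : PairStreet → Street c κ 0≤c 0≤κ κ-fix 2
  withoutBoth s = record { cars = cars s ; gaps = suc (gaps s)
    ; density = trans (density s) (cong (λ n → c * ι (suc n)) (sym (ℕ.+-suc (cars s) (gaps s)))) }

  private
    h u₁ u₂ a₁ a₂ p₁ f₀ f₁ : PairStreet → ℚ
    h s = spots (suc (cars s)) (gaps s)
    u₁ s = preferences⁻¹ (suc (cars s)) (gaps s)
    u₂ s = pairPreferences⁻¹ (cars s) (gaps s)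
    a₁ s = meanRun (suc (cars s)) (gaps s)
    a₂ s = meanRun (cars s) (suc (gaps s))
    p₁ s = runMoment 2 (suc (cars s)) (gaps s)
    f₀ s = pairMoment pair₀ (cars s) (gaps s)
    f₁ s = pairMoment pair₁ (cars s) (gaps s)

    0≤u₂ : ∀ s → 0ℚ ≤ u₂ s
    0≤u₂ s = inv-nonNeg (pairPreferences (cars s) (gaps s)) (pairPreferences-pos (cars s) (gaps s))
    0≤h : ∀ s → 0ℚ ≤ h s
    0≤h s = ι-nonNeg (suc (suc (cars s) ℕ.+ gaps s))
    0≤hu₂ : ∀ s → 0ℚ ≤ h s * u₂ s
    0≤hu₂ s = *-nonNeg {h s} {u₂ s} (0≤h s) (0≤u₂ s)

    hhu₂≤3 : ∀ s → h s * (h s * u₂ s) ≤ ι 3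
    hhu₂≤3 s = begin
      h s * (h s * u₂ s)         ≡⟨ *-assoc (h s) (h s) (u₂ s) ⟨
      h s * h s * u₂ s           ≤⟨ *-mono-≤ʳ (u₂ s) (0≤u₂ s) (spots²≤3*pairPreferences (cars s) (gaps s)) ⟩
      ι 3 * z * u₂ s             ≡⟨ swap (ι 3) z (u₂ s) ⟩
      ι 3 * (u₂ s * z)           ≡⟨ cong (ι 3 *_) (inv-* z (pairPreferences-pos (cars s) (gaps s))) ⟩
      ι 3 * 1ℚ                   ≡⟨ *-identityʳ (ι 3) ⟩
      ι 3                        ∎
      where
      open ≤-Reasoning
      z : ℚ
      z = pairPreferences (cars s) (gaps s)
      swap : ∀ a b c → a * b * c ≡ a * (c * b)
      swap = solve-∀ ℚ-ring

    hu₂≤3 : ∀ s → h s * u₂ s ≤ ι 3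
    hu₂≤3 s = begin
      h s * u₂ s                 ≡⟨ *-identityˡ (h s * u₂ s) ⟨
      1ℚ * (h s * u₂ s)          ≤⟨ *-mono-≤ʳ (h s * u₂ s) (0≤hu₂ s) (1≤spots (suc (cars s)) (gaps s)) ⟩
      h s * (h s * u₂ s)         ≤⟨ hhu₂≤3 s ⟩
      ι 3                        ∎
      where open ≤-Reasoning

    hhu₂-bounded : Bounded (λ s → h s * (h s * u₂ s))
    hhu₂-bounded = bounded-between (ι 3) (λ s → *-nonNeg {h s} {h s * u₂ s} (0≤h s) (0≤hu₂ s)) hhu₂≤3

    hu₂-bounded : Bounded (λ s → h s * u₂ s)
    hu₂-bounded = bounded-between (ι 3) 0≤hu₂ hu₂≤3

    u₁-bounded : Bounded u₁
    u₁-bounded = bounded-∘ withoutOne (preferences⁻¹-bounded c κ 0≤c 0≤κ κ-fix)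

    a₁-bounded : Bounded a₁
    a₁-bounded = bounded-∘ withoutOne (meanRun-bounded c κ 0≤c 0≤κ κ-fix)

    p₁-bounded : Bounded p₁
    p₁-bounded = bounded-∘ withoutOne (runMoment-bounded c κ 0≤c 0≤κ κ-fix 2)

    slope₁-bounded : Bounded (λ s → h s * (a₁ s - γ))
    slope₁-bounded = bounded-∘ withoutOne (slope-bounded c κ 0≤c 0≤κ κ-fix)

    a₂-bounded : Bounded a₂
    a₂-bounded = bounded-∘ withoutBoth (meanRun-bounded c κ 0≤c 0≤κ κ-fix)

    slope₂-bounded : Bounded (λ s → h s * (a₂ s - γ))
    slope₂-bounded = bounded-≡ {g = λ s → slope c κ 0≤c 0≤κ κ-fix (withoutBoth s)}
      (bounded-∘ withoutBoth (slope-bounded c κ 0≤c 0≤κ κ-fix))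
      (λ s → cong (λ n → ι (suc n) * (a₂ s - γ)) (sym (ℕ.+-suc (cars s) (gaps s))))

    quartic-bounded : Bounded (λ s → ι 64 + ι 72 * runMoment 4 (cars s) (suc (gaps s)))
    quartic-bounded = bounded-+ (bounded-const (ι 64)) (bounded-* (bounded-const (ι 72))
      (bounded-∘ withoutBoth (runMoment-bounded c κ 0≤c 0≤κ κ-fix 4)))

    pairMoment-bounded : ∀ {f} C → 0ℚ ≤ C → (∀ {x y} → 0ℚ ≤ x → 0ℚ ≤ y → ∣ f x y ∣ ≤ C * quartic x y) →
      Bounded (λ s → pairMoment f (cars s) (gaps s))
    pairMoment-bounded {f} C 0≤C f≤ = bounded-≤ (bounded-* (bounded-const C) quartic-bounded)
      (λ s → pairMoment-bound {f} C 0≤C f≤ (cars s) (gaps s))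

    f₁-bounded : Bounded f₁
    f₁-bounded = pairMoment-bounded {pair₁} 2ℚ (ι-nonNeg 2) pair₁-bound

    f₀-bounded : Bounded f₀
    f₀-bounded = pairMoment-bounded {pair₀} 1ℚ 0≤1
      (λ {x} {y} 0≤x 0≤y → subst (∣ pair₀ x y ∣ ≤_) (sym (*-identityˡ (quartic x y))) (pair₀-bound 0≤x 0≤y))

  Cov-error : PairStreet → ℚ
  Cov-error s =
    Cov (PF (suc (suc (cars s))) (suc (suc (cars s) ℕ.+ gaps s))) (π zero) (π (suc zero)) - (- (¼ * (κ * κ)))

  private
    -- The centred mean is -(a₁ + r)/2, by u₁ (h - a₁) = 1. The same relation shows that h r is
    -- bounded, so r is a correction of order 1/h.
    r hr : PairStreet → ℚ
    r s = u₁ s * (a₁ s * a₁ s - p₁ s)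
    hr s = h s * r s

    r-bounded : Bounded r
    r-bounded = bounded-* u₁-bounded (bounded-- (bounded-* a₁-bounded a₁-bounded) p₁-bounded)

    hr-bounded : Bounded hr
    hr-bounded = bounded-≡
      (bounded-* (bounded-+ (bounded-const 1ℚ) (bounded-* a₁-bounded u₁-bounded))
                 (bounded-- (bounded-* a₁-bounded a₁-bounded) p₁-bounded))
      (λ s → trans (expand (h s) (u₁ s) (a₁ s) (p₁ s))
         (cong (λ y → (y + a₁ s * u₁ s) * (a₁ s * a₁ s - p₁ s))
               (inv-* (preferences (suc (cars s)) (gaps s)) (preferences-pos (suc (cars s)) (gaps s)))))
      where
      expand : ∀ h u a p → h * (u * (a * a - p)) ≡ (u * (h - a) + a * u) * (a * a - p)
      expand = solve-∀ ℚ-ring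

    -- `main` is h times the error, with κ written as 1 + γ. In `remainder` the powers of h are
    -- absorbed into the bounded families h (a - γ), h^2 u₂, h u₂ and h r. The cofactors `quotient₁`
    -- and `quotient₂` belong to the defining relations of u₁ and u₂.
    main remainder : (h u₁ u₂ a₁ a₂ p₁ f₁ f₀ γ : ℚ) → ℚ
    main h u₁ u₂ a₁ a₂ p₁ f₁ f₀ γ =
      h * (u₂ * (¼ * (h * h) * (- (2ℚ * a₂ + 1ℚ)) + (¼ * h * f₁ + ¼ * f₀))
           - (u₁ * (½ * (p₁ - h * a₁))) * (u₁ * (½ * (p₁ - h * a₁))) - (- (¼ * ((1ℚ + γ) * (1ℚ + γ)))))
    remainder h u₁ u₂ a₁ a₂ p₁ f₁ f₀ γ =
      (- ½) * (h * (a₂ - γ))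
      - ¼ * ((2ℚ * a₂ + 1ℚ) * (2ℚ * a₂ * (h * (h * u₂)) + (2ℚ * a₂ + 1ℚ) * (h * u₂)))
      + ¼ * (h * (h * u₂) * f₁ + h * u₂ * f₀)
      - ¼ * (h * (a₁ - γ) * (a₁ + γ)
             + (2ℚ * a₁ + u₁ * (a₁ * a₁ - p₁)) * (h * (u₁ * (a₁ * a₁ - p₁))))

    quotient₁ : (h u a p : ℚ) → ℚ
    quotient₁ h u a p = - (¼ * (h * a * (u * (h * a - p) + (a + u * (a * a - p)))))
    quotient₂ : (h a : ℚ) → ℚ
    quotient₂ h a = - (¼ * ((2ℚ * a + 1ℚ) * h))

    identity : ∀ h u₁ u₂ a₁ a₂ p₁ f₁ f₀ γ →
      h * (u₂ * (¼ * (h * h) * (- (2ℚ * a₂ + 1ℚ)) + (¼ * h * f₁ + ¼ * f₀))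
           - (u₁ * (½ * (p₁ - h * a₁))) * (u₁ * (½ * (p₁ - h * a₁))) - (- (¼ * ((1ℚ + γ) * (1ℚ + γ))))) ≡
      ((- ½) * (h * (a₂ - γ))
      - ¼ * ((2ℚ * a₂ + 1ℚ) * (2ℚ * a₂ * (h * (h * u₂)) + (2ℚ * a₂ + 1ℚ) * (h * u₂)))
      + ¼ * (h * (h * u₂) * f₁ + h * u₂ * f₀)
      - ¼ * (h * (a₁ - γ) * (a₁ + γ)
             + (2ℚ * a₁ + u₁ * (a₁ * a₁ - p₁)) * (h * (u₁ * (a₁ * a₁ - p₁)))))
      + (u₁ * (h - a₁) - 1ℚ) * (- (¼ * (h * a₁ * (u₁ * (h * a₁ - p₁) + (a₁ + u₁ * (a₁ * a₁ - p₁))))))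
      + (u₂ * (h * h - 2ℚ * h * a₂ - 2ℚ * a₂ - 1ℚ) - 1ℚ) * (- (¼ * ((2ℚ * a₂ + 1ℚ) * h)))
    identity = solve-∀ ℚ-ring

    reduce : ∀ h u₁ u₂ a₁ a₂ p₁ f₁ f₀ γ → u₁ * (h - a₁) ≡ 1ℚ → u₂ * (h * h - 2ℚ * h * a₂ - 2ℚ * a₂ - 1ℚ) ≡ 1ℚ →
      main h u₁ u₂ a₁ a₂ p₁ f₁ f₀ γ ≡ remainder h u₁ u₂ a₁ a₂ p₁ f₁ f₀ γ
    reduce h u₁ u₂ a₁ a₂ p₁ f₁ f₀ γ uz₁ uz₂ =
      trans (identity h u₁ u₂ a₁ a₂ p₁ f₁ f₀ γ)
        (trans (cong₂ (λ x y → R + (x - 1ℚ) * Q₁ + (y - 1ℚ) * Q₂) uz₁ uz₂) (vanish R Q₁ Q₂))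
      where
      R Q₁ Q₂ : ℚ
      R = remainder h u₁ u₂ a₁ a₂ p₁ f₁ f₀ γ
      Q₁ = quotient₁ h u₁ a₁ p₁
      Q₂ = quotient₂ h a₂
      vanish : ∀ r x y → r + (1ℚ - 1ℚ) * x + (1ℚ - 1ℚ) * y ≡ r
      vanish = solve-∀ ℚ-ring

    formula : ∀ s → h s * Cov-error s ≡ remainder (h s) (u₁ s) (u₂ s) (a₁ s) (a₂ s) (p₁ s) (f₁ s) (f₀ s) γ
    formula s = trans
      (cong₂ (λ x y → h s * (x - (- (¼ * (y * y))))) (Cov-formula (cars s) (gaps s)) (sym κ-fix))
      (reduce (h s) (u₁ s) (u₂ s) (a₁ s) (a₂ s) (p₁ s) (f₁ s) (f₀ s) γ
        (inv-* (preferences (suc (cars s)) (gaps s)) (preferences-pos (suc (cars s)) (gaps s)))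
        (inv-* (pairPreferences (cars s) (gaps s)) (pairPreferences-pos (cars s) (gaps s))))

  Cov-error-bounded : Bounded (λ s → spots (suc (cars s)) (gaps s) * Cov-error s)
  Cov-error-bounded = bounded-≡
    (bounded-- (bounded-+ (bounded-- (bounded-* (bounded-const (- ½)) slope₂-bounded)
      (bounded-* (bounded-const ¼) (bounded-* 2a₂+1 (bounded-+ (bounded-* 2a₂ hhu₂-bounded) (bounded-* 2a₂+1 hu₂-bounded)))))
      (bounded-* (bounded-const ¼) (bounded-+ (bounded-* hhu₂-bounded f₁-bounded) (bounded-* hu₂-bounded f₀-bounded))))
      (bounded-* (bounded-const ¼) (bounded-+ (bounded-* slope₁-bounded (bounded-+ a₁-bounded (bounded-const γ)))
        (bounded-* (bounded-+ (bounded-* (bounded-const 2ℚ) a₁-bounded) r-bounded) hr-bounded))))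
    formula
    where
    2a₂ = bounded-* (bounded-const 2ℚ) a₂-bounded
    2a₂+1 = bounded-+ 2a₂ (bounded-const 1ℚ)

-- Passage to the limits

open import Data.Integer.Base using (+_)

module _ (c : ℚ) (0<c : 0ℚ < c) (c<1 : c < 1ℚ) where

  open Constants c c<1

  private
    0<1-c : 0ℚ < 1ℚ - c
    0<1-c = positive⁻¹ (1ℚ - c)
    0≤c : 0ℚ ≤ c
    0≤c = <⇒≤ 0<c
    κ : ℚ
    κ = inv (1ℚ - c) 0<1-c
    0≤κ : 0ℚ ≤ κ
    0≤κ = inv-nonNeg (1ℚ - c) 0<1-c
    κ-fix : 1ℚ + c * κ ≡ κ
    κ-fix = trans (cong (λ x → x + c * κ) (sym (inv-* (1ℚ - c) 0<1-c))) (lemma κ c)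
      where
      lemma : ∀ κ c → κ * (1ℚ - c) + c * κ ≡ κ
      lemma = solve-∀ ℚ-ring

  c/6[1-c]≡ : c/6[1-c] ≡ ⅙ * (c * κ)
  c/6[1-c]≡ = *-cancelˡ-≡ d (*-pos {ℕ→ℚ 6} {1ℚ - c} (positive⁻¹ (ℕ→ℚ 6)) 0<1-c) (begin
    d * (c * (1/ d) {{6[1-c]-nonZero}})     ≡⟨ swap d c ((1/ d) {{6[1-c]-nonZero}}) ⟩
    c * ((1/ d) {{6[1-c]-nonZero}} * d)     ≡⟨ cong (c *_) (*-inverseˡ d {{6[1-c]-nonZero}}) ⟩
    c * 1ℚ                                  ≡⟨ cong (c *_) (inv-* (1ℚ - c) 0<1-c) ⟨
    c * (κ * (1ℚ - c))                      ≡⟨ collect c κ ⟩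
    d * (⅙ * (c * κ))                       ∎)
    where
    open ≡-Reasoning
    d : ℚ
    d = ℕ→ℚ 6 * (1ℚ - c)
    swap : ∀ d c x → d * (c * x) ≡ c * (x * d)
    swap = solve-∀ ℚ-ring
    collect : ∀ c κ → c * (κ * (1ℚ - c)) ≡ ℕ→ℚ 6 * (1ℚ - c) * (⅙ * (c * κ))
    collect = solve-∀ ℚ-ring

  1/4[1-c]²≡ : 1/4[1-c]² ≡ ¼ * (κ * κ)
  1/4[1-c]²≡ = *-cancelˡ-≡ d (*-pos {ℕ→ℚ 4} {(1ℚ - c) * (1ℚ - c)} (positive⁻¹ (ℕ→ℚ 4)) (*-pos 0<1-c 0<1-c)) (begin
    d * (1ℚ * (1/ d) {{4[1-c]²-nonZero}})   ≡⟨ swap d ((1/ d) {{4[1-c]²-nonZero}}) ⟩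
    (1/ d) {{4[1-c]²-nonZero}} * d          ≡⟨ *-inverseˡ d {{4[1-c]²-nonZero}} ⟩
    1ℚ * 1ℚ                                 ≡⟨ cong₂ _*_ (inv-* (1ℚ - c) 0<1-c) (inv-* (1ℚ - c) 0<1-c) ⟨
    κ * (1ℚ - c) * (κ * (1ℚ - c))           ≡⟨ collect c κ ⟩
    d * (¼ * (κ * κ))                       ∎)
    where
    open ≡-Reasoning
    d : ℚ
    d = ℕ→ℚ 4 * ((1ℚ - c) * (1ℚ - c))
    swap : ∀ d x → d * (1ℚ * x) ≡ x * d
    swap = solve-∀ ℚ-ring
    collect : ∀ c κ → κ * (1ℚ - c) * (κ * (1ℚ - c)) ≡ ℕ→ℚ 4 * ((1ℚ - c) * (1ℚ - c)) * (¼ * (κ * κ))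
    collect = solve-∀ ℚ-ring

  cars≤spots : ∀ m n → ι m ≡ c * ι n → m ℕ.≤ n
  cars≤spots m n density with m ℕ.≤? n
  ... | yes m≤n = m≤n
  ... | no  m≰n = ⊥-elim (<-irrefl refl (<-≤-trans n<m (begin
    ι m         ≡⟨ density ⟩
    c * ι n     ≤⟨ *-mono-≤ʳ (ι n) (ι-nonNeg n) (<⇒≤ c<1) ⟩
    1ℚ * ι n    ≡⟨ *-identityˡ (ι n) ⟩
    ι n         ∎)))
    where
    open ≤-Reasoning
    n<m : ι n < ι m
    n<m = <-≤-trans (subst (_< 1ℚ + ι n) (+-identityˡ (ι n)) (+-monoˡ-< (ι n) (positive⁻¹ 1ℚ)))
                    (ι-mono (ℕ.≰⇒> m≰n))

  eventually : ∀ C {ε} → 0ℚ < ε → ∃[ N ] (∀ n → N ℕ.≤ n → C ≤ ε * ι n)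
  eventually C {ε} 0<ε with archimedean (inv ε 0<ε * C)
  ... | N , bound = N , λ n N≤n → begin
    C                       ≡⟨ *-identityˡ C ⟨
    1ℚ * C                  ≡⟨ cong (_* C) (inv-* ε 0<ε) ⟨
    inv ε 0<ε * ε * C       ≡⟨ swap (inv ε 0<ε) ε C ⟩
    ε * (inv ε 0<ε * C)     ≤⟨ *-mono-≤ˡ ε (<⇒≤ 0<ε) (≤-trans bound (ι-mono N≤n)) ⟩
    ε * ι n                 ∎
    where
    open ≤-Reasoning
    swap : ∀ i e x → i * e * x ≡ e * (i * x)
    swap = solve-∀ ℚ-ring

  variance-limit : ∀ ε → 0ℚ < ε → ∃[ N ] (∀ n k → N ℕ.≤ n → ℕ→ℚ (suc k) ≡ c * ℕ→ℚ n →
    ∣ Var (PF (suc k) n) (π zero) - ((+ 1 / 12) * (ℕ→ℚ n * ℕ→ℚ n) - c/6[1-c] * ℕ→ℚ n) ∣ ≤ ε * ℕ→ℚ n)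
  variance-limit ε 0<ε = proj₁ N,large , λ n k N≤n density →
    let density′ = subst₂ (λ x y → x ≡ c * y) (ℕ→ℚ≡ι (suc k)) (ℕ→ℚ≡ι n) density in
    subst₂ (λ x y → ∣ Var (PF (suc k) n) (π zero) - ((+ 1 / 12) * (x * x) - y * x) ∣ ≤ ε * x)
      (sym (ℕ→ℚ≡ι n)) (sym c/6[1-c]≡)
      (go n k (n ℕ.∸ suc k) N≤n (ℕ.m+[n∸m]≡n (cars≤spots (suc k) n density′)) density′)
    where
    open Bounded (Var-error-bounded c κ 0≤c 0≤κ κ-fix)
    N,large : ∃[ N ] (∀ n → N ℕ.≤ n → bound ≤ ε * ι n)
    N,large = eventually bound 0<ε
    -- The gap count n - m is generalised to `e`, so that matching on the equation puts the street
    -- into the form required by `Street`.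
    go : ∀ n k e → proj₁ N,large ℕ.≤ n → suc k ℕ.+ e ≡ n → ι (suc k) ≡ c * ι n →
      ∣ Var (PF (suc k) n) (π zero) - (1/12 * (ι n * ι n) - ⅙ * (c * κ) * ι n) ∣ ≤ ε * ι n
    go n k e N≤n refl density =
      ≤-trans (bounded record { cars = k ; gaps = e ; density = density }) (proj₂ N,large n N≤n)

  covariance-limit : ∀ ε → 0ℚ < ε → ∃[ N ] (∀ n k → N ℕ.≤ n → ℕ→ℚ (suc (suc k)) ≡ c * ℕ→ℚ n →
    ∣ Cov (PF (suc (suc k)) n) (π zero) (π (suc zero)) - (- 1/4[1-c]²) ∣ ≤ ε)
  covariance-limit ε 0<ε = proj₁ N,large , λ n k N≤n density →
    let density′ = subst₂ (λ x y → x ≡ c * y) (ℕ→ℚ≡ι (suc (suc k))) (ℕ→ℚ≡ι n) density in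
    subst (λ y → ∣ Cov (PF (suc (suc k)) n) (π zero) (π (suc zero)) - (- y) ∣ ≤ ε) (sym 1/4[1-c]²≡)
      (go n k (n ℕ.∸ suc (suc k)) N≤n (ℕ.m+[n∸m]≡n (cars≤spots (suc (suc k)) n density′)) density′)
    where
    open Bounded (Cov-error-bounded c κ 0≤c 0≤κ κ-fix)
    N,large : ∃[ N ] (∀ n → N ℕ.≤ n → bound ≤ ε * ι n)
    N,large = eventually bound 0<ε
    descale : ∀ n x → bound ≤ ε * ι (suc n) → ∣ ι (suc n) * x ∣ ≤ bound → ∣ x ∣ ≤ ε
    descale n x bound≤ ≤bound = *-cancelˡ-≤ (ι (suc n)) (ι-pos n) (begin
      ι (suc n) * ∣ x ∣        ≡⟨ cong (_* ∣ x ∣) (0≤p⇒∣p∣≡p (ι-nonNeg (suc n))) ⟨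
      ∣ ι (suc n) ∣ * ∣ x ∣    ≡⟨ ∣p*q∣≡∣p∣*∣q∣ (ι (suc n)) x ⟨
      ∣ ι (suc n) * x ∣        ≤⟨ ≤bound ⟩
      bound                    ≤⟨ bound≤ ⟩
      ε * ι (suc n)            ≡⟨ *-comm ε (ι (suc n)) ⟩
      ι (suc n) * ε            ∎)
      where open ≤-Reasoning
    go : ∀ n k e → proj₁ N,large ℕ.≤ n → suc (suc k) ℕ.+ e ≡ n → ι (suc (suc k)) ≡ c * ι n →
      ∣ Cov (PF (suc (suc k)) n) (π zero) (π (suc zero)) - (- (¼ * (κ * κ))) ∣ ≤ ε
    go n k e N≤n refl density = let s = record { cars = k ; gaps = e ; density = density } in
      descale (suc k ℕ.+ e) (Cov-error c κ 0≤c 0≤κ κ-fix s) (proj₂ N,large n N≤n) (bounded s)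

proposition3p5 : (c : ℚ) (0<c : 0ℚ < c) (c<1 : c < 1ℚ) →
    let open Constants c c<1 in
    (∀ (ε : ℚ) → 0ℚ < ε →
    ∃[ N ] (∀ (n k : ℕ) → N ℕ.≤ n →
    let m = suc k in
    ℕ→ℚ m ≡ c * ℕ→ℚ n →
    ∣ Var (PF m n) (π zero)
    - ((+ 1 / 12) * (ℕ→ℚ n * ℕ→ℚ n) - c/6[1-c] * ℕ→ℚ n) ∣
    ≤ ε * ℕ→ℚ n))
    ×
    (∀ (ε : ℚ) → 0ℚ < ε →
    ∃[ N ] (∀ (n k : ℕ) → N ℕ.≤ n →
    let m = suc (suc k) in
    ℕ→ℚ m ≡ c * ℕ→ℚ n →
    ∣ Cov (PF m n) (π zero) (π (suc zero)) - (- 1/4[1-c]²) ∣ ≤ ε))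
proposition3p5 c 0<c c<1 = variance-limit c 0<c c<1 , covariance-limit c 0<c c<1
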